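{- For any integer $m\geq 1$, there exist a simplicial $(4m+2)$-polytope $P\subset\mathbb{R}^{4m+2}$ with $\partial P\in S(2m,4m+1)$, and a $2m$-face of $P$ that does not participate in any affine $(2m+1)$-stress on $(\partial P,p)$, where $p$ is the natural embedding of $\partial P$.
   Context: A missing face of a simplicial complex is a set of vertices that is not a face but all of whose proper subsets are faces; its dimension is its cardinality minus $1$. $S(j,d-1)$ denotes the set of $\mathbb{Z}/2\mathbb{Z}$-homology $(d-1)$-spheres all of whose missing faces have dimension at most $j$ (boundary complexes of simplicial $d$-polytopes are such spheres of dimension $d-1$). $\partial P$ is the boundary complex of the simplicial polytope $P$, an abstract simplicial complex on the vertices of $P$. Its natural embedding $p$ sends each vertex to its position vector in $\mathbb{R}^d$ ($d=\dim P$). Let $\Delta$ be a $(d-1)$-dimensional simplicial complex with vertex set $V$ and $p:V\to\mathbb{R}^d$. In $\mathbb{R}[x_v:v\in V]$, let $\theta_j=\sum_v p(v)_jx_v$ ($1\le j\le d$) and $c=\sum_v x_v$; for a linear form $\ell=\sum\ell_vx_v$ let $\partial_\ell=\sum_v\ell_v\,\partial/\partial x_v$. An affine $k$-stress on $(\Delta,p)$ is a homogeneous polynomial $\lambda\in\mathbb{R}[x_v:v\in V]$ of degree $k$ such that every monomial $\mu$ appearing in $\lambda$ with nonzero coefficient has support $\mathrm{supp}(\mu)=\{v:x_v\mid\mu\}\in\Delta$, $\partial_{\theta_i}\lambda=0$ for all $i=1,\dots,d$, and $\partial_c\lambda=0$. A face $\tau$ participates in a stress $\omega$ if some monomial $\mu$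 with nonzero coefficient in $\omega$ satisfies $\tau\subseteq\mathrm{supp}(\mu)$. -}

module Defs where

open import Level using (0ℓ)
open import Algebra.Bundles using (AbelianGroup; CommutativeRing)
open import Algebra.Bundles.Raw using (RawMonoid)
import Algebra.Construct.Terminal as Terminal
import Algebra.Definitions.RawMonoid as RawMonoidDefs
open import Algebra.Morphism.Structures using (module GroupMorphisms)
import Algebra.Properties.CommutativeMonoid.Sum as CommutativeMonoidSum
import Algebra.Properties.CommutativeSemigroup as CommutativeSemigroupProperties
open import Data.Bool.Base using (Bool; true; false; if_then_else_; _xor_)
import Data.Bool.Properties as Bool
open import Data.Fin.Base using (Fin)
open import Data.Fin.Subset
  using (Subset; Side; inside; outside; ⊥; ⊤; ⁅_⁆; _∈_; _∉_; _⊆_; _⊂_; _∩_; _∪_; ∣_∣)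
open import Data.Fin.Subset.Properties using (_∈?_)
open import Data.Integer.Base as ℤ using (ℤ; +_)
import Data.Integer.Properties as ℤ
open import Data.Nat.Base as ℕ using (ℕ; zero; suc)
import Data.Nat.Properties as ℕ
open import Data.Product.Base using (∃; ∃-syntax; _×_; _,_; proj₁; proj₂)
open import Data.Rational.Base as ℚ using (ℚ; 0ℚ; 1ℚ)
import Data.Rational.Properties as ℚ
open import Data.Rational.Solver using (module +-*-Solver)
open import Data.Vec.Base as Vec using (Vec; lookup; _[_]%=_)
open import Function.Bundles using (_⇔_)
open import Relation.Binary.PropositionalEquality
  using (_≡_; _≢_; refl; sym; trans; cong; cong₂; subst; module ≡-Reasoning)
open import Relation.Nullary using (¬_; does)
open import Relation.Unary using (Pred)

------------------------------------------------------------------------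
-- Real numbers: Cantor's construction from Cauchy sequences of
-- rationals, as a type with an explicit equality _≈_.

IsCauchy : (ℕ → ℚ) → Set
IsCauchy x = ∀ ε → 0ℚ ℚ.< ε → ∃[ N ] ∀ k l → N ℕ.≤ k → N ℕ.≤ l →
  ℚ.∣ x k ℚ.- x l ∣ ℚ.< ε

record ℝ : Set where
  constructor mkℝ
  field
    seq    : ℕ → ℚ
    cauchy : IsCauchy seq

open ℝ public

infix 4 _≈_ _≤_

_≈_ : ℝ → ℝ → Set
x ≈ y = ∀ ε → 0ℚ ℚ.< ε → ∃[ N ] ∀ k → N ℕ.≤ k → ℚ.∣ seq x k ℚ.- seq y k ∣ ℚ.< ε

_≤_ : ℝ → ℝ → Set
x ≤ y = ∀ ε → 0ℚ ℚ.< ε → ∃[ N ] ∀ k → N ℕ.≤ k → seq x k ℚ.≤ seq y k ℚ.+ ε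

sum-difference : ∀ a b c d → (a ℚ.+ b) ℚ.- (c ℚ.+ d) ≡ (a ℚ.- c) ℚ.+ (b ℚ.- d)
sum-difference = solve 4 (λ a b c d → (a :+ b) :- (c :+ d) := (a :- c) :+ (b :- d)) refl
  where open +-*-Solver

product-difference : ∀ a b c d → a ℚ.* b ℚ.- c ℚ.* d ≡ a ℚ.* (b ℚ.- d) ℚ.+ d ℚ.* (a ℚ.- c)
product-difference = solve 4 (λ a b c d → a :* b :- c :* d := a :* (b :- d) :+ d :* (a :- c)) refl
  where open +-*-Solver

add-back : ∀ a b → a ≡ (a ℚ.- b) ℚ.+ b
add-back = solve 2 (λ a b → a := (a :- b) :+ b) refl
  where open +-*-Solver

0<½ε : ∀ {ε} → 0ℚ ℚ.< ε → 0ℚ ℚ.< ℚ.½ ℚ.* ε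
0<½ε {ε} 0<ε = subst (ℚ._< ℚ.½ ℚ.* ε) (ℚ.*-zeroʳ ℚ.½) (ℚ.*-monoʳ-<-pos ℚ.½ 0<ε)

½ε+½ε≡ε : ∀ ε → ℚ.½ ℚ.* ε ℚ.+ ℚ.½ ℚ.* ε ≡ ε
½ε+½ε≡ε ε = trans (sym (ℚ.*-distribʳ-+ ε ℚ.½ ℚ.½)) (ℚ.*-identityˡ ε)

const-cauchy : ∀ q → IsCauchy (λ _ → q)
const-cauchy q ε 0<ε = 0 , λ _ _ _ _ →
  subst (λ r → ℚ.∣ r ∣ ℚ.< ε) (sym (ℚ.+-inverseʳ q)) 0<ε

+-cauchy : ∀ {x y} → IsCauchy x → IsCauchy y → IsCauchy (λ k → x k ℚ.+ y k)
+-cauchy {x} {y} cx cy ε 0<ε = M ℕ.⊔ N , bound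
  where
  M = proj₁ (cx (ℚ.½ ℚ.* ε) (0<½ε 0<ε))
  N = proj₁ (cy (ℚ.½ ℚ.* ε) (0<½ε 0<ε))

  bound : ∀ k l → M ℕ.⊔ N ℕ.≤ k → M ℕ.⊔ N ℕ.≤ l →
          ℚ.∣ (x k ℚ.+ y k) ℚ.- (x l ℚ.+ y l) ∣ ℚ.< ε
  bound k l k≥ l≥ = begin-strict
    ℚ.∣ (x k ℚ.+ y k) ℚ.- (x l ℚ.+ y l) ∣      ≡⟨ cong ℚ.∣_∣ (sum-difference (x k) (y k) (x l) (y l)) ⟩
    ℚ.∣ (x k ℚ.- x l) ℚ.+ (y k ℚ.- y l) ∣      ≤⟨ ℚ.∣p+q∣≤∣p∣+∣q∣ (x k ℚ.- x l) (y k ℚ.- y l) ⟩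
    ℚ.∣ x k ℚ.- x l ∣ ℚ.+ ℚ.∣ y k ℚ.- y l ∣    <⟨ ℚ.+-mono-<
      (proj₂ (cx _ (0<½ε 0<ε)) k l (ℕ.m⊔n≤o⇒m≤o M N k≥) (ℕ.m⊔n≤o⇒m≤o M N l≥))
      (proj₂ (cy _ (0<½ε 0<ε)) k l (ℕ.m⊔n≤o⇒n≤o M N k≥) (ℕ.m⊔n≤o⇒n≤o M N l≥)) ⟩
    ℚ.½ ℚ.* ε ℚ.+ ℚ.½ ℚ.* ε                    ≡⟨ ½ε+½ε≡ε ε ⟩
    ε                                          ∎
    where open ℚ.≤-Reasoning

eventually-bounded : ∀ {x} → IsCauchy x →
  ∃[ B ] (0ℚ ℚ.< B × ∃[ N ] ∀ k → N ℕ.≤ k → ℚ.∣ x k ∣ ℚ.≤ B)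
eventually-bounded {x} cx = 1ℚ ℚ.+ ℚ.∣ x N ∣ , 0<B , N , bound
  where
  0<1 : 0ℚ ℚ.< 1ℚ
  0<1 = ℚ.positive⁻¹ 1ℚ

  N = proj₁ (cx 1ℚ 0<1)

  0<B : 0ℚ ℚ.< 1ℚ ℚ.+ ℚ.∣ x N ∣
  0<B = ℚ.+-mono-<-≤ 0<1 (ℚ.0≤∣p∣ (x N))

  bound : ∀ k → N ℕ.≤ k → ℚ.∣ x k ∣ ℚ.≤ 1ℚ ℚ.+ ℚ.∣ x N ∣
  bound k k≥ = begin
    ℚ.∣ x k ∣                              ≡⟨ cong ℚ.∣_∣ (add-back (x k) (x N)) ⟩
    ℚ.∣ (x k ℚ.- x N) ℚ.+ x N ∣            ≤⟨ ℚ.∣p+q∣≤∣p∣+∣q∣ (x k ℚ.- x N) (x N) ⟩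
    ℚ.∣ x k ℚ.- x N ∣ ℚ.+ ℚ.∣ x N ∣        ≤⟨ ℚ.+-monoˡ-≤ ℚ.∣ x N ∣
      (ℚ.<⇒≤ (proj₂ (cx 1ℚ 0<1) k N k≥ ℕ.≤-refl)) ⟩
    1ℚ ℚ.+ ℚ.∣ x N ∣                       ∎
    where open ℚ.≤-Reasoning

product-bound : ∀ {a b B δ} → 0ℚ ℚ.< B → ℚ.∣ a ∣ ℚ.≤ B → ℚ.∣ b ∣ ℚ.< δ →
                ℚ.∣ a ℚ.* b ∣ ℚ.< B ℚ.* δ
product-bound {a} {b} {B} {δ} 0<B a≤B b<δ = begin-strict
  ℚ.∣ a ℚ.* b ∣          ≡⟨ ℚ.∣p*q∣≡∣p∣*∣q∣ a b ⟩
  ℚ.∣ a ∣ ℚ.* ℚ.∣ b ∣    ≤⟨ ℚ.*-monoʳ-≤-nonNeg ℚ.∣ b ∣ {{ℚ.∣-∣-nonNeg b}} a≤B ⟩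
  B ℚ.* ℚ.∣ b ∣          <⟨ ℚ.*-monoʳ-<-pos B {{ℚ.positive 0<B}} b<δ ⟩
  B ℚ.* δ                ∎
  where open ℚ.≤-Reasoning

product-difference-bound : ∀ {a a′ b b′ B C δ} → 0ℚ ℚ.< B → 0ℚ ℚ.< C →
  ℚ.∣ a ∣ ℚ.≤ B → ℚ.∣ b′ ∣ ℚ.≤ C →
  ℚ.∣ a ℚ.- a′ ∣ ℚ.< δ → ℚ.∣ b ℚ.- b′ ∣ ℚ.< δ →
  ℚ.∣ a ℚ.* b ℚ.- a′ ℚ.* b′ ∣ ℚ.< (B ℚ.+ C) ℚ.* δ
product-difference-bound {a} {a′} {b} {b′} {B} {C} {δ} 0<B 0<C a≤B b′≤C Δa Δb = begin-strict
  ℚ.∣ a ℚ.* b ℚ.- a′ ℚ.* b′ ∣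
    ≡⟨ cong ℚ.∣_∣ (product-difference a b a′ b′) ⟩
  ℚ.∣ a ℚ.* (b ℚ.- b′) ℚ.+ b′ ℚ.* (a ℚ.- a′) ∣
    ≤⟨ ℚ.∣p+q∣≤∣p∣+∣q∣ (a ℚ.* (b ℚ.- b′)) (b′ ℚ.* (a ℚ.- a′)) ⟩
  ℚ.∣ a ℚ.* (b ℚ.- b′) ∣ ℚ.+ ℚ.∣ b′ ℚ.* (a ℚ.- a′) ∣
    <⟨ ℚ.+-mono-< (product-bound {a} {b ℚ.- b′} 0<B a≤B Δb)
                  (product-bound {b′} {a ℚ.- a′} 0<C b′≤C Δa) ⟩
  B ℚ.* δ ℚ.+ C ℚ.* δ
    ≡⟨ ℚ.*-distribʳ-+ δ B C ⟨
  (B ℚ.+ C) ℚ.* δ ∎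
  where open ℚ.≤-Reasoning

divide : ∀ {D ε} → 0ℚ ℚ.< D → 0ℚ ℚ.< ε → ∃[ δ ] (0ℚ ℚ.< δ × D ℚ.* δ ≡ ε)
divide {D} {ε} 0<D 0<ε = D⁻¹ ℚ.* ε , 0<δ , Dδ≡ε
  where
  instance
    D⁺ : ℚ.Positive D
    D⁺ = ℚ.positive 0<D
    D≢0 : ℚ.NonZero D
    D≢0 = ℚ.pos⇒nonZero D

  D⁻¹ = ℚ.1/ D

  0<δ : 0ℚ ℚ.< D⁻¹ ℚ.* ε
  0<δ = subst (ℚ._< D⁻¹ ℚ.* ε) (ℚ.*-zeroʳ D⁻¹)
              (ℚ.*-monoʳ-<-pos D⁻¹ {{ℚ.1/pos⇒pos D}} 0<ε)

  Dδ≡ε : D ℚ.* (D⁻¹ ℚ.* ε) ≡ ε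
  Dδ≡ε = trans (sym (ℚ.*-assoc D D⁻¹ ε))
               (trans (cong (ℚ._* ε) (ℚ.*-inverseʳ D)) (ℚ.*-identityˡ ε))

*-cauchy : ∀ {x y} → IsCauchy x → IsCauchy y → IsCauchy (λ k → x k ℚ.* y k)
*-cauchy {x} {y} cx cy ε 0<ε =
  let B , 0<B , K , x≤B = eventually-bounded cx
      C , 0<C , L , y≤C = eventually-bounded cy
      δ , 0<δ , [B+C]δ≡ε = divide (ℚ.+-mono-< 0<B 0<C) 0<ε
      M , Δx = cx δ 0<δ
      N , Δy = cy δ 0<δ
  in (K ℕ.⊔ L) ℕ.⊔ (M ℕ.⊔ N) , λ k l k≥ l≥ →
    let k≥KL = ℕ.m⊔n≤o⇒m≤o (K ℕ.⊔ L) (M ℕ.⊔ N) k≥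
        k≥MN = ℕ.m⊔n≤o⇒n≤o (K ℕ.⊔ L) (M ℕ.⊔ N) k≥
        l≥KL = ℕ.m⊔n≤o⇒m≤o (K ℕ.⊔ L) (M ℕ.⊔ N) l≥
        l≥MN = ℕ.m⊔n≤o⇒n≤o (K ℕ.⊔ L) (M ℕ.⊔ N) l≥
    in subst (ℚ.∣ x k ℚ.* y k ℚ.- x l ℚ.* y l ∣ ℚ.<_) [B+C]δ≡ε
         (product-difference-bound {x k} {x l} {y k} {y l} {B} {C} {δ} 0<B 0<C
           (x≤B k (ℕ.m⊔n≤o⇒m≤o K L k≥KL)) (y≤C l (ℕ.m⊔n≤o⇒n≤o K L l≥KL))
           (Δx k l (ℕ.m⊔n≤o⇒m≤o M N k≥MN) (ℕ.m⊔n≤o⇒m≤o M N l≥MN))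
           (Δy k l (ℕ.m⊔n≤o⇒n≤o M N k≥MN) (ℕ.m⊔n≤o⇒n≤o M N l≥MN)))

-- Abstract, so that conversion checking of reals never unfolds the
-- proofs above.
abstract
  const-isCauchy : ∀ q → IsCauchy (λ _ → q)
  const-isCauchy = const-cauchy

  +-isCauchy : ∀ {x y} → IsCauchy x → IsCauchy y → IsCauchy (λ k → x k ℚ.+ y k)
  +-isCauchy {x} {y} = +-cauchy {x} {y}

  *-isCauchy : ∀ {x y} → IsCauchy x → IsCauchy y → IsCauchy (λ k → x k ℚ.* y k)
  *-isCauchy {x} {y} = *-cauchy {x} {y}

fromℚ : ℚ → ℝ
fromℚ q = mkℝ (λ _ → q) (const-isCauchy q)

0ℝ 1ℝ : ℝ
0ℝ = fromℚ 0ℚ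
1ℝ = fromℚ 1ℚ

infixl 6 _+_
infixl 7 _*_

_+_ : ℝ → ℝ → ℝ
x + y = mkℝ (λ k → seq x k ℚ.+ seq y k) (+-isCauchy {seq x} {seq y} (cauchy x) (cauchy y))

_*_ : ℝ → ℝ → ℝ
x * y = mkℝ (λ k → seq x k ℚ.* seq y k) (*-isCauchy {seq x} {seq y} (cauchy x) (cauchy y))

+-rawMonoid : RawMonoid 0ℓ 0ℓ
+-rawMonoid = record { Carrier = ℝ ; _≈_ = _≈_ ; _∙_ = _+_ ; ε = 0ℝ }

open RawMonoidDefs +-rawMonoid public using (sum) renaming (_×_ to _·ℕ_)

------------------------------------------------------------------------
-- Simplicial complexes

-- A family of subsets of the vertex set Fin n; it need not be a complex.
Family : ℕ → Set₁
Family n = Pred (Subset n) 0ℓ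

dim : ∀ {n} → Subset n → ℤ
dim σ = + ∣ σ ∣ ℤ.- ℤ.1ℤ

record IsSimplicialComplex {n} (Δ : Family n) : Set where
  field
    ∅-face      : Δ ⊥
    vertex-face : ∀ v → Δ ⁅ v ⁆
    down-closed : ∀ {σ τ} → τ ⊆ σ → Δ σ → Δ τ

IsMissingFace : ∀ {n} → Family n → Subset n → Set
IsMissingFace Δ σ = ¬ Δ σ × (∀ τ → τ ⊂ σ → Δ τ)

link : ∀ {n} → Family n → Subset n → Family n
link Δ σ τ = (τ ∩ σ ≡ ⊥) × Δ (τ ∪ σ)

------------------------------------------------------------------------
-- Reduced simplicial homology with coefficients in ℤ/2ℤ

module ℤ/2 = CommutativeRing Bool.xor-∧-commutativeRing

ℤ/2ℤ : AbelianGroup 0ℓ 0ℓ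
ℤ/2ℤ = ℤ/2.+-abelianGroup

sum₂ : ∀ {n} → (Fin n → Bool) → Bool
sum₂ = CommutativeMonoidSum.sum ℤ/2.+-commutativeMonoid

-- The coefficient of τ in the boundary of Σ_σ c(σ)·σ is the sum of the
-- coefficients c(τ ∪ {v}) over all v ∉ τ.
boundary : ∀ {n} → (Subset n → Bool) → (Subset n → Bool)
boundary c τ = sum₂ λ v → if does (v ∈? τ) then false else c (τ ∪ ⁅ v ⁆)

-- Degree i = -1 is included (its only possible face is ∅), so that the
-- homology below is reduced.
IsChain : ∀ {n} → ℤ → Family n → (Subset n → Bool) → Set
IsChain i Δ c = ∀ σ → c σ ≡ true → Δ σ × dim σ ≡ i

record Cycle {n} (i : ℤ) (Δ : Family n) : Set where
  field
    chain   : Subset n → Bool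
    isChain : IsChain i Δ chain
    closed  : ∀ τ → boundary chain τ ≡ false

open Cycle public

Homologous : ∀ {n i} {Δ : Family n} → Cycle i Δ → Cycle i Δ → Set
Homologous {n} {i} {Δ} z w = ∃[ b ] IsChain (ℤ.suc i) Δ b ×
  (∀ τ → boundary b τ ≡ chain z τ xor chain w τ)

xor-⊎ : ∀ {A : Set} (x y : Bool) → (x ≡ true → A) → (y ≡ true → A) → x xor y ≡ true → A
xor-⊎ true  _    f g _ = f refl
xor-⊎ false true f g _ = g refl

xor-chain : ∀ {n i} {Δ : Family n} {b c} → IsChain i Δ b → IsChain i Δ c →
            IsChain i Δ (λ σ → b σ xor c σ)
xor-chain {Δ = Δ} {b} {c} hb hc σ = xor-⊎ (b σ) (c σ) (hb σ) (hc σ)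

boundary-xor : ∀ {n} (b c : Subset n → Bool) τ →
               boundary (λ σ → b σ xor c σ) τ ≡ boundary b τ xor boundary c τ
boundary-xor b c τ = trans (sum-cong-≗ pointwise)
  (∑-distrib-+ (λ v → if does (v ∈? τ) then false else b (τ ∪ ⁅ v ⁆))
               (λ v → if does (v ∈? τ) then false else c (τ ∪ ⁅ v ⁆)))
  where
  open CommutativeMonoidSum ℤ/2.+-commutativeMonoid using (sum-cong-≗; ∑-distrib-+)
  pointwise : ∀ v →
    (if does (v ∈? τ) then false else (b (τ ∪ ⁅ v ⁆) xor c (τ ∪ ⁅ v ⁆))) ≡
    (if does (v ∈? τ) then false else b (τ ∪ ⁅ v ⁆)) xor
    (if does (v ∈? τ) then false else c (τ ∪ ⁅ v ⁆))
  pointwise v with does (v ∈? τ)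
  ... | true  = refl
  ... | false = refl

boundary-0 : ∀ {n} (τ : Subset n) → boundary (λ _ → false) τ ≡ false
boundary-0 {n} τ = trans (sum-cong-≗ pointwise) (sum-replicate-zero n)
  where
  open CommutativeMonoidSum ℤ/2.+-commutativeMonoid using (sum-cong-≗; sum-replicate-zero)
  pointwise : ∀ v → (if does (v ∈? τ) then false else false) ≡ false
  pointwise v with does (v ∈? τ)
  ... | true  = refl
  ... | false = refl

module _ {n} {i : ℤ} {Δ : Family n} where

  _⊞_ : Cycle i Δ → Cycle i Δ → Cycle i Δ
  z ⊞ w = record
    { chain   = λ σ → chain z σ xor chain w σ
    ; isChain = xor-chain {b = chain z} {chain w} (isChain z) (isChain w)
    ; closed  = λ τ → trans (boundary-xor (chain z) (chain w) τ)
                            (cong₂ _xor_ (closed z τ) (closed w τ))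
    }

  0-cycle : Cycle i Δ
  0-cycle = record { chain = λ _ → false ; isChain = λ _ () ; closed = boundary-0 }

  ≗⇒Homologous : (z w : Cycle i Δ) → (∀ σ → chain z σ ≡ chain w σ) → Homologous z w
  ≗⇒Homologous z w z≗w = (λ _ → false) , (λ _ ()) , λ τ →
    trans (boundary-0 τ)
          (sym (trans (cong (_xor chain w τ) (z≗w τ)) (Bool.xor-same (chain w τ))))

  Homologous-sym : (z w : Cycle i Δ) → Homologous z w → Homologous w z
  Homologous-sym z w (b , hb , ∂b) =
    b , hb , λ τ → trans (∂b τ) (Bool.xor-comm (chain z τ) (chain w τ))

  Homologous-trans : (z w u : Cycle i Δ) → Homologous z w → Homologous w u → Homologous z u
  Homologous-trans z w u (b , hb , ∂b) (c , hc , ∂c) =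
    (λ σ → b σ xor c σ) , xor-chain {b = b} {c} hb hc , λ τ →
    trans (boundary-xor b c τ)
          (trans (cong₂ _xor_ (∂b τ) (∂c τ))
                 (cancel (chain z τ) (chain w τ) (chain u τ)))
    where
    cancel : ∀ x y t → (x xor y) xor (y xor t) ≡ x xor t
    cancel false false t     = refl
    cancel false true  false = refl
    cancel false true  true  = refl
    cancel true  false t     = refl
    cancel true  true  t     = refl

  ⊞-cong : (z z′ w w′ : Cycle i Δ) → Homologous z z′ → Homologous w w′ →
           Homologous (z ⊞ w) (z′ ⊞ w′)
  ⊞-cong z z′ w w′ (b , hb , ∂b) (c , hc , ∂c) =
    (λ σ → b σ xor c σ) , xor-chain {b = b} {c} hb hc , λ τ →
    trans (boundary-xor b c τ)
          (trans (cong₂ _xor_ (∂b τ) (∂c τ))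
                 (interchange (chain z τ) (chain z′ τ) (chain w τ) (chain w′ τ)))
    where
    open CommutativeSemigroupProperties ℤ/2.+-commutativeSemigroup using (interchange)

H̃ : ∀ {n} → ℤ → Family n → AbelianGroup 0ℓ 0ℓ
H̃ i Δ = record
  { Carrier = Cycle i Δ
  ; _≈_     = Homologous
  ; _∙_     = _⊞_
  ; ε       = 0-cycle
  ; _⁻¹     = λ z → z
  ; isAbelianGroup = record
    { isGroup = record
      { isMonoid = record
        { isSemigroup = record
          { isMagma = record
            { isEquivalence = record
              { refl  = λ {z} → ≗⇒Homologous z z (λ _ → refl)
              ; sym   = λ {z w} → Homologous-sym z w
              ; trans = λ {z w u} → Homologous-trans z w u
              }
            ; ∙-cong = λ {z z′ w w′} → ⊞-cong z z′ w w′
            }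
          ; assoc = λ z w u → ≗⇒Homologous ((z ⊞ w) ⊞ u) (z ⊞ (w ⊞ u))
              (λ σ → Bool.xor-assoc (chain z σ) (chain w σ) (chain u σ))
          }
        ; identity = (λ z → ≗⇒Homologous (0-cycle ⊞ z) z (λ _ → refl))
                   , (λ z → ≗⇒Homologous (z ⊞ 0-cycle) z (λ σ → Bool.xor-identityʳ (chain z σ)))
        }
      ; inverse = (λ z → ≗⇒Homologous (z ⊞ z) 0-cycle (λ σ → Bool.xor-same (chain z σ)))
                , (λ z → ≗⇒Homologous (z ⊞ z) 0-cycle (λ σ → Bool.xor-same (chain z σ)))
      ; ⁻¹-cong = λ z∼w → z∼w
      }
    ; comm = λ z w → ≗⇒Homologous (z ⊞ w) (w ⊞ z) (λ σ → Bool.xor-comm (chain z σ) (chain w σ))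
    }
  }

infix 4 _≅_

_≅_ : AbelianGroup 0ℓ 0ℓ → AbelianGroup 0ℓ 0ℓ → Set
G ≅ H = ∃ (GroupMorphisms.IsGroupIsomorphism (AbelianGroup.rawGroup G) (AbelianGroup.rawGroup H))

-- H̃ᵢ of the e-dimensional sphere; S⁻¹ is the empty space.
H̃-sphere : ℤ → ℤ → AbelianGroup 0ℓ 0ℓ
H̃-sphere i e = if does (i ℤ.≟ e) then ℤ/2ℤ else Terminal.abelianGroup

-- The link of every face (∅ included) has the homology of a sphere of
-- dimension e − |σ|.
record IsHomologySphere {n} (e : ℤ) (Δ : Family n) : Set where
  field
    isSimplicialComplex : IsSimplicialComplex Δ
    dim≤e               : ∀ σ → Δ σ → dim σ ℤ.≤ e
    dim-attained        : ∃[ σ ] (Δ σ × dim σ ≡ e)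
    link-homology       : ∀ σ → Δ σ → ∀ i → H̃ i (link Δ σ) ≅ H̃-sphere i (e ℤ.- + ∣ σ ∣)

S : ∀ {n} → ℕ → ℕ → Family n → Set
S j e Δ = IsHomologySphere (+ e) Δ × (∀ σ → IsMissingFace Δ σ → dim σ ℤ.≤ + j)

------------------------------------------------------------------------
-- Polytopes

Point : ℕ → Set
Point d = Fin d → ℝ

infix 4 _≋_

_≋_ : ∀ {d} → Point d → Point d → Set
x ≋ y = ∀ j → x j ≈ y j

dot : ∀ {d} → Point d → Point d → ℝ
dot a x = sum λ j → a j * x j

combination : ∀ {n d} → (Fin n → ℝ) → (Fin n → Point d) → Point d
combination t p j = sum λ i → t i * p i j

AffineHull : ∀ {n d} → (Fin n → Point d) → Pred (Point d) 0ℓ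
AffineHull p x = ∃[ t ] (sum t ≈ 1ℝ × combination t p ≋ x)

ConvexHull : ∀ {n d} → (Fin n → Point d) → Pred (Point d) 0ℓ
ConvexHull p x = ∃[ t ] ((∀ i → 0ℝ ≤ t i) × sum t ≈ 1ℝ × combination t p ≋ x)

IsValid : ∀ {d} → Pred (Point d) 0ℓ → Point d → ℝ → Set
IsValid P a b = ∀ x → P x → dot a x ≤ b

IsVertex : ∀ {d} → Pred (Point d) 0ℓ → Point d → Set
IsVertex P v = P v × ∃[ a ] ∃[ b ] (IsValid P a b × dot a v ≈ b ×
  (∀ x → P x → dot a x ≈ b → x ≋ v))

-- σ is the vertex set of the face {x ∈ P : a·x = b} of P = conv p, for a
-- valid inequality a·x ≤ b, and this face is not P itself.  The empty
-- face arises from a = 0, b = 1.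
IsProperFace : ∀ {n d} → (Fin n → Point d) → Family n
IsProperFace p σ = σ ≢ ⊤ × ∃[ a ] ∃[ b ] (IsValid (ConvexHull p) a b ×
  (∀ i → i ∈ σ ⇔ dot a (p i) ≈ b))

AffinelyIndependent : ∀ {n d} → (Fin n → Point d) → Subset n → Set
AffinelyIndependent p σ = ∀ t → (∀ i → i ∉ σ → t i ≈ 0ℝ) →
  sum t ≈ 0ℝ → combination t p ≋ (λ _ → 0ℝ) → ∀ i → t i ≈ 0ℝ

-- A full-dimensional polytope in ℝᵈ all of whose proper faces are
-- simplices, given as the convex hull of its vertices.
record SimplicialPolytope (d : ℕ) : Set where
  field
    #vertices        : ℕ
    vertex           : Fin #vertices → Point d
    vertex-injective : ∀ i j → vertex i ≋ vertex j → i ≡ j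
    isVertex         : ∀ i → IsVertex (ConvexHull vertex) (vertex i)
    full-dimensional : ∀ x → AffineHull vertex x
    simplicial       : ∀ σ → IsProperFace vertex σ → AffinelyIndependent vertex σ

open SimplicialPolytope public

∂ : ∀ {d} (P : SimplicialPolytope d) → Family (#vertices P)
∂ P = IsProperFace (vertex P)

------------------------------------------------------------------------
-- Stresses

-- The monomial Π_v x_v^(μ_v).
Monomial : ℕ → Set
Monomial n = Vec ℕ n

degree : ∀ {n} → Monomial n → ℕ
degree = Vec.sum

side : ℕ → Side
side zero    = outside
side (suc _) = inside

supp : ∀ {n} → Monomial n → Subset n
supp = Vec.map side

-- A polynomial in ℝ[x_v : v ∈ Fin n] is given by its coefficients.
-- Stresses are homogeneous, so their support is automatically finite.
Poly : ℕ → Set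
Poly n = Monomial n → ℝ

LinearForm : ℕ → Set
LinearForm n = Fin n → ℝ

IsHomogeneous : ∀ {n} → ℕ → Poly n → Set
IsHomogeneous k f = ∀ μ → degree μ ≢ k → f μ ≈ 0ℝ

-- The coefficient of μ in ∂f/∂x_v is (μ_v + 1) times that of x_v·μ in f.
∂/∂x : ∀ {n} → Fin n → Poly n → Poly n
∂/∂x v f μ = suc (lookup μ v) ·ℕ f (μ [ v ]%= suc)

∂[_] : ∀ {n} → LinearForm n → Poly n → Poly n
∂[ ℓ ] f μ = sum λ v → ℓ v * ∂/∂x v f μ

θ : ∀ {n d} → (Fin n → Point d) → Fin d → LinearForm n
θ p j v = p v j

𝐜 : ∀ {n} → LinearForm n
𝐜 v = 1ℝ

IsZero : ∀ {n} → Poly n → Set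
IsZero f = ∀ μ → f μ ≈ 0ℝ

record IsAffineStress {n d} (k : ℕ) (Δ : Family n) (p : Fin n → Point d) (f : Poly n) : Set where
  field
    homogeneous : IsHomogeneous k f
    supported   : ∀ μ → ¬ (f μ ≈ 0ℝ) → Δ (supp μ)
    ∂θ-zero     : ∀ j → IsZero (∂[ θ p j ] f)
    ∂𝐜-zero     : IsZero (∂[ 𝐜 ] f)

Participates : ∀ {n} → Subset n → Poly n → Set
Participates τ f = ∃[ μ ] (¬ (f μ ≈ 0ℝ) × τ ⊆ supp μ)

{-# OPTIONS --safe #-}
-- P is the direct sum of two 2m-simplices and a triangle: its vertices fall
-- into three blocks of sizes 2m+1, 2m+1 and 3, each with sum 0, and a set of
-- vertices is a proper face iff it contains no block.  So the missing faces
-- are the blocks, and ∂P is a join of boundaries of simplices.  If v and u lie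
-- in a block of which σ misses both, then the deletion of v from the link of σ
-- is a cone with apex u; hence the link of σ is, up to homology, the suspension
-- of the link of σ ∪ {v}, and by iteration its homology is that of a sphere.
--
-- For an affine stress f, ∂_θ f = 0 makes the partial derivatives of f agree on
-- every block.  Hence the derivatives of f at 0 are numbers G i j k that depend
-- only on the degrees i, j, k in the blocks, and ∂_c f = 0 reads
--   (2m+1) G (i+1) j k + (2m+1) G i (j+1) k + 3 G i j (k+1) = 0,
-- while G i j k = 0 when i ≥ 2m+1, j ≥ 2m+1 or k ≥ 3, since f is supported on
-- ∂P.  These relations force G m m 1 = 0, so a face with m, m and 1 vertices in
-- the three blocks does not participate in f if f has degree 2m+1.
module Submission where

open import Level using (0ℓ)
open import Algebra.Bundles using (AbelianGroup; CommutativeMonoid; CommutativeRing)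
import Algebra.Morphism.Construct.Composition as Composition
import Algebra.Properties.CommutativeMonoid.Mult as CommutativeMonoidMult
import Algebra.Properties.CommutativeMonoid.Sum as CommutativeMonoidSum
import Algebra.Properties.Ring as RingProperties
import Algebra.Properties.Semiring.Mult as SemiringMult
import Algebra.Properties.Semiring.Sum as SemiringSum
import Algebra.Solver.CommutativeMonoid as CommutativeMonoidSolver
open import Algebra.Structures using (IsCommutativeRing)
open import Data.Bool.Base using (Bool; true; false; if_then_else_; not; _∧_; _∨_; _xor_)
import Data.Bool.Properties as Bool
open import Data.Fin.Base using (Fin; zero; suc; _↑ˡ_; _↑ʳ_; splitAt)
open import Data.Fin.Patterns using (0F; 1F; 2F)
open import Data.Fin.Properties
  using (_≟_; any?; suc-injective; join-splitAt; splitAt-↑ˡ; splitAt-↑ʳ; ↑ʳ-injective)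
open import Data.Fin.Subset
  using (Subset; inside; outside; ⊥; ⁅_⁆; _∈_; _∉_; _⊆_; _∪_; ∁; ∣_∣)
open import Data.Fin.Subset.Properties
  using (_∈?_; ∈⊤; ⊆⊤; ⊆-antisym; ∪-identityʳ; x∈⁅x⁆; x∈⁅y⁆⇒x≡y; drop-∷-⊆;
         p⊆q⇒∣p∣≤∣q∣; p⊂q⇒∣p∣<∣q∣; ∣⊥∣≡0; ∣∁p∣≡n∸∣p∣)
open import Data.Nat.Base as ℕ using (ℕ; zero; suc; _!)
import Data.Nat.Properties as ℕ
open import Data.Nat.Solver using (module +-*-Solver)
open import Data.Product.Base using (Σ-syntax; ∃-syntax; _×_; _,_; proj₁; proj₂)
open import Data.Rational.Base as ℚ using (ℚ; 0ℚ; 1ℚ)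
import Data.Rational.Properties as ℚ
import Data.Rational.Solver as ℚ
open import Data.Sum.Base using ([_,_]′; inj₁; inj₂)
open import Data.Unit.Polymorphic.Base using (tt)
open import Data.Vec.Base
  using (Vec; []; _∷_; lookup; map; replicate; allFin; _++_; _[_]%=_; _[_]≔_; here)
open import Data.Vec.Properties
  using (≡-dec; []=⇒lookup; lookup⇒[]=; lookup-map; lookup-zipWith; lookup-replicate; lookup-allFin;
         lookup-++ˡ; lookup-++ʳ; lookup∘update; lookup∘update′; []≔-idempotent; []≔-commutes;
         []≔-lookup; updateAt-updateAt; updateAt-cong; updateAt-id; map-++; map-replicate;
         tabulate∘lookup; tabulate-cong)
open import Data.Vec.Relation.Binary.Pointwise.Inductive as PW using (Pointwise; []; _∷_)
open import Function.Base using (_∘_; _$_)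
open import Function.Bundles using (_⇔_; mk⇔; Equivalence)
open import Relation.Binary.PropositionalEquality as ≡ using (_≡_; _≢_)
import Relation.Binary.Reasoning.Setoid as SetoidReasoning
open import Relation.Binary.Structures using (IsEquivalence)
open import Relation.Nullary using (¬_; Dec; does; yes; no; contradiction)
open import Relation.Nullary.Decidable using (_×-dec_; ¬?; dec-true; does-⇔; decidable-stable)

-- Ordered rings

-- Why the relations force `G m m 1` to vanish: scale layer `k` suitably and change signs with the
-- parity of `i`, so that the layers `k = 0, 1, 2` become `a`, `b`, `c`. Along an antidiagonal
-- (`i + j` fixed) `c` is constant, `b` is an arithmetic progression with difference `c`, and `b`
-- gives the successive differences of `a`. So the 2m+1 values of `b` with `i + j = 2m` add up to
-- `a (2m+1) 0 - a 0 (2m+1) = 0`, and the middle term of a progression with an odd number of terms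
-- is its mean. This dictates the sizes: a third block with 3 vertices leaves exactly three layers,
-- and two equal blocks of odd size make `a` vanish at both ends and give `b` a middle term.
--
-- The obstacle to formalisation is that equality of Cauchy reals is undecidable. `OrderedRing`
-- therefore asks for no total order and for no inverses except those of positive integers, and the
-- geometric arguments distinguish cases only on vertices and blocks. The one passage through double
-- negation, from "not nonzero" to zero, is provable for Cauchy reals (`≈0-stable`).

record OrderedRing : Set₁ where
  field
    commutativeRing : CommutativeRing 0ℓ 0ℓ
  open CommutativeRing commutativeRing public hiding (zero)
    renaming (_+_ to infixl 6 _+_; _*_ to infixl 7 _*_; -_ to infix 8 -_; _≈_ to infix 4 _≈_)
  open SemiringMult semiring public using () renaming (_×_ to infixr 8 _·_)
  infix 4 _≤_
  field
    _≤_          : Carrier → Carrier → Set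
    ≤-reflexive  : ∀ {x y} → x ≈ y → x ≤ y
    ≤-trans      : ∀ {x y z} → x ≤ y → y ≤ z → x ≤ z
    ≤-antisym    : ∀ {x y} → x ≤ y → y ≤ x → x ≈ y
    +-mono-≤     : ∀ {x y u v} → x ≤ y → u ≤ v → x + u ≤ y + v
    *-nonneg     : ∀ {x y} → 0# ≤ x → 0# ≤ y → 0# ≤ x * y
    1≰0          : ¬ 1# ≤ 0#
    0≤1          : 0# ≤ 1#
    reciprocal   : ∀ n → ∃[ x ] suc n · x ≈ 1#

-- Stated for any commutative monoid because it serves both the sums of real numbers and the mod 2
-- sums in boundaries of chains.
module SingleTerm {c ℓ} (M : CommutativeMonoid c ℓ) where
  open CommutativeMonoid M
  open CommutativeMonoidSum M

  sum-zero : ∀ {n} (t : Fin n → Carrier) → (∀ i → t i ≈ ε) → sum t ≈ ε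
  sum-zero {n} t t≈0 = trans (sum-cong-≋ t≈0) (sum-replicate-zero n)

  sum-single : ∀ {n} (t : Fin n → Carrier) i → (∀ j → j ≢ i → t j ≈ ε) → sum t ≈ t i
  sum-single t zero    t≈0 =
    trans (∙-congˡ (sum-zero (t ∘ suc) λ j → t≈0 (suc j) λ ())) (identityʳ _)
  sum-single t (suc i) t≈0 =
    trans (∙-cong (t≈0 zero λ ())
                  (sum-single (t ∘ suc) i λ j j≢i → t≈0 (suc j) (j≢i ∘ suc-injective)))
          (identityˡ _)

module OrderedRingProperties (R : OrderedRing) where
  open OrderedRing R
  open SemiringSum semiring public
  open SingleTerm +-commutativeMonoid public
  open RingProperties ring public
    using (-‿distribʳ-*; -‿+-comm; -0#≈0#; -‿involutive)
  open SemiringMult semiring public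
    using (×-assoc-*; ×-comm-*; ×-congʳ; ×-homo-+; ×-assocˡ)
  module ≈-Reasoning = SetoidReasoning setoid

  x-x≈0 : ∀ x → x - x ≈ 0#
  x-x≈0 = -‿inverseʳ

  x-y≈0⇒x≈y : ∀ {x y} → x - y ≈ 0# → x ≈ y
  x-y≈0⇒x≈y {x} {y} x-y≈0 = begin
    x               ≈⟨ +-identityʳ x ⟨
    x + 0#          ≈⟨ +-congˡ (-‿inverseˡ y) ⟨
    x + (- y + y)   ≈⟨ +-assoc x (- y) y ⟨
    (x - y) + y     ≈⟨ +-congʳ x-y≈0 ⟩
    0# + y          ≈⟨ +-identityˡ y ⟩
    y               ∎
    where open ≈-Reasoning

  x≈y⇒x-y≈0 : ∀ {x y} → x ≈ y → x - y ≈ 0#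
  x≈y⇒x-y≈0 {x} {y} x≈y = trans (+-congʳ x≈y) (x-x≈0 y)

  x-0≈x : ∀ x → x - 0# ≈ x
  x-0≈x x = trans (+-congˡ -0#≈0#) (+-identityʳ x)

  *-distribˡ-sub : ∀ x y z → x * (y - z) ≈ x * y - x * z
  *-distribˡ-sub x y z = trans (distribˡ x y (- z)) (+-congˡ (sym (-‿distribʳ-* x z)))

  sum-neg : ∀ {n} (t : Fin n → Carrier) → sum (λ i → - t i) ≈ - sum t
  sum-neg {zero}  t = sym -0#≈0#
  sum-neg {suc n} t = trans (+-congˡ (sum-neg (t ∘ suc))) (-‿+-comm _ _)

  sum-sub : ∀ {n} (s t : Fin n → Carrier) → sum (λ i → s i - t i) ≈ sum s - sum t
  sum-sub s t = trans (∑-distrib-+ s (λ i → - t i)) (+-congˡ (sum-neg t))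

  -- Linearity of the functional `a`: combining its values at the points `x v` is the same as
  -- evaluating it at their combination.
  sum-exchange : ∀ {m n} (t : Fin m → Carrier) (a : Fin n → Carrier) (x : Fin m → Fin n → Carrier) →
    sum (λ v → t v * sum λ j → a j * x v j) ≈ sum (λ j → a j * sum λ v → t v * x v j)
  sum-exchange t a x = begin
    sum (λ v → t v * sum λ j → a j * x v j)     ≈⟨ sum-cong-≋ (λ v → *-distribˡ-sum (t v) (λ j → a j * x v j)) ⟩
    sum (λ v → sum λ j → t v * (a j * x v j))   ≈⟨ ∑-comm (λ v j → t v * (a j * x v j)) ⟩
    sum (λ j → sum λ v → t v * (a j * x v j))   ≈⟨ sum-cong-≋ (λ j → sum-cong-≋ λ v → swap (t v) (a j) (x v j)) ⟩
    sum (λ j → sum λ v → a j * (t v * x v j))   ≈⟨ sum-cong-≋ (λ j → *-distribˡ-sum (a j) (λ v → t v * x v j)) ⟨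
    sum (λ j → a j * sum λ v → t v * x v j)     ∎
    where
    open ≈-Reasoning
    swap : ∀ x y z → x * (y * z) ≈ y * (x * z)
    swap x y z = trans (sym (*-assoc x y z)) (trans (*-congʳ (*-comm x y)) (*-assoc y x z))

  ×-torsionFree : ∀ n {x} → suc n · x ≈ 0# → x ≈ 0#
  ×-torsionFree n {x} nx≈0 with reciprocal n
  ... | y , ny≈1 = begin
    x                ≈⟨ *-identityʳ x ⟨
    x * 1#           ≈⟨ *-congˡ ny≈1 ⟨
    x * suc n · y    ≈⟨ ×-comm-* (suc n) x y ⟩
    suc n · (x * y)  ≈⟨ ×-assoc-* (suc n) x y ⟨
    suc n · x * y    ≈⟨ *-congʳ nx≈0 ⟩
    0# * y           ≈⟨ zeroˡ y ⟩
    0#               ∎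
    where open ≈-Reasoning

  ≤-refl : ∀ {x} → x ≤ x
  ≤-refl = ≤-reflexive refl

  0≤x+y : ∀ {x y} → 0# ≤ x → 0# ≤ y → 0# ≤ x + y
  0≤x+y 0≤x 0≤y = ≤-trans (≤-reflexive (sym (+-identityˡ 0#))) (+-mono-≤ 0≤x 0≤y)

  x≤x+y : ∀ {x y} → 0# ≤ y → x ≤ x + y
  x≤x+y 0≤y = ≤-trans (≤-reflexive (sym (+-identityʳ _))) (+-mono-≤ ≤-refl 0≤y)

  0≤y-x⇒x≤y : ∀ {x y} → 0# ≤ y - x → x ≤ y
  0≤y-x⇒x≤y {x} {y} 0≤y-x = ≤-trans (x≤x+y 0≤y-x) $ ≤-reflexive $ begin
    x + (y - x)    ≈⟨ +-comm x (y - x) ⟩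
    (y - x) + x    ≈⟨ +-assoc y (- x) x ⟩
    y + (- x + x)  ≈⟨ +-congˡ (-‿inverseˡ x) ⟩
    y + 0#         ≈⟨ +-identityʳ y ⟩
    y              ∎
    where open ≈-Reasoning

  x≤0⇒0≤-x : ∀ {x} → x ≤ 0# → 0# ≤ - x
  x≤0⇒0≤-x {x} x≤0 = ≤-trans (≤-reflexive (sym (-‿inverseʳ x)))
    (≤-trans (+-mono-≤ x≤0 ≤-refl) (≤-reflexive (+-identityˡ (- x))))

  0≤x⇒-x≤0 : ∀ {x} → 0# ≤ x → - x ≤ 0#
  0≤x⇒-x≤0 {x} 0≤x = 0≤y-x⇒x≤y (≤-trans 0≤x (≤-reflexive
    (trans (sym (-‿involutive x)) (sym (+-identityˡ (- - x))))))

  0≤sum : ∀ {n} (t : Fin n → Carrier) → (∀ i → 0# ≤ t i) → 0# ≤ sum t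
  0≤sum {zero}  t 0≤t = ≤-refl
  0≤sum {suc n} t 0≤t = 0≤x+y (0≤t zero) (0≤sum (t ∘ suc) (0≤t ∘ suc))

  term≤sum : ∀ {n} (t : Fin n → Carrier) → (∀ i → 0# ≤ t i) → ∀ i → t i ≤ sum t
  term≤sum t 0≤t zero    = x≤x+y (0≤sum (t ∘ suc) (0≤t ∘ suc))
  term≤sum t 0≤t (suc i) = ≤-trans (term≤sum (t ∘ suc) (0≤t ∘ suc) i)
    (≤-trans (x≤x+y (0≤t zero)) (≤-reflexive (+-comm _ _)))

  sum≈0⇒term≈0 : ∀ {n} (t : Fin n → Carrier) → (∀ i → 0# ≤ t i) → sum t ≈ 0# → ∀ i → t i ≈ 0#
  sum≈0⇒term≈0 t 0≤t Σt≈0 i =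
    ≤-antisym (≤-trans (term≤sum t 0≤t i) (≤-reflexive Σt≈0)) (0≤t i)

  indicator : ∀ {A : Set} → Dec A → Carrier
  indicator a? = if does a? then 1# else 0#

  indicator-yes : ∀ {A : Set} (a? : Dec A) → A → indicator a? ≈ 1#
  indicator-yes (yes _) _ = refl
  indicator-yes (no ¬a) a = contradiction a ¬a

  indicator-no : ∀ {A : Set} (a? : Dec A) → ¬ A → indicator a? ≈ 0#
  indicator-no (yes a) ¬a = contradiction a ¬a
  indicator-no (no _)  _  = refl

  0≤indicator : ∀ {A : Set} (a? : Dec A) → 0# ≤ indicator a?
  0≤indicator (yes _) = 0≤1
  0≤indicator (no _)  = ≤-refl

  sum-indicator : ∀ {n} {A : Fin n → Set} (A? : ∀ i → Dec (A i)) →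
    ∃[ c ] sum (λ i → indicator (A? i)) ≈ c · 1#
  sum-indicator {zero}  A? = 0 , refl
  sum-indicator {suc n} A? with A? zero | sum-indicator (A? ∘ suc)
  ... | yes _ | c , Σ≈c = suc c , +-congˡ Σ≈c
  ... | no  _ | c , Σ≈c = c , trans (+-identityˡ _) Σ≈c

  -- Lets one cancel the size of a block without computing it. A zero count is impossible, since the
  -- sum is at least its term 1 at `i`.
  sum-indicator>0 : ∀ {n} {A : Fin n → Set} (A? : ∀ i → Dec (A i)) {i} → A i →
    ∃[ c ] sum (λ i → indicator (A? i)) ≈ suc c · 1#
  sum-indicator>0 A? {i} a with sum-indicator A?
  ... | suc c , Σ≈c = c , Σ≈c
  ... | zero  , Σ≈0 = contradiction 1≤0 1≰0
    where
    1≤0 : 1# ≤ 0#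
    1≤0 = ≤-trans (≤-reflexive (sym (indicator-yes (A? i) a)))
      (≤-trans (term≤sum _ (λ j → 0≤indicator (A? j)) i) (≤-reflexive Σ≈0))

  δ : ∀ {n} → Fin n → Fin n → Carrier
  δ i j = indicator (i ≟ j)

  δ-refl : ∀ {n} (i : Fin n) → δ i i ≈ 1#
  δ-refl i = indicator-yes (i ≟ i) ≡.refl

  δ-≢ : ∀ {n} {i j : Fin n} → i ≢ j → δ i j ≈ 0#
  δ-≢ {i = i} {j} = indicator-no (i ≟ j)

  sum-*-δ : ∀ {n} (t : Fin n → Carrier) i → sum (λ j → t j * δ j i) ≈ t i
  sum-*-δ t i = trans
    (sum-single (λ j → t j * δ j i) i λ j j≢i → trans (*-congˡ (δ-≢ j≢i)) (zeroʳ (t j)))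
    (trans (*-congˡ (δ-refl i)) (*-identityʳ (t i)))

-- The direct sum of simplices

-- The k-th simplex has one vertex root k and a vertex ι j for every
-- coordinate j that Γ assigns to it; ι j is the j-th basis vector and
-- root k is minus the sum of the basis vectors of its block.
module Blocks {r d} (Γ : Vec (Fin r) d) where

  Vertex : Set
  Vertex = Fin (r ℕ.+ d)

  root : Fin r → Vertex
  root k = k ↑ˡ d

  ι : Fin d → Vertex
  ι j = r ↑ʳ j

  block : Vertex → Fin r
  block = lookup (allFin r ++ Γ)

  block-root : ∀ k → block (root k) ≡ k
  block-root k = ≡.trans (lookup-++ˡ (allFin r) Γ k) (lookup-allFin k)

  block-ι : ∀ j → block (ι j) ≡ lookup Γ j
  block-ι = lookup-++ʳ (allFin r) Γ

  root-or-ι : (P : Vertex → Set) → (∀ k → P (root k)) → (∀ j → P (ι j)) → ∀ v → P v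
  root-or-ι P P-root P-ι v with splitAt r v | join-splitAt r d v
  ... | inj₁ k | eq = ≡.subst P eq (P-root k)
  ... | inj₂ j | eq = ≡.subst P eq (P-ι j)

  root≢ι : ∀ k j → root k ≢ ι j
  root≢ι k j eq with () ←
    ≡.trans (≡.sym (splitAt-↑ˡ r k d)) (≡.trans (≡.cong (splitAt r) eq) (splitAt-↑ʳ r d j))

module DirectSum (R : OrderedRing) {r d} (Γ : Vec (Fin r) d) where
  open OrderedRing R
  open OrderedRingProperties R
  open Blocks Γ

  vertex : Vertex → Fin d → Carrier
  vertex v j = δ v (ι j) - δ v (root (lookup Γ j))

  -- Coordinate `j` is nonzero at two vertices only: it is 1 at `ι j` and -1 at the root of its
  -- block. All linear relations among the vertices are read off from this.
  combination-vertex : ∀ t j → sum (λ v → t v * vertex v j) ≈ t (ι j) - t (root (lookup Γ j))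
  combination-vertex t j = begin
    sum (λ v → t v * vertex v j)
      ≈⟨ sum-cong-≋ (λ v → *-distribˡ-sub (t v) _ _) ⟩
    sum (λ v → t v * δ v (ι j) - t v * δ v (root (lookup Γ j)))
      ≈⟨ sum-sub (λ v → t v * δ v (ι j)) (λ v → t v * δ v (root (lookup Γ j))) ⟩
    sum (λ v → t v * δ v (ι j)) - sum (λ v → t v * δ v (root (lookup Γ j)))
      ≈⟨ +-cong (sum-*-δ t (ι j)) (-‿cong (sum-*-δ t (root (lookup Γ j)))) ⟩
    t (ι j) - t (root (lookup Γ j)) ∎
    where open ≈-Reasoning

  -- Serves twice: a relation that vanishes somewhere in every block is zero, which gives the
  -- independence of faces; and the first derivatives of a stress form such a relation.
  relation-constant-on-blocks : ∀ t → (∀ j → sum (λ v → t v * vertex v j) ≈ 0#) →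
    ∀ v w → block v ≡ block w → t v ≈ t w
  relation-constant-on-blocks t t·p≈0 v w eq =
    trans (at-root v) (trans (reflexive (≡.cong (t ∘ root) eq)) (sym (at-root w)))
    where
    at-root : ∀ v → t v ≈ t (root (block v))
    at-root = root-or-ι (λ v → t v ≈ t (root (block v)))
      (λ k → reflexive (≡.cong (t ∘ root) (≡.sym (block-root k))))
      (λ j → trans (x-y≈0⇒x≈y (trans (sym (combination-vertex t j)) (t·p≈0 j)))
                   (reflexive (≡.cong (t ∘ root) (≡.sym (block-ι j)))))

  affinely-spanning : ∀ {n} → r ℕ.+ d ≡ suc n → ∀ (x : Fin d → Carrier) →
    ∃[ t ] (sum t ≈ 1# × ∀ j → sum (λ v → t v * vertex v j) ≈ x j)
  affinely-spanning {n} eq x = t , Σt≈1 , λ j → trans (combination-vertex t j) (difference j)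
    where
    y : Vertex → Carrier
    y = [ (λ _ → 0#) , x ]′ ∘ splitAt r

    c s : Carrier
    c = proj₁ (reciprocal n)
    -- A constant added to all weights cancels in `combination-vertex`, so `s` is free to correct
    -- the total weight to 1.
    s = c * (1# - sum y)

    t : Vertex → Carrier
    t v = s + y v

    n·s : (r ℕ.+ d) · s ≈ 1# - sum y
    n·s = begin
      (r ℕ.+ d) · s               ≈⟨ reflexive (≡.cong (_· s) eq) ⟩
      suc n · s                   ≈⟨ ×-assoc-* (suc n) c _ ⟨
      suc n · c * (1# - sum y)    ≈⟨ *-congʳ (proj₂ (reciprocal n)) ⟩
      1# * (1# - sum y)           ≈⟨ *-identityˡ _ ⟩
      1# - sum y                  ∎
      where open ≈-Reasoning

    Σt≈1 : sum t ≈ 1#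
    Σt≈1 = begin
      sum t                                ≈⟨ ∑-distrib-+ (λ _ → s) y ⟩
      sum {r ℕ.+ d} (λ _ → s) + sum y      ≈⟨ +-congʳ (sum-replicate (r ℕ.+ d)) ⟩
      (r ℕ.+ d) · s + sum y                ≈⟨ +-congʳ n·s ⟩
      (1# - sum y) + sum y                 ≈⟨ +-assoc 1# (- sum y) (sum y) ⟩
      1# + (- sum y + sum y)               ≈⟨ +-congˡ (-‿inverseˡ (sum y)) ⟩
      1# + 0#                              ≈⟨ +-identityʳ 1# ⟩
      1#                                   ∎
      where open ≈-Reasoning

    y-ι : ∀ j → y (ι j) ≡ x j
    y-ι j = ≡.cong [ (λ _ → 0#) , x ]′ (splitAt-↑ʳ r d j)

    y-root : ∀ k → y (root k) ≡ 0#
    y-root k = ≡.cong [ (λ _ → 0#) , x ]′ (splitAt-↑ˡ r k d)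

    difference : ∀ j → t (ι j) - t (root (lookup Γ j)) ≈ x j
    difference j = begin
      (s + y (ι j)) - (s + y (root (lookup Γ j)))
        ≈⟨ +-cong (trans (+-congˡ (reflexive (y-ι j))) (+-comm s (x j)))
                  (-‿cong (trans (+-congˡ (reflexive (y-root (lookup Γ j)))) (+-identityʳ s))) ⟩
      (x j + s) - s     ≈⟨ +-assoc (x j) s (- s) ⟩
      x j + (s - s)     ≈⟨ +-congˡ (-‿inverseʳ s) ⟩
      x j + 0#          ≈⟨ +-identityʳ (x j) ⟩
      x j               ∎
      where open ≈-Reasoning

  -- The vertices of each block add up to 0, so weights that are constant on blocks combine them to
  -- 0, and every functional sends this to 0.
  block-sum : ∀ a (c : Fin r → Carrier) →
    sum (λ v → c (block v) * sum λ j → a j * vertex v j) ≈ 0#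
  block-sum a c = trans (sum-exchange (c ∘ block) a vertex) $ sum-zero _ λ j →
    trans (*-congˡ (trans (combination-vertex (c ∘ block) j)
      (x≈y⇒x-y≈0 (reflexive (≡.cong c (≡.trans (block-ι j) (≡.sym (block-root _))))))))
      (zeroʳ (a j))

  -- Converse of `block-sum`. On the basis vectors values can be prescribed freely; at the root of a
  -- block both `w` and the functional are then determined by the zero sum over the block, so they
  -- agree there too.
  functional : ∀ w → (∀ k → sum (λ v → δ k (block v) * w v) ≈ 0#) →
    ∃[ a ] ∀ v → sum (λ j → a j * vertex v j) ≈ w v
  functional w Σw≈0 = a , root-or-ι _ on-root on-ι
    where
    a = w ∘ ι

    g : Vertex → Carrier
    g v = sum λ j → a j * vertex v j

    on-ι : ∀ j → g (ι j) ≈ w (ι j)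
    on-ι j = trans (sum-single _ j other) this
      where
      δ-root≈0 : ∀ i → δ (ι j) (root (lookup Γ i)) ≈ 0#
      δ-root≈0 i = δ-≢ (root≢ι (lookup Γ i) j ∘ ≡.sym)
      other : ∀ i → i ≢ j → a i * vertex (ι j) i ≈ 0#
      other i i≢j = trans (*-congˡ (x≈y⇒x-y≈0
        (trans (δ-≢ (i≢j ∘ ≡.sym ∘ ↑ʳ-injective r j i)) (sym (δ-root≈0 i))))) (zeroʳ _)
      this : a j * vertex (ι j) j ≈ w (ι j)
      this = trans (*-congˡ (trans (+-cong (δ-refl (ι j)) (-‿cong (δ-root≈0 j))) (x-0≈x 1#)))
                   (*-identityʳ _)

    on-root : ∀ k → g (root k) ≈ w (root k)
    on-root k = x-y≈0⇒x≈y (begin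
      g (root k) - w (root k)
        ≈⟨ *-identityˡ _ ⟨
      1# * (g (root k) - w (root k))
        ≈⟨ *-congʳ (trans (reflexive (≡.cong (δ k) (block-root k))) (δ-refl k)) ⟨
      δ k (block (root k)) * (g (root k) - w (root k))
        ≈⟨ sum-single (λ v → δ k (block v) * (g v - w v)) (root k)
             (root-or-ι (λ v → v ≢ root k → δ k (block v) * (g v - w v) ≈ 0#) other-root other-ι) ⟨
      sum (λ v → δ k (block v) * (g v - w v))
        ≈⟨ sum-cong-≋ (λ v → *-distribˡ-sub (δ k (block v)) (g v) (w v)) ⟩
      sum (λ v → δ k (block v) * g v - δ k (block v) * w v)
        ≈⟨ sum-sub (λ v → δ k (block v) * g v) (λ v → δ k (block v) * w v) ⟩
      sum (λ v → δ k (block v) * g v) - sum (λ v → δ k (block v) * w v)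
        ≈⟨ x≈y⇒x-y≈0 (trans (block-sum a (δ k)) (sym (Σw≈0 k))) ⟩
      0# ∎)
      where
      open ≈-Reasoning
      other-root : ∀ l → root l ≢ root k → δ k (block (root l)) * (g (root l) - w (root l)) ≈ 0#
      other-root l l≢k = trans (*-congʳ (δ-≢ λ k≡ →
        l≢k (≡.cong root (≡.sym (≡.trans k≡ (block-root l)))))) (zeroˡ _)
      other-ι : ∀ j → ι j ≢ root k → δ k (block (ι j)) * (g (ι j) - w (ι j)) ≈ 0#
      other-ι j _ = trans (*-congˡ (x≈y⇒x-y≈0 (on-ι j))) (zeroʳ _)

  -- The value of the functional is 1 on σ; in each block the value at the
  -- missing vertex is chosen so that the values add up to 0.
  supporting-functional : ∀ σ (x : Fin r → Vertex) → (∀ k → block (x k) ≡ k) → (∀ k → x k ∉ σ) →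
    ∃[ a ] ∀ v → (v ∈ σ → sum (λ j → a j * vertex v j) ≈ 1#) ×
                 (v ∉ σ → sum (λ j → a j * vertex v j) ≤ 0#)
  supporting-functional σ x block-x x∉σ =
    let a , a·p = functional w Σw≈0 in
    a , λ v → (λ v∈σ → trans (a·p v) (on-σ v v∈σ)) ,
              (λ v∉σ → ≤-trans (≤-reflexive (a·p v)) (off-σ v v∉σ))
    where
    χ : Vertex → Carrier
    χ v = indicator (v ∈? σ)

    s : Fin r → Carrier
    s k = sum λ v → δ k (block v) * χ v

    w : Vertex → Carrier
    w v = χ v - δ v (x (block v)) * s (block v)

    Σ-correction : ∀ k → sum (λ v → δ k (block v) * (δ v (x (block v)) * s (block v))) ≈ s k
    Σ-correction k = trans (sum-single _ (x k) other) this
      where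
      other : ∀ v → v ≢ x k → δ k (block v) * (δ v (x (block v)) * s (block v)) ≈ 0#
      other v v≢x with k ≟ block v
      ... | yes ≡.refl = trans (*-congˡ (trans (*-congʳ (δ-≢ v≢x)) (zeroˡ _))) (zeroʳ _)
      ... | no  _      = zeroˡ _
      this : δ k (block (x k)) * (δ (x k) (x (block (x k))) * s (block (x k))) ≈ s k
      this rewrite block-x k = trans (*-cong (δ-refl k) (trans (*-congʳ (δ-refl (x k))) (*-identityˡ (s k)))) (*-identityˡ (s k))

    Σw≈0 : ∀ k → sum (λ v → δ k (block v) * w v) ≈ 0#
    Σw≈0 k = begin
      sum (λ v → δ k (block v) * w v)
        ≈⟨ sum-cong-≋ (λ v → *-distribˡ-sub (δ k (block v)) (χ v) _) ⟩
      sum (λ v → δ k (block v) * χ v - δ k (block v) * (δ v (x (block v)) * s (block v)))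
        ≈⟨ sum-sub (λ v → δ k (block v) * χ v) _ ⟩
      s k - sum (λ v → δ k (block v) * (δ v (x (block v)) * s (block v)))
        ≈⟨ x≈y⇒x-y≈0 (sym (Σ-correction k)) ⟩
      0# ∎
      where open ≈-Reasoning

    on-σ : ∀ v → v ∈ σ → w v ≈ 1#
    on-σ v v∈σ = trans (+-cong (indicator-yes (v ∈? σ) v∈σ)
      (-‿cong (trans (*-congʳ (δ-≢ λ v≡x → x∉σ (block v) (≡.subst (_∈ σ) v≡x v∈σ))) (zeroˡ _))))
      (x-0≈x 1#)

    off-σ : ∀ v → v ∉ σ → w v ≤ 0#
    off-σ v v∉σ = ≤-trans
      (≤-reflexive (trans (+-congʳ (indicator-no (v ∈? σ) v∉σ)) (+-identityˡ _)))
      (0≤x⇒-x≤0 (*-nonneg (0≤indicator (v ≟ x (block v)))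
        (0≤sum _ λ u → *-nonneg (0≤indicator (block v ≟ block u)) (0≤indicator (u ∈? σ)))))

  -- The values `g` add up to 0 on block `k`, where all equal `b`; hence a positive multiple of `b`
  -- is 0, and so is `b`. Now all values are at most 0 and add up to 0 on every block, which forces
  -- each of them to be 0.
  full-block-maximal : ∀ a b → (∀ v → sum (λ j → a j * vertex v j) ≤ b) →
    ∀ k → (∀ v → block v ≡ k → sum (λ j → a j * vertex v j) ≈ b) →
    ∀ v → sum (λ j → a j * vertex v j) ≈ b
  full-block-maximal a b g≤b k g≈b v = trans g≈0 (sym b≈0)
    where
    g : Vertex → Carrier
    g v = sum λ j → a j * vertex v j

    N = sum-indicator>0 (λ v → k ≟ block v) {root k} (≡.sym (block-root k))

    b≈0 : b ≈ 0#
    b≈0 = ×-torsionFree (proj₁ N) (begin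
      suc (proj₁ N) · b                  ≈⟨ ×-congʳ (suc (proj₁ N)) (*-identityˡ b) ⟨
      suc (proj₁ N) · (1# * b)           ≈⟨ ×-assoc-* (suc (proj₁ N)) 1# b ⟨
      suc (proj₁ N) · 1# * b             ≈⟨ *-congʳ (proj₂ N) ⟨
      sum (λ v → δ k (block v)) * b      ≈⟨ *-distribʳ-sum b (λ v → δ k (block v)) ⟩
      sum (λ v → δ k (block v) * b)      ≈⟨ sum-cong-≋ on-block ⟩
      sum (λ v → δ k (block v) * g v)    ≈⟨ block-sum a (δ k) ⟩
      0#                                 ∎)
      where
      open ≈-Reasoning
      on-block : ∀ v → δ k (block v) * b ≈ δ k (block v) * g v
      on-block v with k ≟ block v
      ... | yes k≡ = *-congˡ (sym (g≈b v (≡.sym k≡)))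
      ... | no  _  = trans (zeroˡ b) (sym (zeroˡ (g v)))

    -δg≈0 : - (δ (block v) (block v) * g v) ≈ 0#
    -δg≈0 = sum≈0⇒term≈0 (λ u → - (δ (block v) (block u) * g u))
      (λ u → ≤-trans (*-nonneg (0≤indicator (block v ≟ block u))
                       (x≤0⇒0≤-x (≤-trans (g≤b u) (≤-reflexive b≈0))))
                     (≤-reflexive (sym (-‿distribʳ-* _ _))))
      (trans (sum-neg (λ u → δ (block v) (block u) * g u)) (trans (-‿cong (block-sum a (δ (block v)))) -0#≈0#)) v

    g≈0 : g v ≈ 0#
    g≈0 = begin
      g v                                  ≈⟨ *-identityˡ (g v) ⟨
      1# * g v                             ≈⟨ *-congʳ (δ-refl (block v)) ⟨
      δ (block v) (block v) * g v          ≈⟨ -‿involutive _ ⟨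
      - - (δ (block v) (block v) * g v)    ≈⟨ -‿cong -δg≈0 ⟩
      - 0#                                 ≈⟨ -0#≈0# ⟩
      0#                                   ∎
      where open ≈-Reasoning

-- Convex combinations and supporting hyperplanes.

module ConvexCombination (R : OrderedRing) where
  open OrderedRing R
  open OrderedRingProperties R

  vertex-in-hull : ∀ {n d} (p : Fin n → Fin d → Carrier) v →
    (∀ w → 0# ≤ δ w v) × sum (λ w → δ w v) ≈ 1# × (∀ j → sum (λ w → δ w v * p w j) ≈ p v j)
  vertex-in-hull p v = (λ w → 0≤indicator (w ≟ v)) ,
    trans (sum-cong-≋ λ w → sym (*-identityˡ (δ w v))) (sum-*-δ (λ _ → 1#) v) ,
    λ j → trans (sum-cong-≋ λ w → *-comm (δ w v) (p w j)) (sum-*-δ (λ w → p w j) v)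

  value-cong : ∀ {d} (a x y : Fin d → Carrier) b → (∀ j → x j ≈ y j) →
    sum (λ j → a j * y j) ≈ b → sum (λ j → a j * x j) ≈ b
  value-cong a x y b x≈y = trans (sum-cong-≋ λ j → *-congˡ (x≈y j))

  -- Weights t of a convex combination and the values g of a functional
  -- with maximum 1, attained exactly on σ.
  module MaximalValue {n} (σ : Subset n) (t g : Fin n → Carrier)
    (0≤t : ∀ v → 0# ≤ t v) (Σt≈1 : sum t ≈ 1#)
    (g≈1 : ∀ v → v ∈ σ → g v ≈ 1#) (g≤0 : ∀ v → v ∉ σ → g v ≤ 0#) where

    -- What the weight at `v` loses against the maximum 1, namely `t v * (1 - g v)`. It is 0 on `σ`
    -- and at least `t v` off `σ`, so a combination with value 1 puts no weight off `σ`.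
    slack : Fin n → Carrier
    slack v = t v - t v * g v

    t≤slack : ∀ v → v ∉ σ → t v ≤ slack v
    t≤slack v v∉σ = x≤x+y (≤-trans (*-nonneg (0≤t v) (x≤0⇒0≤-x (g≤0 v v∉σ)))
                                   (≤-reflexive (sym (-‿distribʳ-* _ _))))

    0≤slack : ∀ v → 0# ≤ slack v
    0≤slack v with v ∈? σ
    ... | yes v∈σ = ≤-reflexive (sym (x≈y⇒x-y≈0 (sym (trans (*-congˡ (g≈1 v v∈σ)) (*-identityʳ (t v))))))
    ... | no  v∉σ = ≤-trans (0≤t v) (t≤slack v v∉σ)

    Σslack : sum slack ≈ 1# - sum (λ v → t v * g v)
    Σslack = trans (sum-sub t (λ v → t v * g v)) (+-congʳ Σt≈1)

    value≤1 : sum (λ v → t v * g v) ≤ 1#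
    value≤1 = 0≤y-x⇒x≤y (≤-trans (0≤sum slack 0≤slack) (≤-reflexive Σslack))

    value≈1⇒t≈0 : sum (λ v → t v * g v) ≈ 1# → ∀ v → v ∉ σ → t v ≈ 0#
    value≈1⇒t≈0 value≈1 v v∉σ = ≤-antisym
      (≤-trans (t≤slack v v∉σ) (≤-reflexive
        (sum≈0⇒term≈0 slack 0≤slack (trans Σslack (x≈y⇒x-y≈0 (sym value≈1))) v)))
      (0≤t v)

module SupportedFace (R : OrderedRing) {r d} (Γ : Vec (Fin r) d) (σ : Subset (r ℕ.+ d))
  (x : Fin r → Fin (r ℕ.+ d)) (block-x : ∀ k → Blocks.block Γ (x k) ≡ k) (x∉σ : ∀ k → x k ∉ σ) where
  open OrderedRing R
  open OrderedRingProperties R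
  open Blocks Γ
  open DirectSum R Γ
  open ConvexCombination R

  normal : Fin d → Carrier
  normal = proj₁ (supporting-functional σ x block-x x∉σ)

  value : Vertex → Carrier
  value v = sum λ j → normal j * vertex v j

  value≈1 : ∀ v → v ∈ σ → value v ≈ 1#
  value≈1 v = proj₁ (proj₂ (supporting-functional σ x block-x x∉σ) v)

  value≤0 : ∀ v → v ∉ σ → value v ≤ 0#
  value≤0 v = proj₂ (proj₂ (supporting-functional σ x block-x x∉σ) v)

  ∈⇔value≈1 : ∀ v → v ∈ σ ⇔ value v ≈ 1#
  ∈⇔value≈1 v = mk⇔ (value≈1 v) λ v≈1 → decidable-stable (v ∈? σ) λ v∉σ →
    1≰0 (≤-trans (≤-reflexive (sym v≈1)) (value≤0 v v∉σ))

  module _ (t : Vertex → Carrier) (0≤t : ∀ v → 0# ≤ t v) (Σt≈1 : sum t ≈ 1#)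
    (y : Fin d → Carrier) (t·p≈y : ∀ j → sum (λ v → t v * vertex v j) ≈ y j) where
    private module Max = MaximalValue σ t value 0≤t Σt≈1 value≈1 value≤0

    value-y : sum (λ j → normal j * y j) ≈ sum (λ v → t v * value v)
    value-y = trans (sum-cong-≋ λ j → *-congˡ (sym (t·p≈y j))) (sym (sum-exchange t normal vertex))

    value-y≤1 : sum (λ j → normal j * y j) ≤ 1#
    value-y≤1 = ≤-trans (≤-reflexive value-y) Max.value≤1

    -- Applied with `σ` a singleton: the supporting hyperplane then meets the polytope in a single
    -- point. All weight sits at `v`, because the weights off `σ` vanish.
    maximizer : ∀ v → (∀ w → w ∈ σ → w ≡ v) → sum (λ j → normal j * y j) ≈ 1# → ∀ j → y j ≈ vertex v j
    maximizer v σ⊆v y≈1 j = begin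
      y j                               ≈⟨ t·p≈y j ⟨
      sum (λ w → t w * vertex w j)      ≈⟨ sum-single _ v (λ w w≢v → trans (*-congʳ (t≈0 w w≢v)) (zeroˡ _)) ⟩
      t v * vertex v j                  ≈⟨ *-congʳ (trans (sym (sum-single t v t≈0)) Σt≈1) ⟩
      1# * vertex v j                   ≈⟨ *-identityˡ _ ⟩
      vertex v j                        ∎
      where
      open ≈-Reasoning
      t≈0 : ∀ w → w ≢ v → t w ≈ 0#
      t≈0 w w≢v = Max.value≈1⇒t≈0 (trans (sym value-y) y≈1) w (w≢v ∘ σ⊆v w)

  -- The relation is constant on each block and vanishes at the vertex `x k` of block `k`, which is
  -- not in `σ`.
  independent : ∀ t → (∀ v → v ∉ σ → t v ≈ 0#) → (∀ j → sum (λ v → t v * vertex v j) ≈ 0#) → ∀ v → t v ≈ 0#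
  independent t t≈0 t·p≈0 v = trans
    (relation-constant-on-blocks t t·p≈0 v (x (block v)) (≡.sym (block-x (block v))))
    (t≈0 _ (x∉σ (block v)))

-- Derivatives of stresses at the origin

updateAt-++-↑ˡ : ∀ {A : Set} {m n} (xs : Vec A m) (ys : Vec A n) i f →
  (xs ++ ys) [ i ↑ˡ n ]%= f ≡ (xs [ i ]%= f) ++ ys
updateAt-++-↑ˡ (x ∷ xs) ys zero    f = ≡.refl
updateAt-++-↑ˡ (x ∷ xs) ys (suc i) f = ≡.cong (x ∷_) (updateAt-++-↑ˡ xs ys i f)

updateAt-++-↑ʳ : ∀ {A : Set} {m n} (xs : Vec A m) (ys : Vec A n) i f →
  (xs ++ ys) [ m ↑ʳ i ]%= f ≡ xs ++ (ys [ i ]%= f)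
updateAt-++-↑ʳ []       ys i f = ≡.refl
updateAt-++-↑ʳ (x ∷ xs) ys i f = ≡.cong (x ∷_) (updateAt-++-↑ʳ xs ys i f)

factorial : ∀ {n} → Vec ℕ n → ℕ
factorial []      = 1
factorial (x ∷ μ) = x ! ℕ.* factorial μ

factorial-[]%=suc : ∀ {n} (μ : Vec ℕ n) v →
  factorial (μ [ v ]%= suc) ≡ factorial μ ℕ.* suc (lookup μ v)
factorial-[]%=suc (x ∷ μ) zero    = rearrange x (x !) (factorial μ)
  where
  open +-*-Solver
  rearrange : ∀ x y z → suc x ℕ.* y ℕ.* z ≡ y ℕ.* z ℕ.* suc x
  rearrange = solve 3 (λ x y z → (con 1 :+ x) :* y :* z := y :* z :* (con 1 :+ x)) ≡.refl
factorial-[]%=suc (x ∷ μ) (suc v) =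
  ≡.trans (≡.cong (x ! ℕ.*_) (factorial-[]%=suc μ v)) (≡.sym (ℕ.*-assoc (x !) (factorial μ) _))

factorial-suc : ∀ {n} (μ : Vec ℕ n) → ∃[ c ] factorial μ ≡ suc c
factorial-suc μ with factorial μ | nonZero μ
  where
  nonZero : ∀ {n} (μ : Vec ℕ n) → ℕ.NonZero (factorial μ)
  nonZero []      = _
  nonZero (x ∷ μ) = ℕ.m*n≢0 (x !) (factorial μ) {{ℕ._!≢0 x}} {{nonZero μ}}
... | suc c | _ = c , ≡.refl

-- push Γ ν ρ moves the exponents ν of the ι j to the roots of their blocks.
push : ∀ {r d} → Vec (Fin r) d → Vec ℕ d → Vec ℕ r → Vec ℕ r
push []      []      ρ = ρ
push (k ∷ Γ) (x ∷ ν) ρ = push Γ ν (ρ [ k ]%= (x ℕ.+_))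

push-++ : ∀ {r d e} (Γ : Vec (Fin r) d) (Γ′ : Vec (Fin r) e) ν ν′ ρ →
  push (Γ ++ Γ′) (ν ++ ν′) ρ ≡ push Γ′ ν′ (push Γ ν ρ)
push-++ []      Γ′ []      ν′ ρ = ≡.refl
push-++ (k ∷ Γ) Γ′ (x ∷ ν) ν′ ρ = push-++ Γ Γ′ ν ν′ (ρ [ k ]%= (x ℕ.+_))

push-replicate : ∀ {r} m (k : Fin r) x ρ →
  push (replicate m k) (replicate m x) ρ ≡ ρ [ k ]%= (m ℕ.* x ℕ.+_)
push-replicate zero    k x ρ = ≡.sym (updateAt-id k ρ)
push-replicate (suc m) k x ρ = ≡.trans (push-replicate m k x _) $ ≡.trans
  (updateAt-updateAt k ρ) $ updateAt-cong k (λ y → rearrange (m ℕ.* x) x y) ρ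
  where
  open +-*-Solver
  rearrange : ∀ a b c → a ℕ.+ (b ℕ.+ c) ≡ b ℕ.+ a ℕ.+ c
  rearrange = solve 3 (λ a b c → a :+ (b :+ c) := b :+ a :+ c) ≡.refl

-- The recurrence for the block degrees.

module Recurrence (R : OrderedRing) where
  open OrderedRing R
  open OrderedRingProperties R

  triangular : ℕ → ℕ
  triangular zero    = 0
  triangular (suc i) = triangular i ℕ.+ i

  -- `triangular i` is the binomial coefficient "i choose 2". For odd `i` it is a multiple of `i`,
  -- which allows the factor 2m+1 to be cancelled in `middle≈0`.
  triangular-odd : ∀ m → triangular (suc (m ℕ.+ m)) ≡ suc (m ℕ.+ m) ℕ.* m
  triangular-odd zero    = ≡.refl
  triangular-odd (suc m) rewrite ℕ.+-suc m m | triangular-odd m = identity m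
    where
    open +-*-Solver
    identity : ∀ m → suc (m ℕ.+ m) ℕ.* m ℕ.+ suc (m ℕ.+ m) ℕ.+ suc (suc (m ℕ.+ m)) ≡
                     suc (suc (suc (m ℕ.+ m))) ℕ.* suc m
    identity = solve 1 (λ m → let n = con 1 :+ (m :+ m) in
      n :* m :+ n :+ (con 1 :+ n) := (con 2 :+ n) :* (con 1 :+ m)) ≡.refl

  module Unsigned (a b c : ℕ → ℕ → Carrier)
    (a-rec : ∀ i j → a (suc i) j ≈ a i (suc j) + b i j)
    (b-rec : ∀ i j → b (suc i) j ≈ b i (suc j) + c i j)
    (c-rec : ∀ i j → c (suc i) j ≈ c i (suc j)) where

    c-closed : ∀ i j s → i ℕ.+ j ≡ s → c i j ≈ c 0 s
    c-closed zero    j s ≡.refl = refl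
    c-closed (suc i) j s eq     = trans (c-rec i j) (c-closed i (suc j) s (≡.trans (ℕ.+-suc i j) eq))

    b-closed : ∀ i j s → i ℕ.+ j ≡ suc s → b i j ≈ b 0 (suc s) + i · c 0 s
    b-closed zero    j s ≡.refl = sym (+-identityʳ _)
    b-closed (suc i) j s eq     = begin
      b (suc i) j                                ≈⟨ b-rec i j ⟩
      b i (suc j) + c i j                        ≈⟨ +-cong (b-closed i (suc j) s (≡.trans (ℕ.+-suc i j) eq))
                                                           (c-closed i j s (ℕ.suc-injective eq)) ⟩
      b 0 (suc s) + i · c 0 s + c 0 s            ≈⟨ +-assoc _ _ _ ⟩
      b 0 (suc s) + (i · c 0 s + c 0 s)          ≈⟨ +-congˡ (+-comm _ _) ⟩
      b 0 (suc s) + (c 0 s + i · c 0 s)          ∎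
      where open ≈-Reasoning

    a-closed : ∀ i j s → i ℕ.+ j ≡ suc (suc s) →
      a i j ≈ a 0 (suc (suc s)) + (i · b 0 (suc s) + triangular i · c 0 s)
    a-closed zero    j s ≡.refl = sym (trans (+-congˡ (+-identityˡ 0#)) (+-identityʳ _))
    a-closed (suc i) j s eq     = begin
      a (suc i) j
        ≈⟨ a-rec i j ⟩
      a i (suc j) + b i j
        ≈⟨ +-cong (a-closed i (suc j) s (≡.trans (ℕ.+-suc i j) eq)) (b-closed i j s (ℕ.suc-injective eq)) ⟩
      (a₀ + (i · b₀ + triangular i · c₀)) + (b₀ + i · c₀)
        ≈⟨ solve 5 (λ a b ib tc ic → (a ⊕ (ib ⊕ tc)) ⊕ (b ⊕ ic) ⊜ a ⊕ ((b ⊕ ib) ⊕ (tc ⊕ ic))) refl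
                 a₀ b₀ (i · b₀) (triangular i · c₀) (i · c₀) ⟩
      a₀ + (suc i · b₀ + (triangular i · c₀ + i · c₀))
        ≈⟨ +-congˡ (+-congˡ (×-homo-+ c₀ (triangular i) i)) ⟨
      a₀ + (suc i · b₀ + triangular (suc i) · c₀) ∎
      where
      open ≈-Reasoning
      open CommutativeMonoidSolver +-commutativeMonoid
      a₀ = a 0 (suc (suc s))
      b₀ = b 0 (suc s)
      c₀ = c 0 s

    -- With N = 2m+1 the closed form of a N 0 is a 0 N + N (b₀ + m c₀),
    -- and that of b m m is b₀ + m c₀.
    middle≈0 : ∀ m → 1 ℕ.≤ m → a (suc (m ℕ.+ m)) 0 ≈ 0# → a 0 (suc (m ℕ.+ m)) ≈ 0# → b m m ≈ 0#
    middle≈0 m@(suc m′) _ aN0≈0 a0N≈0 =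
      trans (b-closed m m s ≡.refl) (×-torsionFree (m ℕ.+ m) (begin
        N · (b₀ + m · c₀)                        ≈⟨ ·-distrib N b₀ (m · c₀) ⟩
        N · b₀ + N · m · c₀                      ≈⟨ +-congˡ (×-assocˡ c₀ N m) ⟩
        N · b₀ + (N ℕ.* m) · c₀                  ≈⟨ +-congˡ (reflexive (≡.cong (_· c₀) (triangular-odd m))) ⟨
        N · b₀ + triangular N · c₀               ≈⟨ +-identityˡ _ ⟨
        0# + (N · b₀ + triangular N · c₀)        ≈⟨ +-congʳ a0N≈0 ⟨
        a 0 N + (N · b₀ + triangular N · c₀)     ≈⟨ a-closed N 0 s (ℕ.+-identityʳ N) ⟨
        a N 0                                    ≈⟨ aN0≈0 ⟩
        0#                                       ∎))
      where
      open ≈-Reasoning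
      open CommutativeMonoidMult +-commutativeMonoid using (×-distrib-+)
      ·-distrib : ∀ n x y → n · (x + y) ≈ n · x + n · y
      ·-distrib n x y = ×-distrib-+ x y n
      N = suc (m ℕ.+ m)
      -- This is 2m - 1, so `suc s` is 2m and `suc (suc s)` is `N`: the antidiagonals of `c`, `b`
      -- and `a`.
      s = m′ ℕ.+ m
      b₀ = b 0 (suc s)
      c₀ = c 0 s

  -- The product of `x` with the `i`-th power of -1. This sign turns relations of the form "sum
  -- equals 0" into recurrences without minus signs, as `Unsigned` expects.
  signed : ℕ → Carrier → Carrier
  signed zero    x = x
  signed (suc i) x = - signed i x

  signed-cong : ∀ i {x y} → x ≈ y → signed i x ≈ signed i y
  signed-cong zero    x≈y = x≈y
  signed-cong (suc i) x≈y = -‿cong (signed-cong i x≈y)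

  signed-+ : ∀ i x y → signed i (x + y) ≈ signed i x + signed i y
  signed-+ zero    x y = refl
  signed-+ (suc i) x y = trans (-‿cong (signed-+ i x y)) (sym (-‿+-comm _ _))

  signed-0 : ∀ i → signed i 0# ≈ 0#
  signed-0 zero    = refl
  signed-0 (suc i) = trans (-‿cong (signed-0 i)) -0#≈0#

  signed≈0⇒≈0 : ∀ i {x} → signed i x ≈ 0# → x ≈ 0#
  signed≈0⇒≈0 zero    x≈0  = x≈0
  signed≈0⇒≈0 (suc i) -x≈0 = signed≈0⇒≈0 i
    (trans (sym (-‿involutive _)) (trans (-‿cong -x≈0) -0#≈0#))

  signed-rec : ∀ i {x y} → x + y ≈ 0# → signed (suc i) x ≈ signed i y
  signed-rec i {x} {y} x+y≈0 = sym (x-y≈0⇒x≈y (begin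
    signed i y - - signed i x     ≈⟨ +-congˡ (-‿involutive _) ⟩
    signed i y + signed i x       ≈⟨ +-comm _ _ ⟩
    signed i x + signed i y       ≈⟨ signed-+ i x y ⟨
    signed i (x + y)              ≈⟨ signed-cong i x+y≈0 ⟩
    signed i 0#                   ≈⟨ signed-0 i ⟩
    0#                            ∎))
    where open ≈-Reasoning

  middle≈0 : ∀ p q (G : ℕ → ℕ → ℕ → Carrier) →
    (∀ i j k → suc p · G (suc i) j k + (suc p · G i (suc j) k + suc q · G i j (suc k)) ≈ 0#) →
    (∀ i j → G i j 3 ≈ 0#) →
    ∀ m → 1 ℕ.≤ m → G (suc (m ℕ.+ m)) 0 0 ≈ 0# → G 0 (suc (m ℕ.+ m)) 0 ≈ 0# → G m m 1 ≈ 0#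
  middle≈0 p q G rec G3≈0 m 1≤m GN0≈0 G0N≈0 =
    ×-torsionFree p (×-torsionFree q (signed≈0⇒≈0 m
      (Unsigned.middle≈0 (λ i j → signed i (a i j)) (λ i j → signed i (b i j)) (λ i j → signed i (c i j))
        (λ i j → trans (signed-rec i (a-rec i j)) (signed-+ i _ _))
        (λ i j → trans (signed-rec i (b-rec i j)) (signed-+ i _ _))
        (λ i j → signed-rec i (c-rec i j))
        m 1≤m
        (trans (signed-cong N (·≈0 P (·≈0 P GN0≈0))) (signed-0 N))
        (·≈0 P (·≈0 P G0N≈0)))))
    where
    open CommutativeMonoidMult +-commutativeMonoid using (×-distrib-+)
    N = suc (m ℕ.+ m)
    P = suc p
    Q = suc q

    -- The factors P², QP, Q² on the layers 0, 1, 2 make all coefficients of the recurrence equal to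
    -- 1. Layer 3 vanishes, so `c` satisfies a recurrence of its own.
    a b c : ℕ → ℕ → Carrier
    a i j = P · P · G i j 0
    b i j = Q · P · G i j 1
    c i j = Q · Q · G i j 2

    ·≈0 : ∀ n {x} → x ≈ 0# → n · x ≈ 0#
    ·≈0 zero    x≈0 = refl
    ·≈0 (suc n) x≈0 = trans (+-cong x≈0 (·≈0 n x≈0)) (+-identityˡ 0#)

    ·-distrib₃ : ∀ n x y z → n · (x + (y + z)) ≈ n · x + (n · y + n · z)
    ·-distrib₃ n x y z = trans (×-distrib-+ x (y + z) n) (+-congˡ (×-distrib-+ y z n))

    ·-swap : ∀ m n x → m · n · x ≈ n · m · x
    ·-swap m n x = trans (×-assocˡ x m n) (trans (reflexive (≡.cong (_· x) (ℕ.*-comm m n))) (sym (×-assocˡ x n m)))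

    a-rec : ∀ i j → a (suc i) j + (a i (suc j) + b i j) ≈ 0#
    a-rec i j = trans (+-congˡ (+-congˡ (·-swap Q P _)))
      (trans (sym (·-distrib₃ P _ _ _)) (·≈0 P (rec i j 0)))

    b-rec : ∀ i j → b (suc i) j + (b i (suc j) + c i j) ≈ 0#
    b-rec i j = trans (sym (·-distrib₃ Q _ _ _)) (·≈0 Q (rec i j 1))

    c-rec : ∀ i j → c (suc i) j + c i (suc j) ≈ 0#
    c-rec i j = trans (sym (×-distrib-+ _ _ Q)) (·≈0 Q
      (trans (sym (×-distrib-+ _ _ Q)) (·≈0 Q (×-torsionFree p
        (trans (×-distrib-+ _ _ P)
          (trans (+-congˡ (sym (trans (+-congˡ (·≈0 Q (G3≈0 i j))) (+-identityʳ _)))) (rec i j 2)))))))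

module Stress (R : OrderedRing) {r d} (Γ : Vec (Fin r) d) where
  open OrderedRing R
  open OrderedRingProperties R
  open Blocks Γ
  open DirectSum R Γ

  -- Induction on the coordinates: the exponent of the first one is moved to its root unit by unit,
  -- and `E` with first exponent 0 again satisfies the hypothesis for the remaining coordinates. `E`
  -- is abstract to permit this.
  collapse : (E : Vec ℕ r → Vec ℕ d → Carrier) →
    (∀ ρ ν j → E ρ (ν [ j ]%= suc) ≈ E (ρ [ lookup Γ j ]%= suc) ν) →
    ∀ ρ ν → E ρ ν ≈ E (push Γ ν ρ) (replicate d 0)
  collapse = go Γ
    where
    go : ∀ {d} (Γ : Vec (Fin r) d) (E : Vec ℕ r → Vec ℕ d → Carrier) →
      (∀ ρ ν j → E ρ (ν [ j ]%= suc) ≈ E (ρ [ lookup Γ j ]%= suc) ν) →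
      ∀ ρ ν → E ρ ν ≈ E (push Γ ν ρ) (replicate d 0)
    go []      E move ρ []      = refl
    go (k ∷ Γ) E move ρ (x ∷ ν) = trans (head x ρ)
      (go Γ (λ ρ ν → E ρ (0 ∷ ν)) (λ ρ ν j → move ρ (0 ∷ ν) (suc j)) (ρ [ k ]%= (x ℕ.+_)) ν)
      where
      head : ∀ x ρ → E ρ (x ∷ ν) ≈ E (ρ [ k ]%= (x ℕ.+_)) (0 ∷ ν)
      head zero    ρ = reflexive (≡.cong (λ ρ → E ρ (0 ∷ ν)) (≡.sym (updateAt-id k ρ)))
      head (suc x) ρ = trans (move ρ (x ∷ ν) zero) $ trans (head x (ρ [ k ]%= suc)) $
        reflexive $ ≡.cong (λ ρ → E ρ (0 ∷ ν)) $
        ≡.trans (updateAt-updateAt k ρ) (updateAt-cong k (ℕ.+-suc x) ρ)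

  module Derivatives (f : Vec ℕ (r ℕ.+ d) → Carrier)
    (∂θ≈0 : ∀ j μ → sum (λ v → vertex v j * suc (lookup μ v) · f (μ [ v ]%= suc)) ≈ 0#)
    (∂c≈0 : ∀ μ → sum (λ v → 1# * suc (lookup μ v) · f (μ [ v ]%= suc)) ≈ 0#) where

    -- The derivative of f with multi-index μ, evaluated at the origin.
    D : Vec ℕ (r ℕ.+ d) → Carrier
    D μ = factorial μ · f μ

    D-suc : ∀ μ v → D (μ [ v ]%= suc) ≈ factorial μ · suc (lookup μ v) · f (μ [ v ]%= suc)
    D-suc μ v = trans (reflexive (≡.cong (_· f (μ [ v ]%= suc)) (factorial-[]%=suc μ v)))
                      (sym (×-assocˡ _ (factorial μ) (suc (lookup μ v))))

    -- For fixed `μ`, the coefficients of `μ` in the partial derivatives of `f` are, by ∂_θ f = 0, a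
    -- linear relation among the vertices; so `relation-constant-on-blocks` applies.
    D-block : ∀ μ {v w} → block v ≡ block w → D (μ [ v ]%= suc) ≈ D (μ [ w ]%= suc)
    D-block μ {v} {w} eq = trans (D-suc μ v) $ trans
      (×-congʳ (factorial μ) (relation-constant-on-blocks (λ v → suc (lookup μ v) · f (μ [ v ]%= suc))
        (λ j → trans (sum-cong-≋ λ v → *-comm _ (vertex v j)) (∂θ≈0 j μ)) v w eq))
      (sym (D-suc μ w))

    D-root : ∀ ρ ν v → D ((ρ ++ ν) [ v ]%= suc) ≈ D ((ρ [ block v ]%= suc) ++ ν)
    D-root ρ ν v = trans (D-block (ρ ++ ν) (≡.sym (block-root (block v))))
      (reflexive (≡.cong D (updateAt-++-↑ˡ ρ ν (block v) suc)))

    -- This is ∂_c f = 0 at the monomial `ρ ++ ν`, multiplied by its factorial. The factorial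
    -- absorbs the exponents produced by differentiation, and `D-root` moves every new unit to a
    -- root.
    D-sum : ∀ ρ ν → sum (λ v → D ((ρ [ block v ]%= suc) ++ ν)) ≈ 0#
    D-sum ρ ν = begin
      sum (λ v → D ((ρ [ block v ]%= suc) ++ ν))                 ≈⟨ sum-cong-≋ (D-root ρ ν) ⟨
      sum (λ v → D (μ [ v ]%= suc))                              ≈⟨ sum-cong-≋ (λ v → trans (D-suc μ v) (F· (suc (lookup μ v) · f (μ [ v ]%= suc)))) ⟩
      sum (λ v → F · 1# * (1# * suc (lookup μ v) · f (μ [ v ]%= suc)))
        ≈⟨ *-distribˡ-sum (F · 1#) (λ v → 1# * suc (lookup μ v) · f (μ [ v ]%= suc)) ⟨
      F · 1# * sum (λ v → 1# * suc (lookup μ v) · f (μ [ v ]%= suc))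
        ≈⟨ *-congˡ (∂c≈0 μ) ⟩
      F · 1# * 0#                                                ≈⟨ zeroʳ _ ⟩
      0#                                                         ∎
      where
      open ≈-Reasoning
      μ = ρ ++ ν
      F = factorial μ
      F· : ∀ x → F · x ≈ F · 1# * (1# * x)
      F· x = sym (trans (×-assoc-* F 1# _) (×-congʳ F (trans (*-identityˡ _) (*-identityˡ x))))

    D-collapse : ∀ ρ ν → D (ρ ++ ν) ≈ D (push Γ ν ρ ++ replicate d 0)
    D-collapse = collapse (λ ρ ν → D (ρ ++ ν)) λ ρ ν j →
      trans (reflexive (≡.cong D (≡.sym (updateAt-++-↑ʳ ρ ν j suc))))
            (trans (D-root ρ ν (ι j)) (reflexive (≡.cong (λ k → D ((ρ [ k ]%= suc) ++ ν)) (block-ι j))))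

    f≈0⇒D≈0 : ∀ μ → f μ ≈ 0# → D μ ≈ 0#
    f≈0⇒D≈0 μ fμ≈0 = trans (×-congʳ (factorial μ) fμ≈0) (n·0≈0 (factorial μ))
      where
      n·0≈0 : ∀ n → n · 0# ≈ 0#
      n·0≈0 zero    = refl
      n·0≈0 (suc n) = trans (+-identityˡ _) (n·0≈0 n)

    D≈0⇒f≈0 : ∀ μ → D μ ≈ 0# → f μ ≈ 0#
    D≈0⇒f≈0 μ Dμ≈0 with factorial-suc μ
    ... | c , eq = ×-torsionFree c (trans (reflexive (≡.cong (_· f μ) (≡.sym eq))) Dμ≈0)

-- Blocks of sizes 2m+1, 2m+1 and 3

-- Two runs of length m and a root form each large block, so that a face can take exactly one run of
-- it. The nesting ends in `[]` because `4 * m` unfolds to `m + (m + (m + (m + 0)))`.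
segments : ∀ {A : Set} m → A → A → A → A → A → A → Vec A (4 ℕ.* m ℕ.+ 2)
segments m a b c e f g =
  (replicate m a ++ replicate m b ++ replicate m c ++ replicate m e ++ []) ++ (f ∷ g ∷ [])

Γ : ∀ m → Vec (Fin 3) (4 ℕ.* m ℕ.+ 2)
Γ m = segments m 0F 0F 1F 1F 2F 2F

segments-Pointwise : ∀ {A B : Set} {_~_ : A → B → Set} m {a a′ b b′ c c′ e e′ f f′ g g′} →
  a ~ a′ → b ~ b′ → c ~ c′ → e ~ e′ → f ~ f′ → g ~ g′ →
  Pointwise _~_ (segments m a b c e f g) (segments m a′ b′ c′ e′ f′ g′)
segments-Pointwise {_~_ = _~_} m a~ b~ c~ e~ f~ g~ =
  ++⁺ (++⁺ (replicate⁺ a~ m) (++⁺ (replicate⁺ b~ m) (++⁺ (replicate⁺ c~ m) (++⁺ (replicate⁺ e~ m) []))))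
      (f~ ∷ g~ ∷ [])
  where
  open PW using (++⁺)
  replicate⁺ : ∀ {x y} → x ~ y → ∀ m → Pointwise _~_ (replicate m x) (replicate m y)
  replicate⁺ x~y zero    = []
  replicate⁺ x~y (suc m) = x~y ∷ replicate⁺ x~y m

push-segments : ∀ m a b c e f g i j k →
  push (Γ m) (segments m a b c e f g) (i ∷ j ∷ k ∷ []) ≡
  (m ℕ.* b ℕ.+ (m ℕ.* a ℕ.+ i)) ∷ (m ℕ.* e ℕ.+ (m ℕ.* c ℕ.+ j)) ∷ (g ℕ.+ (f ℕ.+ k)) ∷ []
push-segments m a b c e f g i j k = ≡.trans
  (push-++ (replicate m 0F ++ replicate m 0F ++ replicate m 1F ++ replicate m 1F ++ []) (2F ∷ 2F ∷ [])
    (replicate m a ++ replicate m b ++ replicate m c ++ replicate m e ++ []) (f ∷ g ∷ []) (i ∷ j ∷ k ∷ []))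
  (≡.cong (push (2F ∷ 2F ∷ []) (f ∷ g ∷ [])) (≡.trans
    (segment 0F a (replicate m 0F ++ replicate m 1F ++ replicate m 1F ++ [])
      (replicate m b ++ replicate m c ++ replicate m e ++ []) (i ∷ j ∷ k ∷ [])) (≡.trans
    (segment 0F b (replicate m 1F ++ replicate m 1F ++ []) (replicate m c ++ replicate m e ++ []) _) (≡.trans
    (segment 1F c (replicate m 1F ++ []) (replicate m e ++ []) _)
    (segment 1F e [] [] _)))))
  where
  segment : ∀ {n} l x (Δ : Vec (Fin 3) n) ν ρ →
    push (replicate m l ++ Δ) (replicate m x ++ ν) ρ ≡ push Δ ν (ρ [ l ]%= (m ℕ.* x ℕ.+_))
  segment l x Δ ν ρ = ≡.trans (push-++ (replicate m l) Δ (replicate m x) ν ρ)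
                              (≡.cong (push Δ ν) (push-replicate m l x ρ))

-- One run of each large block and the root of the triangle: m, m and 1 vertices in the three
-- blocks.
middleFace : ∀ m → Subset (3 ℕ.+ (4 ℕ.* m ℕ.+ 2))
middleFace m = (outside ∷ outside ∷ inside ∷ []) ++ segments m inside outside inside outside outside outside

middleMonomial : ∀ m → Vec ℕ (3 ℕ.+ (4 ℕ.* m ℕ.+ 2))
middleMonomial m = (0 ∷ 0 ∷ 1 ∷ []) ++ segments m 1 0 1 0 0 0

module MiddleCoefficient (R : OrderedRing) (m : ℕ) (1≤m : 1 ℕ.≤ m) where
  open OrderedRing R
  open OrderedRingProperties R
  open Blocks (Γ m)
  open DirectSum R (Γ m)
  open Stress R (Γ m)

  sum-lookup-++ : ∀ {A : Set} {k l} (h : A → Carrier) (xs : Vec A k) (ys : Vec A l) →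
    sum (λ i → h (lookup (xs ++ ys) i)) ≈ sum (λ i → h (lookup xs i)) + sum (λ i → h (lookup ys i))
  sum-lookup-++ h []       ys = sym (+-identityˡ _)
  sum-lookup-++ h (x ∷ xs) ys = trans (+-congˡ (sum-lookup-++ h xs ys)) (sym (+-assoc _ _ _))

  sum-lookup-replicate : ∀ {A : Set} (h : A → Carrier) n x →
    sum (λ i → h (lookup (replicate n x) i)) ≈ n · h x
  sum-lookup-replicate h zero    x = refl
  sum-lookup-replicate h (suc n) x = +-congˡ (sum-lookup-replicate h n x)

  sum-block : ∀ h → sum (λ v → h (block v)) ≈
    suc (m ℕ.+ m) · h 0F + (suc (m ℕ.+ m) · h 1F + 3 · h 2F)
  sum-block h = begin
    h 0F + (h 1F + (h 2F + sum (λ j → h (lookup (Γ m) j))))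
      ≈⟨ +-congˡ (+-congˡ (+-congˡ sum-Γ)) ⟩
    h 0F + (h 1F + (h 2F + ((x + (x + (y + (y + 0#)))) + (h 2F + (h 2F + 0#)))))
      ≈⟨ solve 5 (λ a b c x y → a ⊕ (b ⊕ (c ⊕ ((x ⊕ (x ⊕ (y ⊕ (y ⊕ id)))) ⊕ (c ⊕ (c ⊕ id)))))
                   ⊜ (a ⊕ (x ⊕ x)) ⊕ ((b ⊕ (y ⊕ y)) ⊕ (c ⊕ (c ⊕ (c ⊕ id))))) refl
               (h 0F) (h 1F) (h 2F) x y ⟩
    (h 0F + (x + x)) + ((h 1F + (y + y)) + 3 · h 2F)
      ≈⟨ +-cong (+-congˡ (×-homo-+ (h 0F) m m)) (+-congʳ (+-congˡ (×-homo-+ (h 1F) m m))) ⟨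
    suc (m ℕ.+ m) · h 0F + (suc (m ℕ.+ m) · h 1F + 3 · h 2F) ∎
    where
    open ≈-Reasoning
    open CommutativeMonoidSolver +-commutativeMonoid
    x = m · h 0F
    y = m · h 1F
    segment : ∀ {n} k (Δ : Vec (Fin 3) n) → sum (λ j → h (lookup (replicate m k ++ Δ) j)) ≈
      m · h k + sum (λ j → h (lookup Δ j))
    segment k Δ = trans (sum-lookup-++ h (replicate m k) Δ) (+-congʳ (sum-lookup-replicate h m k))
    sum-Γ : sum (λ j → h (lookup (Γ m) j)) ≈ (x + (x + (y + (y + 0#)))) + (h 2F + (h 2F + 0#))
    sum-Γ = trans
      (sum-lookup-++ h (replicate m 0F ++ replicate m 0F ++ replicate m 1F ++ replicate m 1F ++ []) (2F ∷ 2F ∷ []))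
      (+-congʳ (trans (segment 0F (replicate m 0F ++ replicate m 1F ++ replicate m 1F ++ []))
      (+-congˡ (trans (segment 0F (replicate m 1F ++ replicate m 1F ++ []))
      (+-congˡ (trans (segment 1F (replicate m 1F ++ []))
      (+-congˡ (segment 1F []))))))))

  module _ (f : Vec ℕ (3 ℕ.+ (4 ℕ.* m ℕ.+ 2)) → Carrier)
    (∂θ≈0 : ∀ j μ → sum (λ v → vertex v j * suc (lookup μ v) · f (μ [ v ]%= suc)) ≈ 0#)
    (∂c≈0 : ∀ μ → sum (λ v → 1# * suc (lookup μ v) · f (μ [ v ]%= suc)) ≈ 0#)
    (f-full≈0 : ∀ μ k → (∀ v → block v ≡ k → lookup μ v ≢ 0) → f μ ≈ 0#) where

    open Derivatives f ∂θ≈0 ∂c≈0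

    -- By D-block, D only depends on the degrees in the three blocks.
    G : ℕ → ℕ → ℕ → Carrier
    G i j k = D ((i ∷ j ∷ k ∷ []) ++ replicate (4 ℕ.* m ℕ.+ 2) 0)

    N : ℕ
    N = suc (m ℕ.+ m)

    G-rec : ∀ i j k → N · G (suc i) j k + (N · G i (suc j) k + 3 · G i j (suc k)) ≈ 0#
    G-rec i j k = trans
      (sym (sum-block λ l → D (((i ∷ j ∷ k ∷ []) [ l ]%= suc) ++ replicate (4 ℕ.* m ℕ.+ 2) 0)))
      (D-sum (i ∷ j ∷ k ∷ []) (replicate _ 0))

    D-segments : ∀ a b c e f g i j k → D ((i ∷ j ∷ k ∷ []) ++ segments m a b c e f g) ≈
      G (m ℕ.* b ℕ.+ (m ℕ.* a ℕ.+ i)) (m ℕ.* e ℕ.+ (m ℕ.* c ℕ.+ j)) (g ℕ.+ (f ℕ.+ k))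
    D-segments a b c e f′ g i j k = trans (D-collapse (i ∷ j ∷ k ∷ []) (segments m a b c e f′ g))
      (reflexive (≡.cong (λ ρ → D (ρ ++ replicate _ 0)) (push-segments m a b c e f′ g i j k)))

    D-full≈0 : ∀ ρ ν k → lookup ρ k ≢ 0 → Pointwise (λ l x → l ≡ k → x ≢ 0) (Γ m) ν → D (ρ ++ ν) ≈ 0#
    D-full≈0 ρ ν k ρk≢0 ν≢0 = f≈0⇒D≈0 (ρ ++ ν) (f-full≈0 (ρ ++ ν) k (root-or-ι _
      (λ l l≡k → ρk≢0 ∘ ≡.trans (≡.sym (≡.trans (lookup-++ˡ ρ ν l)
        (≡.cong (lookup ρ) (≡.trans (≡.sym (block-root l)) l≡k)))))
      (λ j j≡k → PW.lookup ν≢0 j (≡.trans (≡.sym (block-ι j)) j≡k)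
        ∘ ≡.trans (≡.sym (lookup-++ʳ ρ ν j)))))

    m*1+m*1+1≡N : m ℕ.* 1 ℕ.+ (m ℕ.* 1 ℕ.+ 1) ≡ N
    m*1+m*1+1≡N = solve 1 (λ m → m :* con 1 :+ (m :* con 1 :+ con 1) := con 1 :+ (m :+ m)) ≡.refl m
      where open +-*-Solver

    m*0+m*0+i≡i : ∀ i → m ℕ.* 0 ℕ.+ (m ℕ.* 0 ℕ.+ i) ≡ i
    m*0+m*0+i≡i = solve 2 (λ m i → m :* con 0 :+ (m :* con 0 :+ i) := i) ≡.refl m
      where open +-*-Solver

    m*0+m*1+0≡m : m ℕ.* 0 ℕ.+ (m ℕ.* 1 ℕ.+ 0) ≡ m
    m*0+m*1+0≡m = solve 1 (λ m → m :* con 0 :+ (m :* con 1 :+ con 0) := m) ≡.refl m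
      where open +-*-Solver

    -- `G` depends on degrees only, so it may be evaluated at the squarefree monomial of the whole
    -- first block; this contains a block, and `f` vanishes there.
    GN00≈0 : G N 0 0 ≈ 0#
    GN00≈0 = trans (reflexive (≡.cong₂ (λ i j → G i j 0) (≡.sym m*1+m*1+1≡N) (≡.sym (m*0+m*0+i≡i 0))))
      (trans (sym (D-segments 1 1 0 0 0 0 1 0 0))
        (D-full≈0 (1 ∷ 0 ∷ 0 ∷ []) (segments m 1 1 0 0 0 0) 0F (λ ())
          (segments-Pointwise m (λ _ ()) (λ _ ()) (λ ()) (λ ()) (λ ()) (λ ()))))

    G0N0≈0 : G 0 N 0 ≈ 0#
    G0N0≈0 = trans (reflexive (≡.cong₂ (λ i j → G i j 0) (≡.sym (m*0+m*0+i≡i 0)) (≡.sym m*1+m*1+1≡N)))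
      (trans (sym (D-segments 0 0 1 1 0 0 0 1 0))
        (D-full≈0 (0 ∷ 1 ∷ 0 ∷ []) (segments m 0 0 1 1 0 0) 1F (λ ())
          (segments-Pointwise m (λ ()) (λ ()) (λ _ ()) (λ _ ()) (λ ()) (λ ()))))

    -- The degree 3 is spread over the three vertices of the triangle, while `i` and `j` stay at the
    -- other two roots.
    Gij3≈0 : ∀ i j → G i j 3 ≈ 0#
    Gij3≈0 i j = trans (reflexive (≡.cong₂ (λ i j → G i j 3) (≡.sym (m*0+m*0+i≡i i)) (≡.sym (m*0+m*0+i≡i j))))
      (trans (sym (D-segments 0 0 0 0 1 1 i j 1))
        (D-full≈0 (i ∷ j ∷ 1 ∷ []) (segments m 0 0 0 0 1 1) 2F (λ ())
          (segments-Pointwise m (λ ()) (λ ()) (λ ()) (λ ()) (λ _ ()) (λ _ ()))))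

    middleCoefficient≈0 : f (middleMonomial m) ≈ 0#
    middleCoefficient≈0 = D≈0⇒f≈0 (middleMonomial m)
      (trans (D-segments 1 0 1 0 0 0 0 0 1)
        (trans (reflexive (≡.cong₂ (λ i j → G i j 1) m*0+m*1+0≡m m*0+m*1+0≡m))
          (Recurrence.middle≈0 R (m ℕ.+ m) 2 G G-rec Gij3≈0 m 1≤m GN00≈0 G0N0≈0)))

open import Data.Integer.Base as ℤ using (ℤ; +_; -[1+_])
import Data.Integer.Properties as ℤ
open import Relation.Binary.PropositionalEquality
  using (refl; sym; trans; cong; cong₂; subst; module ≡-Reasoning)
open import Defs

-- The real numbers as an ordered ring

module Reals where

  private
    p≤∣p∣ : ∀ p → p ℚ.≤ ℚ.∣ p ∣
    p≤∣p∣ p with ℚ.≤-total 0ℚ p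
    ... | inj₁ 0≤p = ℚ.≤-reflexive (sym (ℚ.0≤p⇒∣p∣≡p 0≤p))
    ... | inj₂ p≤0 = ℚ.≤-trans p≤0 (ℚ.0≤∣p∣ p)

    ∣p∣≤q : ∀ p {q} → p ℚ.≤ q → ℚ.- p ℚ.≤ q → ℚ.∣ p ∣ ℚ.≤ q
    ∣p∣≤q p p≤q -p≤q with ℚ.∣p∣≡p∨∣p∣≡-p p
    ... | inj₁ eq = subst (ℚ._≤ _) (sym eq) p≤q
    ... | inj₂ eq = subst (ℚ._≤ _) (sym eq) -p≤q

    -‿flip : ∀ p q → ℚ.- (p ℚ.- q) ≡ q ℚ.- p
    -‿flip = solve 2 (λ p q → :- (p :- q) := q :- p) refl
      where open ℚ.+-*-Solver

    ∣p-q∣≡∣q-p∣ : ∀ p q → ℚ.∣ p ℚ.- q ∣ ≡ ℚ.∣ q ℚ.- p ∣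
    ∣p-q∣≡∣q-p∣ p q = trans (sym (ℚ.∣-p∣≡∣p∣ (p ℚ.- q))) (cong ℚ.∣_∣ (-‿flip p q))

    p≤q+r⇒p-q≤r : ∀ p q {r} → p ℚ.≤ q ℚ.+ r → p ℚ.- q ℚ.≤ r
    p≤q+r⇒p-q≤r p q {r} p≤q+r =
      subst (p ℚ.- q ℚ.≤_) (cancel q r) (ℚ.+-monoˡ-≤ (ℚ.- q) p≤q+r)
      where
      open ℚ.+-*-Solver
      cancel : ∀ q r → (q ℚ.+ r) ℚ.- q ≡ r
      cancel = solve 2 (λ q r → (q :+ r) :- q := r) refl

    triangle : ∀ p q → ℚ.∣ p ∣ ℚ.≤ ℚ.∣ p ℚ.- q ∣ ℚ.+ ℚ.∣ q ∣
    triangle p q = subst (λ r → ℚ.∣ r ∣ ℚ.≤ ℚ.∣ p ℚ.- q ∣ ℚ.+ ℚ.∣ q ∣) (sym (add-back p q))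
                         (ℚ.∣p+q∣≤∣p∣+∣q∣ (p ℚ.- q) q)

    ½ε<ε : ∀ {ε} → 0ℚ ℚ.< ε → ℚ.½ ℚ.* ε ℚ.< ε
    ½ε<ε {ε} 0<ε = begin-strict
      ℚ.½ ℚ.* ε                  ≡⟨ ℚ.+-identityʳ _ ⟨
      ℚ.½ ℚ.* ε ℚ.+ 0ℚ           <⟨ ℚ.+-monoʳ-< (ℚ.½ ℚ.* ε) (0<½ε 0<ε) ⟩
      ℚ.½ ℚ.* ε ℚ.+ ℚ.½ ℚ.* ε    ≡⟨ ½ε+½ε≡ε ε ⟩
      ε                          ∎
      where open ℚ.≤-Reasoning

  ≗⇒≈ : ∀ x y → (∀ k → seq x k ≡ seq y k) → x ≈ y
  ≗⇒≈ x y x≗y ε 0<ε = 0 , λ k _ → subst (ℚ._< ε)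
    (sym (trans (cong (λ q → ℚ.∣ q ℚ.- seq y k ∣) (x≗y k)) (cong ℚ.∣_∣ (ℚ.+-inverseʳ (seq y k)))))
    0<ε

  ≈-sym : ∀ x y → x ≈ y → y ≈ x
  ≈-sym x y x≈y ε 0<ε = let N , h = x≈y ε 0<ε in
    N , λ k k≥ → subst (ℚ._< ε) (∣p-q∣≡∣q-p∣ (seq x k) (seq y k)) (h k k≥)

  ≈-trans : ∀ x y z → x ≈ y → y ≈ z → x ≈ z
  ≈-trans x y z x≈y y≈z ε 0<ε =
    let M , h = x≈y _ (0<½ε 0<ε)
        N , g = y≈z _ (0<½ε 0<ε)
    in M ℕ.⊔ N , λ k k≥ → begin-strict
      ℚ.∣ seq x k ℚ.- seq z k ∣
        ≡⟨ cong ℚ.∣_∣ (telescope (seq x k) (seq y k) (seq z k)) ⟩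
      ℚ.∣ (seq x k ℚ.- seq y k) ℚ.+ (seq y k ℚ.- seq z k) ∣
        ≤⟨ ℚ.∣p+q∣≤∣p∣+∣q∣ (seq x k ℚ.- seq y k) (seq y k ℚ.- seq z k) ⟩
      ℚ.∣ seq x k ℚ.- seq y k ∣ ℚ.+ ℚ.∣ seq y k ℚ.- seq z k ∣
        <⟨ ℚ.+-mono-< (h k (ℕ.m⊔n≤o⇒m≤o M N k≥)) (g k (ℕ.m⊔n≤o⇒n≤o M N k≥)) ⟩
      ℚ.½ ℚ.* ε ℚ.+ ℚ.½ ℚ.* ε
        ≡⟨ ½ε+½ε≡ε ε ⟩
      ε ∎
    where
    open ℚ.≤-Reasoning
    telescope : ∀ a b c → a ℚ.- c ≡ (a ℚ.- b) ℚ.+ (b ℚ.- c)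
    telescope = solve 3 (λ a b c → a :- c := (a :- b) :+ (b :- c)) refl
      where open ℚ.+-*-Solver

  +-cong : ∀ x y u v → x ≈ y → u ≈ v → x + u ≈ y + v
  +-cong x y u v x≈y u≈v ε 0<ε =
    let M , h = x≈y _ (0<½ε 0<ε)
        N , g = u≈v _ (0<½ε 0<ε)
    in M ℕ.⊔ N , λ k k≥ → begin-strict
      ℚ.∣ (seq x k ℚ.+ seq u k) ℚ.- (seq y k ℚ.+ seq v k) ∣
        ≡⟨ cong ℚ.∣_∣ (sum-difference (seq x k) (seq u k) (seq y k) (seq v k)) ⟩
      ℚ.∣ (seq x k ℚ.- seq y k) ℚ.+ (seq u k ℚ.- seq v k) ∣
        ≤⟨ ℚ.∣p+q∣≤∣p∣+∣q∣ (seq x k ℚ.- seq y k) (seq u k ℚ.- seq v k) ⟩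
      ℚ.∣ seq x k ℚ.- seq y k ∣ ℚ.+ ℚ.∣ seq u k ℚ.- seq v k ∣
        <⟨ ℚ.+-mono-< (h k (ℕ.m⊔n≤o⇒m≤o M N k≥)) (g k (ℕ.m⊔n≤o⇒n≤o M N k≥)) ⟩
      ℚ.½ ℚ.* ε ℚ.+ ℚ.½ ℚ.* ε
        ≡⟨ ½ε+½ε≡ε ε ⟩
      ε ∎
    where open ℚ.≤-Reasoning

  *-cong : ∀ x y u v → x ≈ y → u ≈ v → x * u ≈ y * v
  *-cong x y u v x≈y u≈v ε 0<ε =
    let B , 0<B , K , x≤B   = eventually-bounded (cauchy x)
        C , 0<C , L , v≤C   = eventually-bounded (cauchy v)
        δ , 0<δ , [B+C]δ≡ε  = divide (ℚ.+-mono-< 0<B 0<C) 0<ε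
        M , h = x≈y δ 0<δ
        N , g = u≈v δ 0<δ
    in (K ℕ.⊔ L) ℕ.⊔ (M ℕ.⊔ N) , λ k k≥ →
      let k≥KL = ℕ.m⊔n≤o⇒m≤o (K ℕ.⊔ L) (M ℕ.⊔ N) k≥
          k≥MN = ℕ.m⊔n≤o⇒n≤o (K ℕ.⊔ L) (M ℕ.⊔ N) k≥
      in subst (ℚ.∣ seq x k ℚ.* seq u k ℚ.- seq y k ℚ.* seq v k ∣ ℚ.<_) [B+C]δ≡ε
           (product-difference-bound {seq x k} {seq y k} {seq u k} {seq v k} {B} {C} {δ} 0<B 0<C
             (x≤B k (ℕ.m⊔n≤o⇒m≤o K L k≥KL)) (v≤C k (ℕ.m⊔n≤o⇒n≤o K L k≥KL))
             (h k (ℕ.m⊔n≤o⇒m≤o M N k≥MN)) (g k (ℕ.m⊔n≤o⇒n≤o M N k≥MN)))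

  -1ℝ : ℝ
  -1ℝ = fromℚ (ℚ.- 1ℚ)

  -- Negation as a product, so that its Cauchy property and its congruence come from those of
  -- multiplication.
  neg : ℝ → ℝ
  neg x = -1ℝ * x

  neg-inverseˡ : ∀ x → neg x + x ≈ 0ℝ
  neg-inverseˡ x = ≗⇒≈ (neg x + x) 0ℝ λ k → law (seq x k)
    where
    open ℚ.+-*-Solver
    law : ∀ q → ℚ.- 1ℚ ℚ.* q ℚ.+ q ≡ 0ℚ
    law = solve 1 (λ q → con (ℚ.- 1ℚ) :* q :+ q := con 0ℚ) refl

  isEquivalence : IsEquivalence _≈_
  isEquivalence = record
    { refl  = λ {x} → ≗⇒≈ x x λ _ → refl
    ; sym   = λ {x y} → ≈-sym x y
    ; trans = λ {x y z} → ≈-trans x y z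
    }

  isCommutativeRing : IsCommutativeRing _≈_ _+_ _*_ neg 0ℝ 1ℝ
  isCommutativeRing = record
    { isRing = record
      { +-isAbelianGroup = record
        { isGroup = record
          { isMonoid = record
            { isSemigroup = record
              { isMagma = record
                { isEquivalence = isEquivalence
                ; ∙-cong        = λ {x y u v} → +-cong x y u v
                }
              ; assoc = λ x y z → ≗⇒≈ (x + y + z) (x + (y + z)) λ k → ℚ.+-assoc (seq x k) (seq y k) (seq z k)
              }
            ; identity = (λ x → ≗⇒≈ (0ℝ + x) x λ k → ℚ.+-identityˡ (seq x k))
                       , (λ x → ≗⇒≈ (x + 0ℝ) x λ k → ℚ.+-identityʳ (seq x k))
            }
          ; inverse = neg-inverseˡ
                    , (λ x → ≈-trans (x + neg x) (neg x + x) 0ℝ (comm x (neg x)) (neg-inverseˡ x))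
          ; ⁻¹-cong = λ {x y} → *-cong -1ℝ -1ℝ x y (≗⇒≈ -1ℝ -1ℝ λ _ → refl)
          }
        ; comm = comm
        }
      ; *-cong  = λ {x y u v} → *-cong x y u v
      ; *-assoc = λ x y z → ≗⇒≈ (x * y * z) (x * (y * z)) λ k → ℚ.*-assoc (seq x k) (seq y k) (seq z k)
      ; *-identity = (λ x → ≗⇒≈ (1ℝ * x) x λ k → ℚ.*-identityˡ (seq x k))
                   , (λ x → ≗⇒≈ (x * 1ℝ) x λ k → ℚ.*-identityʳ (seq x k))
      ; distrib = (λ x y z → ≗⇒≈ (x * (y + z)) (x * y + x * z) λ k → ℚ.*-distribˡ-+ (seq x k) (seq y k) (seq z k))
                , (λ x y z → ≗⇒≈ ((y + z) * x) (y * x + z * x) λ k → ℚ.*-distribʳ-+ (seq x k) (seq y k) (seq z k))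
      }
    ; *-comm = λ x y → ≗⇒≈ (x * y) (y * x) λ k → ℚ.*-comm (seq x k) (seq y k)
    }
    where
    comm : ∀ x y → x + y ≈ y + x
    comm x y = ≗⇒≈ (x + y) (y + x) λ k → ℚ.+-comm (seq x k) (seq y k)

  ≤-reflexive : ∀ x y → x ≈ y → x ≤ y
  ≤-reflexive x y x≈y ε 0<ε = let N , h = x≈y ε 0<ε in
    N , λ k k≥ → begin
      seq x k                                     ≡⟨ add-back (seq x k) (seq y k) ⟩
      (seq x k ℚ.- seq y k) ℚ.+ seq y k           ≤⟨ ℚ.+-monoˡ-≤ (seq y k) (p≤∣p∣ (seq x k ℚ.- seq y k)) ⟩
      ℚ.∣ seq x k ℚ.- seq y k ∣ ℚ.+ seq y k       ≤⟨ ℚ.+-monoˡ-≤ (seq y k) (ℚ.<⇒≤ (h k k≥)) ⟩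
      ε ℚ.+ seq y k                               ≡⟨ ℚ.+-comm ε (seq y k) ⟩
      seq y k ℚ.+ ε                               ∎
    where open ℚ.≤-Reasoning

  ≤-trans : ∀ x y z → x ≤ y → y ≤ z → x ≤ z
  ≤-trans x y z x≤y y≤z ε 0<ε =
    let M , h = x≤y _ (0<½ε 0<ε)
        N , g = y≤z _ (0<½ε 0<ε)
    in M ℕ.⊔ N , λ k k≥ → begin
      seq x k
        ≤⟨ h k (ℕ.m⊔n≤o⇒m≤o M N k≥) ⟩
      seq y k ℚ.+ ℚ.½ ℚ.* ε
        ≤⟨ ℚ.+-monoˡ-≤ (ℚ.½ ℚ.* ε) (g k (ℕ.m⊔n≤o⇒n≤o M N k≥)) ⟩
      (seq z k ℚ.+ ℚ.½ ℚ.* ε) ℚ.+ ℚ.½ ℚ.* ε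
        ≡⟨ ℚ.+-assoc (seq z k) (ℚ.½ ℚ.* ε) (ℚ.½ ℚ.* ε) ⟩
      seq z k ℚ.+ (ℚ.½ ℚ.* ε ℚ.+ ℚ.½ ℚ.* ε)
        ≡⟨ cong (seq z k ℚ.+_) (½ε+½ε≡ε ε) ⟩
      seq z k ℚ.+ ε ∎
    where open ℚ.≤-Reasoning

  ≤-antisym : ∀ x y → x ≤ y → y ≤ x → x ≈ y
  ≤-antisym x y x≤y y≤x ε 0<ε =
    let M , h = x≤y _ (0<½ε 0<ε)
        N , g = y≤x _ (0<½ε 0<ε)
    in M ℕ.⊔ N , λ k k≥ → ℚ.≤-<-trans
      (∣p∣≤q (seq x k ℚ.- seq y k)
        (p≤q+r⇒p-q≤r (seq x k) (seq y k) (h k (ℕ.m⊔n≤o⇒m≤o M N k≥)))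
        (subst (ℚ._≤ ℚ.½ ℚ.* ε) (sym (-‿flip (seq x k) (seq y k)))
          (p≤q+r⇒p-q≤r (seq y k) (seq x k) (g k (ℕ.m⊔n≤o⇒n≤o M N k≥)))))
      (½ε<ε 0<ε)

  +-mono-≤ : ∀ x y u v → x ≤ y → u ≤ v → x + u ≤ y + v
  +-mono-≤ x y u v x≤y u≤v ε 0<ε =
    let M , h = x≤y _ (0<½ε 0<ε)
        N , g = u≤v _ (0<½ε 0<ε)
    in M ℕ.⊔ N , λ k k≥ → begin
      seq x k ℚ.+ seq u k
        ≤⟨ ℚ.+-mono-≤ (h k (ℕ.m⊔n≤o⇒m≤o M N k≥)) (g k (ℕ.m⊔n≤o⇒n≤o M N k≥)) ⟩
      (seq y k ℚ.+ ℚ.½ ℚ.* ε) ℚ.+ (seq v k ℚ.+ ℚ.½ ℚ.* ε)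
        ≡⟨ regroup (seq y k) (seq v k) (ℚ.½ ℚ.* ε) ⟩
      (seq y k ℚ.+ seq v k) ℚ.+ (ℚ.½ ℚ.* ε ℚ.+ ℚ.½ ℚ.* ε)
        ≡⟨ cong ((seq y k ℚ.+ seq v k) ℚ.+_) (½ε+½ε≡ε ε) ⟩
      (seq y k ℚ.+ seq v k) ℚ.+ ε ∎
    where
    open ℚ.≤-Reasoning
    regroup : ∀ a b c → (a ℚ.+ c) ℚ.+ (b ℚ.+ c) ≡ (a ℚ.+ b) ℚ.+ (c ℚ.+ c)
    regroup = solve 3 (λ a b c → (a :+ c) :+ (b :+ c) := (a :+ b) :+ (c :+ c)) refl
      where open ℚ.+-*-Solver

  private
    -- 0 ≤ (p + δ)(q + δ) = pq + δ (p + q + δ)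
    product-lower-bound : ∀ {p q δ D} → 0ℚ ℚ.≤ p ℚ.+ δ → 0ℚ ℚ.≤ q ℚ.+ δ → 0ℚ ℚ.< δ →
      p ℚ.+ q ℚ.+ δ ℚ.≤ D → 0ℚ ℚ.≤ p ℚ.* q ℚ.+ δ ℚ.* D
    product-lower-bound {p} {q} {δ} {D} 0≤p+δ 0≤q+δ 0<δ sum≤D = begin
      0ℚ                                       ≤⟨ ℚ.nonNegative⁻¹ _ {{ℚ.nonNeg*nonNeg⇒nonNeg (p ℚ.+ δ) {{ℚ.nonNegative 0≤p+δ}} (q ℚ.+ δ) {{ℚ.nonNegative 0≤q+δ}}}} ⟩
      (p ℚ.+ δ) ℚ.* (q ℚ.+ δ)                  ≡⟨ expand p q δ ⟩
      p ℚ.* q ℚ.+ δ ℚ.* (p ℚ.+ q ℚ.+ δ)        ≤⟨ ℚ.+-monoʳ-≤ (p ℚ.* q) (ℚ.*-monoˡ-≤-nonNeg δ {{ℚ.nonNegative (ℚ.<⇒≤ 0<δ)}} sum≤D) ⟩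
      p ℚ.* q ℚ.+ δ ℚ.* D                      ∎
      where
      open ℚ.≤-Reasoning
      expand : ∀ p q δ → (p ℚ.+ δ) ℚ.* (q ℚ.+ δ) ≡ p ℚ.* q ℚ.+ δ ℚ.* (p ℚ.+ q ℚ.+ δ)
      expand = solve 3 (λ p q δ → (p :+ δ) :* (q :+ δ) := p :* q :+ δ :* (p :+ q :+ δ)) refl
        where open ℚ.+-*-Solver

  *-nonneg : ∀ x y → 0ℝ ≤ x → 0ℝ ≤ y → 0ℝ ≤ x * y
  *-nonneg x y 0≤x 0≤y ε 0<ε =
    let B , 0<B , K , x≤B = eventually-bounded (cauchy x)
        C , 0<C , L , y≤C = eventually-bounded (cauchy y)
        D   = B ℚ.+ C ℚ.+ 1ℚ
        0<D : 0ℚ ℚ.< D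
        0<D = ℚ.+-mono-< (ℚ.+-mono-< 0<B 0<C) (ℚ.positive⁻¹ 1ℚ)
        δ₀ , 0<δ₀ , Dδ₀≡ε = divide 0<D 0<ε
        -- The error term is `δ` times p + q + δ. Capping `δ` at 1 bounds the second factor by `D`,
        -- and `δ ≤ δ₀` makes the product at most `ε`.
        δ   = δ₀ ℚ.⊓ 1ℚ
        0<δ : 0ℚ ℚ.< δ
        0<δ = 0<⊓ 0<δ₀ (ℚ.positive⁻¹ 1ℚ)
        M , h = 0≤x δ 0<δ
        N , g = 0≤y δ 0<δ
    in (K ℕ.⊔ L) ℕ.⊔ (M ℕ.⊔ N) , λ k k≥ →
      let k≥KL = ℕ.m⊔n≤o⇒m≤o (K ℕ.⊔ L) (M ℕ.⊔ N) k≥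
          k≥MN = ℕ.m⊔n≤o⇒n≤o (K ℕ.⊔ L) (M ℕ.⊔ N) k≥
      in ℚ.≤-trans
        (product-lower-bound {seq x k} {seq y k} {δ} {D}
          (h k (ℕ.m⊔n≤o⇒m≤o M N k≥MN)) (g k (ℕ.m⊔n≤o⇒n≤o M N k≥MN)) 0<δ
          (ℚ.+-mono-≤ (ℚ.+-mono-≤
            (ℚ.≤-trans (p≤∣p∣ (seq x k)) (x≤B k (ℕ.m⊔n≤o⇒m≤o K L k≥KL)))
            (ℚ.≤-trans (p≤∣p∣ (seq y k)) (y≤C k (ℕ.m⊔n≤o⇒n≤o K L k≥KL))))
            (ℚ.p⊓q≤q δ₀ 1ℚ)))
        (ℚ.+-monoʳ-≤ (seq x k ℚ.* seq y k)
          (ℚ.≤-trans (ℚ.*-monoʳ-≤-nonNeg D {{ℚ.nonNegative (ℚ.<⇒≤ 0<D)}} (ℚ.p⊓q≤p δ₀ 1ℚ))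
                     (ℚ.≤-reflexive (trans (ℚ.*-comm δ₀ D) Dδ₀≡ε))))
    where
    0<⊓ : ∀ {p q} → 0ℚ ℚ.< p → 0ℚ ℚ.< q → 0ℚ ℚ.< p ℚ.⊓ q
    0<⊓ {p} {q} 0<p 0<q with ℚ.⊓-sel p q
    ... | inj₁ eq = subst (0ℚ ℚ.<_) (sym eq) 0<p
    ... | inj₂ eq = subst (0ℚ ℚ.<_) (sym eq) 0<q

  0≤1 : 0ℝ ≤ 1ℝ
  0≤1 ε 0<ε = 0 , λ _ _ → ℚ.+-mono-≤ (ℚ.nonNegative⁻¹ 1ℚ) (ℚ.<⇒≤ 0<ε)

  1≰0 : ¬ 1ℝ ≤ 0ℝ
  1≰0 1≤0 = let N , h = 1≤0 ℚ.½ (ℚ.positive⁻¹ ℚ.½) in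
    contradiction (h N ℕ.≤-refl) λ { (ℚ.*≤* (ℤ.+≤+ (ℕ.s≤s ()))) }
    where import Data.Integer.Base as ℤ

  private
    module ℚ× = SemiringMult (CommutativeRing.semiring ℚ.+-*-commutativeRing)

  seq-·ℕ : ∀ n x k → seq (n ·ℕ x) k ≡ n ℚ×.× seq x k
  seq-·ℕ zero    x k = refl
  seq-·ℕ (suc n) x k = cong (seq x k ℚ.+_) (seq-·ℕ n x k)

  private
    0≤n×1 : ∀ n → 0ℚ ℚ.≤ n ℚ×.× 1ℚ
    0≤n×1 zero    = ℚ.≤-refl
    0≤n×1 (suc n) = ℚ.+-mono-≤ (ℚ.nonNegative⁻¹ 1ℚ) (0≤n×1 n)

  reciprocal : ∀ n → ∃[ x ] suc n ·ℕ x ≈ 1ℝ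
  reciprocal n = fromℚ q , ≗⇒≈ (suc n ·ℕ fromℚ q) 1ℝ λ k → trans (seq-·ℕ (suc n) (fromℚ q) k) nq≡1
    where
    0<n : 0ℚ ℚ.< suc n ℚ×.× 1ℚ
    0<n = ℚ.+-mono-<-≤ (ℚ.positive⁻¹ 1ℚ) (0≤n×1 n)
    d = divide 0<n (ℚ.positive⁻¹ 1ℚ)
    q = proj₁ d
    nq≡1 : suc n ℚ×.× q ≡ 1ℚ
    nq≡1 = trans (cong (suc n ℚ×.×_) (sym (ℚ.*-identityˡ q)))
                 (trans (sym (ℚ×.×-assoc-* (suc n) 1ℚ q)) (proj₂ (proj₂ d)))

  -- A Cauchy sequence that does not converge to 0 is eventually bounded
  -- away from 0, and which of the two happens at scale ε is decided by a
  -- single sufficiently late term.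
  ≈0-stable : ∀ x → ¬ ¬ (x ≈ 0ℝ) → x ≈ 0ℝ
  ≈0-stable x ¬¬x≈0 ε 0<ε with cauchy x _ (0<½ε (0<½ε 0<ε))
  ... | N , h with ℚ.∣ seq x N ∣ ℚ.<? ℚ.½ ℚ.* ε
  ... | yes small = N , λ k k≥ → begin-strict
      ℚ.∣ seq x k ℚ.- 0ℚ ∣                          ≡⟨ cong ℚ.∣_∣ (ℚ.+-identityʳ (seq x k)) ⟩
      ℚ.∣ seq x k ∣                                 ≤⟨ triangle (seq x k) (seq x N) ⟩
      ℚ.∣ seq x k ℚ.- seq x N ∣ ℚ.+ ℚ.∣ seq x N ∣   <⟨ ℚ.+-mono-<
        (ℚ.<-trans (h k N k≥ ℕ.≤-refl) (½ε<ε (0<½ε 0<ε))) small ⟩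
      ℚ.½ ℚ.* ε ℚ.+ ℚ.½ ℚ.* ε                       ≡⟨ ½ε+½ε≡ε ε ⟩
      ε                                             ∎
    where open ℚ.≤-Reasoning
  ... | no large = contradiction ¬x≈0 ¬¬x≈0
    where
    open ℚ.≤-Reasoning
    ¬x≈0 : ¬ (x ≈ 0ℝ)
    ¬x≈0 x≈0 = let M , g = x≈0 _ (0<½ε (0<½ε 0<ε)) in large (begin-strict
      ℚ.∣ seq x N ∣
        ≤⟨ triangle (seq x N) (seq x (M ℕ.⊔ N)) ⟩
      ℚ.∣ seq x N ℚ.- seq x (M ℕ.⊔ N) ∣ ℚ.+ ℚ.∣ seq x (M ℕ.⊔ N) ∣
        ≡⟨ cong (λ q → ℚ.∣ seq x N ℚ.- seq x (M ℕ.⊔ N) ∣ ℚ.+ ℚ.∣ q ∣) (ℚ.+-identityʳ (seq x (M ℕ.⊔ N))) ⟨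
      ℚ.∣ seq x N ℚ.- seq x (M ℕ.⊔ N) ∣ ℚ.+ ℚ.∣ seq x (M ℕ.⊔ N) ℚ.- 0ℚ ∣
        <⟨ ℚ.+-mono-< (h N (M ℕ.⊔ N) ℕ.≤-refl (ℕ.m≤n⊔m M N)) (g (M ℕ.⊔ N) (ℕ.m≤m⊔n M N)) ⟩
      ℚ.½ ℚ.* (ℚ.½ ℚ.* ε) ℚ.+ ℚ.½ ℚ.* (ℚ.½ ℚ.* ε)
        ≡⟨ ½ε+½ε≡ε (ℚ.½ ℚ.* ε) ⟩
      ℚ.½ ℚ.* ε ∎)

  orderedRing : OrderedRing
  orderedRing = record
    { commutativeRing = record { isCommutativeRing = isCommutativeRing }
    ; _≤_         = _≤_
    ; ≤-reflexive = λ {x y} → ≤-reflexive x y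
    ; ≤-trans     = λ {x y z} → ≤-trans x y z
    ; ≤-antisym   = λ {x y} → ≤-antisym x y
    ; +-mono-≤    = λ {x y u v} → +-mono-≤ x y u v
    ; *-nonneg    = λ {x y} → *-nonneg x y
    ; 1≰0         = 1≰0
    ; 0≤1         = 0≤1
    ; reciprocal  = reciprocal
    }

-- Homology of links

lookup-ext : ∀ {A : Set} {n} {xs ys : Vec A n} → (∀ i → lookup xs i ≡ lookup ys i) → xs ≡ ys
lookup-ext {xs = xs} {ys} eq =
  trans (sym (tabulate∘lookup xs)) (trans (tabulate-cong eq) (tabulate∘lookup ys))

does-∈? : ∀ {n} v (τ : Subset n) → does (v ∈? τ) ≡ lookup τ v
does-∈? zero    (true ∷ τ)  = refl
does-∈? zero    (false ∷ τ) = refl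
does-∈? (suc v) (_ ∷ τ)     = does-∈? v τ

∪-⁅⁆ : ∀ {n} v (τ : Subset n) → τ ∪ ⁅ v ⁆ ≡ τ [ v ]≔ true
∪-⁅⁆ zero    (b ∷ τ) = cong₂ _∷_ (Bool.∨-zeroʳ b) (∪-identityʳ τ)
∪-⁅⁆ (suc v) (b ∷ τ) = cong₂ _∷_ (Bool.∨-identityʳ b) (∪-⁅⁆ v τ)

∣[]≔true∣ : ∀ {n} (τ : Subset n) v → lookup τ v ≡ false → ∣ τ [ v ]≔ true ∣ ≡ suc ∣ τ ∣
∣[]≔true∣ (false ∷ τ) zero    refl = refl
∣[]≔true∣ (true ∷ τ)  (suc v) τv≡f = cong suc (∣[]≔true∣ τ v τv≡f)
∣[]≔true∣ (false ∷ τ) (suc v) τv≡f = ∣[]≔true∣ τ v τv≡f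

dim-[]≔true : ∀ {n} (τ : Subset n) v → lookup τ v ≡ false → dim (τ [ v ]≔ true) ≡ ℤ.suc (dim τ)
dim-[]≔true τ v τv≡f = trans (cong (λ k → + k ℤ.- ℤ.1ℤ) (∣[]≔true∣ τ v τv≡f)) (ℤ.+-assoc ℤ.1ℤ (+ ∣ τ ∣) (ℤ.- ℤ.1ℤ))

[]≔-restore : ∀ {n} (τ : Subset n) v {b c} → lookup τ v ≡ b → (τ [ v ]≔ c) [ v ]≔ b ≡ τ
[]≔-restore τ v refl = trans ([]≔-idempotent τ v) ([]≔-lookup τ v)

suc-injectiveℤ : ∀ {i j} → ℤ.suc i ≡ ℤ.suc j → i ≡ j
suc-injectiveℤ {i} {j} eq = trans (sym (ℤ.pred-suc i)) (trans (cong ℤ.pred eq) (ℤ.pred-suc j))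

-- Mod 2 chains: cones, links and deletions.

Chain : ℕ → Set
Chain n = Subset n → Bool

module _ {n : ℕ} where
  open CommutativeMonoidSum ℤ/2.+-commutativeMonoid using (sum-cong-≗; ∑-distrib-+)
  open SingleTerm ℤ/2.+-commutativeMonoid using (sum-zero; sum-single)

  boundary-term : Chain n → Subset n → Fin n → Bool
  boundary-term c τ w = if lookup τ w then false else c (τ [ w ]≔ true)

  boundary-lookup : ∀ (c : Chain n) τ → boundary c τ ≡ sum₂ (boundary-term c τ)
  boundary-lookup c τ = sum-cong-≗ λ w →
    cong₂ (λ b ρ → if b then false else c ρ) (does-∈? w τ) (∪-⁅⁆ w τ)

  boundary-cong : ∀ {b c : Chain n} → (∀ σ → b σ ≡ c σ) → ∀ τ → boundary b τ ≡ boundary c τ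
  boundary-cong b≗c τ = sum-cong-≗ λ w → cong (if does (w ∈? τ) then false else_) (b≗c (τ ∪ ⁅ w ⁆))

  cone : Fin n → Chain n → Chain n
  cone u c ρ = if lookup ρ u then c (ρ [ u ]≔ false) else false

  cone-cong : ∀ u {b c : Chain n} → (∀ σ → b σ ≡ c σ) → ∀ τ → cone u b τ ≡ cone u c τ
  cone-cong u b≗c τ = cong (if lookup τ u then_else false) (b≗c (τ [ u ]≔ false))

  cone-0 : ∀ u {c : Chain n} → (∀ σ → c σ ≡ false) → ∀ τ → cone u c τ ≡ false
  cone-0 u c≗0 τ with lookup τ u
  ... | true  = c≗0 _
  ... | false = refl

  -- The cone is a chain homotopy from the identity to 0. If `u ∉ τ`, only the term that adds `u`
  -- survives. If `u ∈ τ`, compare with the boundary of `c` at `τ` without `u`: the terms `w ≠ u`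
  -- cancel, and the term that restores `u` is `c τ`.
  boundary-cone : ∀ u (c : Chain n) τ → boundary (cone u c) τ ≡ c τ xor cone u (boundary c) τ
  boundary-cone u c τ with lookup τ u in τu
  ... | false = trans (boundary-lookup (cone u c) τ) $ trans (sum-single _ u other) $
                trans this (sym (Bool.xor-identityʳ (c τ)))
    where
    other : ∀ w → w ≢ u → boundary-term (cone u c) τ w ≡ false
    other w w≢u rewrite lookup∘update′ (w≢u ∘ sym) τ true | τu = Bool.if-eta (lookup τ w)
    this : boundary-term (cone u c) τ u ≡ c τ
    this rewrite τu | lookup∘update u τ true = cong c ([]≔-restore τ u τu)
  ... | true = xor-move (boundary (cone u c) τ) (boundary c τ′) (c τ) $ begin
      boundary (cone u c) τ xor boundary c τ′
        ≡⟨ cong₂ _xor_ (boundary-lookup (cone u c) τ) (boundary-lookup c τ′) ⟩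
      sum₂ (boundary-term (cone u c) τ) xor sum₂ (boundary-term c τ′)
        ≡⟨ ∑-distrib-+ (boundary-term (cone u c) τ) (boundary-term c τ′) ⟨
      sum₂ (λ w → boundary-term (cone u c) τ w xor boundary-term c τ′ w)
        ≡⟨ sum-single _ u other ⟩
      boundary-term (cone u c) τ u xor boundary-term c τ′ u
        ≡⟨ this ⟩
      c τ ∎
    where
    open ≡-Reasoning
    τ′ = τ [ u ]≔ false
    xor-move : ∀ x y z → x xor y ≡ z → x ≡ z xor y
    xor-move x y z refl = sym (trans (Bool.xor-assoc x y y)
      (trans (cong (x xor_) (Bool.xor-same y)) (Bool.xor-identityʳ x)))
    other : ∀ w → w ≢ u → boundary-term (cone u c) τ w xor boundary-term c τ′ w ≡ false
    other w w≢u rewrite lookup∘update′ w≢u τ false | lookup∘update′ (w≢u ∘ sym) τ true | τu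
      | []≔-commutes {x = true} {y = false} τ w u w≢u = Bool.xor-same (if lookup τ w then false else _)
    this : boundary-term (cone u c) τ u xor boundary-term c τ′ u ≡ c τ
    this rewrite τu | lookup∘update u τ false = cong c ([]≔-restore τ u τu)

  linkPart : Fin n → Chain n → Chain n
  linkPart v c τ = if lookup τ v then false else c (τ [ v ]≔ true)

  deletionPart : Fin n → Chain n → Chain n
  deletionPart v c τ = if lookup τ v then false else c τ

  -- Adding `v` contributes nothing on either side, and the other terms agree because mod 2 there
  -- are no signs. So taking the link part is a chain map of degree -1.
  boundary-linkPart : ∀ v (c : Chain n) τ → boundary (linkPart v c) τ ≡ linkPart v (boundary c) τ
  boundary-linkPart v c τ with lookup τ v in τv
  ... | true  = trans (boundary-lookup (linkPart v c) τ) (sum-zero _ zero-term)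
    where
    zero-term : ∀ w → boundary-term (linkPart v c) τ w ≡ false
    zero-term w with v ≟ w
    ... | yes refl rewrite τv = refl
    ... | no v≢w rewrite lookup∘update′ v≢w τ true | τv = Bool.if-eta (lookup τ w)
  ... | false = trans (boundary-lookup (linkPart v c) τ)
                      (trans (sum-cong-≗ term) (sym (boundary-lookup c (τ [ v ]≔ true))))
    where
    term : ∀ w → boundary-term (linkPart v c) τ w ≡ boundary-term c (τ [ v ]≔ true) w
    term w with v ≟ w
    ... | yes refl rewrite lookup∘update v τ true = Bool.if-eta (lookup τ v)
    ... | no v≢w rewrite lookup∘update′ v≢w τ true | lookup∘update′ (v≢w ∘ sym) τ true | τv
          | []≔-commutes {x = true} {y = true} τ w v (v≢w ∘ sym) = refl

  linkPart-xor : ∀ v (b c : Chain n) τ →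
    linkPart v (λ σ → b σ xor c σ) τ ≡ linkPart v b τ xor linkPart v c τ
  linkPart-xor v b c τ with lookup τ v
  ... | true  = refl
  ... | false = refl

  linkPart-cong : ∀ v {b c : Chain n} → (∀ σ → b σ ≡ c σ) → ∀ τ → linkPart v b τ ≡ linkPart v c τ
  linkPart-cong v b≗c τ = cong (if lookup τ v then false else_) (b≗c (τ [ v ]≔ true))

  linkPart-0 : ∀ v {c : Chain n} → (∀ σ → c σ ≡ false) → ∀ τ → linkPart v c τ ≡ false
  linkPart-0 v c≗0 τ = trans (linkPart-cong v c≗0 τ) (Bool.if-eta (lookup τ v))

  decompose : ∀ v (c : Chain n) τ → cone v (linkPart v c) τ xor deletionPart v c τ ≡ c τ
  decompose v c τ with lookup τ v in τv
  ... | false = refl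
  ... | true rewrite lookup∘update v τ false =
    trans (Bool.xor-identityʳ _) (cong c ([]≔-restore τ v τv))

-- K is a complex in which the deletion of v is a cone with apex u, and
-- L is the link of v in K: then K is, up to homology, the suspension of L.
module Suspension {n} {K L : Family n} (i : ℤ) (u v : Fin n) (u≢v : u ≢ v)
  (K⇒L : ∀ {ρ} → K ρ → lookup ρ v ≡ true → L (ρ [ v ]≔ false))
  (L⇒v∉ : ∀ {τ} → L τ → lookup τ v ≡ false)
  (L⇒K : ∀ {τ} → L τ → K τ)
  (L⇒K∋v : ∀ {τ} → L τ → K (τ [ v ]≔ true))
  (cone-K : ∀ {ρ} → K ρ → lookup ρ v ≡ false → K (ρ [ u ]≔ true)) where

  linkPart-isChain : ∀ i {c} → IsChain (ℤ.suc i) K c → IsChain i L (linkPart v c)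
  linkPart-isChain i {c} c-chain τ with lookup τ v in τv
  ... | true  = λ ()
  ... | false = λ cτ≡t → let Kτ , dimτ = c-chain (τ [ v ]≔ true) cτ≡t in
    subst L ([]≔-restore τ v τv) (K⇒L Kτ (lookup∘update v τ true)) ,
    suc-injectiveℤ (trans (sym (dim-[]≔true τ v τv)) dimτ)

  deletionPart-isChain : ∀ i {c} → IsChain i K c →
    ∀ τ → deletionPart v c τ ≡ true → (K τ × dim τ ≡ i) × lookup τ v ≡ false
  deletionPart-isChain i c-chain τ with lookup τ v
  ... | true  = λ ()
  ... | false = λ cτ≡t → c-chain τ cτ≡t , refl

  cone-isChain : ∀ i {c} w → (∀ τ → c τ ≡ true → K (τ [ w ]≔ true) × dim τ ≡ i) →
    IsChain (ℤ.suc i) K (cone w c)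
  cone-isChain i w c-chain ρ with lookup ρ w in ρw
  ... | false = λ ()
  ... | true  = λ cρ≡t → let Kρ , dimρ = c-chain (ρ [ w ]≔ false) cρ≡t in
    subst K restore Kρ ,
    trans (cong dim (sym restore))
      (trans (dim-[]≔true (ρ [ w ]≔ false) w (lookup∘update w ρ false)) (cong ℤ.suc dimρ))
    where restore = []≔-restore ρ w {c = false} ρw

  cone-v-isChain : ∀ i {c} → IsChain i L c → IsChain (ℤ.suc i) K (cone v c)
  cone-v-isChain i c-chain = cone-isChain i v λ τ cτ≡t →
    let Lτ , dimτ = c-chain τ cτ≡t in L⇒K∋v Lτ , dimτ

  cone-u-isChain : ∀ i {c} → (∀ τ → c τ ≡ true → (K τ × dim τ ≡ i) × lookup τ v ≡ false) →
    IsChain (ℤ.suc i) K (cone u c)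
  cone-u-isChain i c-chain = cone-isChain i u λ τ cτ≡t →
    let (Kτ , dimτ) , τv = c-chain τ cτ≡t in cone-K Kτ τv , dimτ

  L-chain⇒deletion-chain : ∀ i {c} → IsChain i L c →
    ∀ τ → c τ ≡ true → (K τ × dim τ ≡ i) × lookup τ v ≡ false
  L-chain⇒deletion-chain i c-chain τ cτ≡t =
    let Lτ , dimτ = c-chain τ cτ≡t in (L⇒K Lτ , dimτ) , L⇒v∉ Lτ

  -- On homology this is the Mayer-Vietoris connecting map for the cover of `K` by the star and the
  -- deletion of `v`. Both are cones and they meet in `L`.
  linkCycle : Cycle (ℤ.suc i) K → Cycle i L
  linkCycle z = record
    { chain   = linkPart v (chain z)
    ; isChain = linkPart-isChain i (isChain z)
    ; closed  = λ τ → trans (boundary-linkPart v (chain z) τ) (linkPart-0 v (closed z) τ)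
    }

  linkCycle-cong : ∀ (z w : Cycle (ℤ.suc i) K) → Homologous z w →
    Homologous (linkCycle z) (linkCycle w)
  linkCycle-cong z w (b , b-chain , ∂b) = linkPart v b , linkPart-isChain (ℤ.suc i) b-chain , λ τ →
    trans (boundary-linkPart v b τ)
          (trans (linkPart-cong v ∂b τ) (linkPart-xor v (chain z) (chain w) τ))

  -- A filling b of the link part of x gives x = ∂ (cone v b) + y with a
  -- cycle y in the deletion of v, and y = ∂ (cone u y).
  fill : ∀ (x : Cycle (ℤ.suc i) K) b → IsChain (ℤ.suc i) L b →
    (∀ τ → boundary b τ ≡ linkPart v (chain x) τ) →
    ∃[ B ] IsChain (ℤ.suc (ℤ.suc i)) K B × (∀ τ → boundary B τ ≡ chain x τ)
  fill x b b-chain ∂b = (λ σ → cone v b σ xor cone u y σ) ,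
    xor-chain {i = ℤ.suc (ℤ.suc i)} {Δ = K} {b = cone v b} {cone u y} (cone-v-isChain (ℤ.suc i) b-chain) (cone-u-isChain (ℤ.suc i) y-chain) , ∂B
    where
    open ≡-Reasoning
    ℓ = linkPart v (chain x)
    y = λ σ → deletionPart v (chain x) σ xor b σ

    y-chain : ∀ τ → y τ ≡ true → (K τ × dim τ ≡ ℤ.suc i) × lookup τ v ≡ false
    y-chain τ = xor-⊎ (deletionPart v (chain x) τ) (b τ)
      (deletionPart-isChain (ℤ.suc i) (isChain x) τ) (L-chain⇒deletion-chain (ℤ.suc i) b-chain τ)

    ∂[cone-b] : ∀ τ → boundary (cone v b) τ ≡ b τ xor cone v ℓ τ
    ∂[cone-b] τ = trans (boundary-cone v b τ) (cong (b τ xor_) (cone-cong v ∂b τ))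

    rearrange : ∀ p q r → (p xor q) xor (r xor p) ≡ q xor r
    rearrange true  true  true  = refl
    rearrange true  true  false = refl
    rearrange true  false true  = refl
    rearrange true  false false = refl
    rearrange false true  true  = refl
    rearrange false true  false = refl
    rearrange false false true  = refl
    rearrange false false false = refl

    x≡ : ∀ τ → (b τ xor cone v ℓ τ) xor y τ ≡ chain x τ
    x≡ τ = trans (rearrange (b τ) (cone v ℓ τ) (deletionPart v (chain x) τ)) (decompose v (chain x) τ)

    ∂y≡0 : ∀ τ → boundary y τ ≡ false
    ∂y≡0 τ = begin
      boundary y τ
        ≡⟨ cong (_xor boundary y τ) ∂[b+cone]≡0 ⟨
      boundary (λ σ → b σ xor cone v ℓ σ) τ xor boundary y τ
        ≡⟨ boundary-xor (λ σ → b σ xor cone v ℓ σ) y τ ⟨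
      boundary (λ σ → (b σ xor cone v ℓ σ) xor y σ) τ
        ≡⟨ boundary-cong x≡ τ ⟩
      boundary (chain x) τ
        ≡⟨ closed x τ ⟩
      false ∎
      where
      ∂ℓ≡0 : ∀ τ → boundary ℓ τ ≡ false
      ∂ℓ≡0 = closed (linkCycle x)
      ∂[b+cone]≡0 : boundary (λ σ → b σ xor cone v ℓ σ) τ ≡ false
      ∂[b+cone]≡0 = begin
        boundary (λ σ → b σ xor cone v ℓ σ) τ             ≡⟨ boundary-xor b (cone v ℓ) τ ⟩
        boundary b τ xor boundary (cone v ℓ) τ            ≡⟨ cong₂ _xor_ (∂b τ) (boundary-cone v ℓ τ) ⟩
        ℓ τ xor (ℓ τ xor cone v (boundary ℓ) τ)           ≡⟨ cong (λ b → ℓ τ xor (ℓ τ xor b)) (cone-0 v ∂ℓ≡0 τ) ⟩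
        ℓ τ xor (ℓ τ xor false)                           ≡⟨ cong (ℓ τ xor_) (Bool.xor-identityʳ (ℓ τ)) ⟩
        ℓ τ xor ℓ τ                                       ≡⟨ Bool.xor-same (ℓ τ) ⟩
        false                                             ∎

    ∂B : ∀ τ → boundary (λ σ → cone v b σ xor cone u y σ) τ ≡ chain x τ
    ∂B τ = begin
      boundary (λ σ → cone v b σ xor cone u y σ) τ
        ≡⟨ boundary-xor (cone v b) (cone u y) τ ⟩
      boundary (cone v b) τ xor boundary (cone u y) τ
        ≡⟨ cong₂ _xor_ (∂[cone-b] τ) (trans (boundary-cone u y τ)
             (trans (cong (y τ xor_) (cone-0 u ∂y≡0 τ)) (Bool.xor-identityʳ (y τ)))) ⟩
      (b τ xor cone v ℓ τ) xor y τ
        ≡⟨ x≡ τ ⟩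
      chain x τ ∎

  linkCycle-injective : ∀ (z w : Cycle (ℤ.suc i) K) →
    Homologous (linkCycle z) (linkCycle w) → Homologous z w
  linkCycle-injective z w (b , b-chain , ∂b) = fill (z ⊞ w) b b-chain λ τ →
    trans (∂b τ) (sym (linkPart-xor v (chain z) (chain w) τ))

  -- Two cones over `w`, with apexes `v` and `u`, glued along their common boundary `w`. The cone
  -- from `u` has no link part at `v`, so `linkCycle` gives back `w` itself.
  suspend : Cycle i L → Cycle (ℤ.suc i) K
  suspend w = record
    { chain   = λ σ → cone v (chain w) σ xor cone u (chain w) σ
    ; isChain = xor-chain {i = ℤ.suc i} {Δ = K} {b = cone v (chain w)} {cone u (chain w)}
        (cone-v-isChain i (isChain w)) (cone-u-isChain i (L-chain⇒deletion-chain i (isChain w)))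
    ; closed  = λ τ → begin
        boundary (λ σ → cone v (chain w) σ xor cone u (chain w) σ) τ
          ≡⟨ boundary-xor (cone v (chain w)) (cone u (chain w)) τ ⟩
        boundary (cone v (chain w)) τ xor boundary (cone u (chain w)) τ
          ≡⟨ cong₂ _xor_ (∂cone v τ) (∂cone u τ) ⟩
        chain w τ xor chain w τ
          ≡⟨ Bool.xor-same (chain w τ) ⟩
        false ∎
    }
    where
    open ≡-Reasoning
    ∂cone : ∀ x τ → boundary (cone x (chain w)) τ ≡ chain w τ
    ∂cone x τ = trans (boundary-cone x (chain w) τ)
      (trans (cong (chain w τ xor_) (cone-0 x (closed w) τ)) (Bool.xor-identityʳ _))

  linkCycle-suspend : ∀ (w : Cycle i L) τ → chain (linkCycle (suspend w)) τ ≡ chain w τ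
  linkCycle-suspend w τ = by-cases (lookup τ v) refl
    where
    v∈⇒false : ∀ τ → lookup τ v ≡ true → chain w τ ≡ false
    v∈⇒false τ τv = Bool.¬-not λ wτ≡t → contradiction
      (trans (sym τv) (L⇒v∉ (proj₁ (isChain w τ wτ≡t)))) λ ()

    cone-u : cone u (chain w) (τ [ v ]≔ true) ≡ false
    cone-u with lookup (τ [ v ]≔ true) u
    ... | false = refl
    ... | true  = v∈⇒false _ (trans (lookup∘update′ (u≢v ∘ sym) (τ [ v ]≔ true) false) (lookup∘update v τ true))

    by-cases : ∀ b → lookup τ v ≡ b →
      linkPart v (λ σ → cone v (chain w) σ xor cone u (chain w) σ) τ ≡ chain w τ
    by-cases true  τv rewrite τv = sym (v∈⇒false τ τv)
    by-cases false τv rewrite τv | lookup∘update v τ true | []≔-restore τ v {c = true} τv | cone-u =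
      Bool.xor-identityʳ _

  H̃-suspension : H̃ (ℤ.suc i) K ≅ H̃ i L
  H̃-suspension = linkCycle , record
    { isGroupMonomorphism = record
      { isGroupHomomorphism = record
        { isMonoidHomomorphism = record
          { isMagmaHomomorphism = record
            { isRelHomomorphism = record { cong = λ {z w} → linkCycle-cong z w }
            ; homo = λ z w → ≗⇒Homologous (linkCycle (z ⊞ w)) (linkCycle z ⊞ linkCycle w)
                (linkPart-xor v (chain z) (chain w))
            }
          ; ε-homo = ≗⇒Homologous (linkCycle 0-cycle) 0-cycle (linkPart-0 v λ _ → refl)
          }
        ; ⁻¹-homo = λ z → ≗⇒Homologous (linkCycle z) (linkCycle z) (λ _ → refl)
        }
      ; injective = λ {z w} → linkCycle-injective z w
      }
    ; surjective = λ w → suspend w , λ {z} z∼ →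
        Homologous-trans (linkCycle z) (linkCycle (suspend w)) w
          (linkCycle-cong z (suspend w) z∼)
          (≗⇒Homologous (linkCycle (suspend w)) w (linkCycle-suspend w))
    }

-- The empty set is the only face, so `K` is the sphere of dimension -1; links of facets have this
-- form. In degree -1 the isomorphism reads off the coefficient of the empty set, and there are no
-- nonzero 0-chains to bound it.
H̃-point : ∀ {n} {K : Family n} → (∀ {σ} → K σ → σ ≡ ⊥) → K ⊥ → ∀ i → H̃ i K ≅ H̃-sphere i -[1+ 0 ]
H̃-point {n} {K} K⇒⊥ K⊥ i with i ℤ.≟ -[1+ 0 ]
... | no i≢-1 = (λ _ → tt) , record
    { isGroupMonomorphism = record
      { isGroupHomomorphism = record
        { isMonoidHomomorphism = record
          { isMagmaHomomorphism = record
            { isRelHomomorphism = record { cong = λ _ → tt }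
            ; homo = λ _ _ → tt
            }
          ; ε-homo = tt
          }
        ; ⁻¹-homo = λ _ → tt
        }
      ; injective = λ {z w} _ → ≗⇒Homologous z w λ σ → trans (zero-chain z σ) (sym (zero-chain w σ))
      }
    ; surjective = λ _ → 0-cycle , λ _ → tt
    }
  where
  zero-chain : ∀ (z : Cycle i K) σ → chain z σ ≡ false
  zero-chain z σ = Bool.¬-not λ zσ≡t → let Kσ , dimσ = isChain z σ zσ≡t in
    i≢-1 (trans (sym dimσ) (trans (cong dim (K⇒⊥ Kσ)) (cong (λ k → + k ℤ.- ℤ.1ℤ) (∣⊥∣≡0 n))))
... | yes refl = (λ z → chain z ⊥) , record
    { isGroupMonomorphism = record
      { isGroupHomomorphism = record
        { isMonoidHomomorphism = record
          { isMagmaHomomorphism = record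
            { isRelHomomorphism = record { cong = λ {z w} → ⊥-coefficient z w }
            ; homo = λ _ _ → refl
            }
          ; ε-homo = refl
          }
        ; ⁻¹-homo = λ _ → refl
        }
      ; injective = λ {z w} z≡w → ≗⇒Homologous z w λ σ → coefficients z w z≡w σ
      }
    ; surjective = λ b → point b , λ {z} z∼ → trans (⊥-coefficient z (point b) z∼) (point-⊥ b)
    }
  where
  _≟ˢ_ : ∀ (σ τ : Subset n) → Dec (σ ≡ τ)
  _≟ˢ_ = ≡-dec Bool._≟_

  dim-⊥ : dim (⊥ {n}) ≡ -[1+ 0 ]
  dim-⊥ = cong (λ k → + k ℤ.- ℤ.1ℤ) (∣⊥∣≡0 n)

  ⊥-coefficient : ∀ (z w : Cycle -[1+ 0 ] K) → Homologous z w → chain z ⊥ ≡ chain w ⊥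
  ⊥-coefficient z w (b , b-chain , ∂b) = xor≡false _ _
    (trans (sym (∂b ⊥)) (trans (boundary-cong b≡0 ⊥) (boundary-0 {n} ⊥)))
    where
    b≡0 : ∀ σ → b σ ≡ false
    b≡0 σ = Bool.¬-not λ bσ≡t → let Kσ , dimσ = b-chain σ bσ≡t in
      contradiction (trans (sym dim-⊥) (trans (cong dim (sym (K⇒⊥ Kσ))) dimσ)) λ ()
    xor≡false : ∀ x y → x xor y ≡ false → x ≡ y
    xor≡false true  true  _ = refl
    xor≡false false false _ = refl

  coefficients : ∀ (z w : Cycle -[1+ 0 ] K) → chain z ⊥ ≡ chain w ⊥ → ∀ σ → chain z σ ≡ chain w σ
  coefficients z w z≡w σ with σ ≟ˢ ⊥
  ... | yes refl = z≡w
  ... | no σ≢⊥   = trans (off z) (sym (off w))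
    where
    off : ∀ (z : Cycle -[1+ 0 ] K) → chain z σ ≡ false
    off z = Bool.¬-not λ zσ≡t → σ≢⊥ (K⇒⊥ (proj₁ (isChain z σ zσ≡t)))

  point : Bool → Cycle -[1+ 0 ] K
  point b = record
    { chain   = λ σ → if does (σ ≟ˢ ⊥) then b else false
    ; isChain = λ σ → is-chain σ
    ; closed  = λ τ → trans (boundary-lookup (λ σ → if does (σ ≟ˢ ⊥) then b else false) τ) (sum-zero _ (term τ))
    }
    where
    open SingleTerm ℤ/2.+-commutativeMonoid using (sum-zero)
    is-chain : ∀ σ → (if does (σ ≟ˢ ⊥) then b else false) ≡ true → K σ × dim σ ≡ -[1+ 0 ]
    is-chain σ with σ ≟ˢ ⊥
    ... | yes refl = λ _ → K⊥ , dim-⊥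
    ... | no _     = λ ()
    term : ∀ τ w → boundary-term (λ σ → if does (σ ≟ˢ ⊥) then b else false) τ w ≡ false
    term τ w with (τ [ w ]≔ true) ≟ˢ ⊥
    ... | no _ = Bool.if-eta (lookup τ w)
    ... | yes eq = contradiction (trans (sym (lookup∘update w τ true))
                     (trans (cong (λ σ → lookup σ w) eq) (lookup-replicate w false))) λ ()

  point-⊥ : ∀ b → chain (point b) ⊥ ≡ b
  point-⊥ b with ⊥ {n} ≟ˢ ⊥
  ... | yes _   = refl
  ... | no  ⊥≢⊥ = contradiction refl ⊥≢⊥

≅-trans : ∀ {G H I : AbelianGroup _ _} → G ≅ H → H ≅ I → G ≅ I
≅-trans {I = I} (f , f-iso) (g , g-iso) =
  g ∘ f , Composition.isGroupIsomorphism (AbelianGroup.trans I) f-iso g-iso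

H̃-sphere-suc : ∀ i e → H̃-sphere i e ≡ H̃-sphere (ℤ.suc i) (ℤ.suc e)
H̃-sphere-suc i e = cong (if_then ℤ/2ℤ else _)
  (does-⇔ (mk⇔ (cong ℤ.suc) suc-injectiveℤ) (i ℤ.≟ e) (ℤ.suc i ℤ.≟ ℤ.suc e))

image : ∀ {n r} → (Fin r → Fin n) → Subset n
image {r = zero}  x = ⊥
image {r = suc r} x = image (x ∘ suc) [ x zero ]≔ true

∈image⇒ : ∀ {n r} (x : Fin r → Fin n) v → lookup (image x) v ≡ true → ∃[ k ] x k ≡ v
∈image⇒ {r = zero}  x v v∈ = contradiction (trans (sym v∈) (lookup-replicate v false)) λ ()
∈image⇒ {r = suc r} x v v∈ with v ≟ x zero
... | yes v≡x = zero , sym v≡x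
... | no  v≢x with ∈image⇒ (x ∘ suc) v (trans (sym (lookup∘update′ v≢x (image (x ∘ suc)) true)) v∈)
... | k , eq = suc k , eq

∈image : ∀ {n r} (x : Fin r → Fin n) k → lookup (image x) (x k) ≡ true
∈image x zero    = lookup∘update (x zero) (image (x ∘ suc)) true
∈image x (suc k) with x (suc k) ≟ x zero
... | yes eq = trans (cong (lookup (image x)) eq) (∈image x zero)
... | no neq = trans (lookup∘update′ neq (image (x ∘ suc)) true) (∈image (x ∘ suc) k)

∣image∣ : ∀ {n r} (x : Fin r → Fin n) → (∀ {k l} → x k ≡ x l → k ≡ l) → ∣ image x ∣ ≡ r
∣image∣ {n} {zero} x inj = ∣⊥∣≡0 n
∣image∣ {r = suc r} x inj = trans
  (∣[]≔true∣ (image (x ∘ suc)) (x zero) (Bool.¬-not λ x0∈ →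
    contradiction (inj (proj₂ (∈image⇒ (x ∘ suc) (x zero) x0∈))) λ ()))
  (cong suc (∣image∣ (x ∘ suc) (λ eq → suc-injective (inj eq))))

lookup-∁ : ∀ {n} (σ : Subset n) v {b} → lookup σ v ≡ b → lookup (∁ σ) v ≡ not b
lookup-∁ σ v refl = lookup-map v not σ

⊆⇒lookup : ∀ {n} {σ τ : Subset n} → σ ⊆ τ → ∀ v → lookup σ v ≡ true → lookup τ v ≡ true
⊆⇒lookup {σ = σ} σ⊆τ v σv = []=⇒lookup (σ⊆τ (lookup⇒[]= v σ σv))

-- The complex of all vertex sets that contain no block: the join of the
-- boundaries of the simplices on the blocks.
module BlockComplex {n r} (block : Fin n → Fin r) {Δ : Family n}
  (Δ⇒ : ∀ {σ} → Δ σ → ∀ k → ∃[ x ] block x ≡ k × lookup σ x ≡ false)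
  (⇒Δ : ∀ {σ} → (∀ k → ∃[ x ] block x ≡ k × lookup σ x ≡ false) → Δ σ) where

  -- Membership in the link in pointwise form, which is easy to follow through changes of `σ` and
  -- `τ` at a single vertex.
  record IsLinkFace (σ τ : Subset n) : Set where
    constructor linkFace
    field
      disjoint : ∀ x → lookup τ x ≡ true → lookup σ x ≡ false
      missing  : ∀ k → ∃[ x ] block x ≡ k × lookup τ x ≡ false × lookup σ x ≡ false
  open IsLinkFace

  link⇒ : ∀ {σ τ} → link Δ σ τ → IsLinkFace σ τ
  link⇒ {σ} {τ} (τ∩σ≡⊥ , Δτ∪σ) = linkFace
    (λ x τx → Bool.¬-not λ σx → contradiction
      (trans (sym (trans (lookup-zipWith _∧_ x τ σ) (cong₂ _∧_ τx σx)))
             (trans (cong (λ ρ → lookup ρ x) τ∩σ≡⊥) (lookup-replicate x false))) λ ())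
    (λ k → let x , x∈k , x∉ = Δ⇒ Δτ∪σ k
               τx∨σx≡f = trans (sym (lookup-zipWith _∨_ x τ σ)) x∉
           in x , x∈k , Bool.∨-conicalˡ _ _ τx∨σx≡f , Bool.∨-conicalʳ _ _ τx∨σx≡f)

  ⇒link : ∀ {σ τ} → IsLinkFace σ τ → link Δ σ τ
  ⇒link {σ} {τ} (linkFace disj miss) =
    lookup-ext (λ x → trans (lookup-zipWith _∧_ x τ σ) (trans (∧≡false x) (sym (lookup-replicate x false)))) ,
    ⇒Δ (λ k → let x , x∈k , τx , σx = miss k in
      x , x∈k , trans (lookup-zipWith _∨_ x τ σ) (cong₂ _∨_ τx σx))
    where
    ∧≡false : ∀ x → lookup τ x ∧ lookup σ x ≡ false
    ∧≡false x with lookup τ x in τx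
    ... | false = refl
    ... | true  = disj x τx

  link-suspension : ∀ σ u v → u ≢ v → block u ≡ block v → lookup σ u ≡ false → lookup σ v ≡ false →
    ∀ i → H̃ (ℤ.suc i) (link Δ σ) ≅ H̃ i (link Δ (σ [ v ]≔ true))
  link-suspension σ u v u≢v u~v σu σv i = Suspension.H̃-suspension i u v u≢v
    (λ {ρ} Kρ ρv → ⇒link (K⇒L (link⇒ Kρ) ρv))
    (λ Lτ → L⇒v∉ (link⇒ Lτ))
    (λ Lτ → ⇒link (L⇒K (link⇒ Lτ)))
    (λ Lτ → ⇒link (L⇒K∋v (link⇒ Lτ)))
    (λ Kρ ρv → ⇒link (cone-K (link⇒ Kρ) ρv))
    where
    σ′ = σ [ v ]≔ true

    true≢false : ∀ {b} → b ≡ true → b ≢ false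
    true≢false refl ()

    ≢v : ∀ {ρ : Subset n} {x} → lookup ρ v ≡ true → lookup ρ x ≡ false → x ≢ v
    ≢v ρv ρx refl = true≢false ρv ρx

    σ′x⇒σx : ∀ {x} → lookup σ′ x ≡ false → x ≢ v × lookup σ x ≡ false
    σ′x⇒σx σ′x = let x≢v = ≢v {σ′} (lookup∘update v σ true) σ′x in
      x≢v , trans (sym (lookup∘update′ x≢v σ true)) σ′x

    K⇒L : ∀ {ρ} → IsLinkFace σ ρ → lookup ρ v ≡ true → IsLinkFace σ′ (ρ [ v ]≔ false)
    K⇒L {ρ} (linkFace disj miss) ρv = linkFace
      (λ x ρ′x → let x≢v = λ { refl → true≢false ρ′x (lookup∘update v ρ false) } in
        trans (lookup∘update′ x≢v σ true) (disj x (trans (sym (lookup∘update′ x≢v ρ false)) ρ′x)))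
      (λ k → let x , x∈k , ρx , σx = miss k; x≢v = ≢v {ρ} ρv ρx in
        x , x∈k , trans (lookup∘update′ x≢v ρ false) ρx , trans (lookup∘update′ x≢v σ true) σx)

    L⇒v∉ : ∀ {τ} → IsLinkFace σ′ τ → lookup τ v ≡ false
    L⇒v∉ (linkFace disj miss) = Bool.¬-not λ τv → true≢false (lookup∘update v σ true) (disj v τv)

    L⇒K : ∀ {τ} → IsLinkFace σ′ τ → IsLinkFace σ τ
    L⇒K (linkFace disj miss) = linkFace
      (λ x τx → proj₂ (σ′x⇒σx (disj x τx)))
      (λ k → let x , x∈k , τx , σ′x = miss k in x , x∈k , τx , proj₂ (σ′x⇒σx σ′x))

    L⇒K∋v : ∀ {τ} → IsLinkFace σ′ τ → IsLinkFace σ (τ [ v ]≔ true)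
    L⇒K∋v {τ} L@(linkFace disj miss) = linkFace disjoint′
      (λ k → let x , x∈k , τx , σ′x = miss k; x≢v , σx = σ′x⇒σx σ′x in
        x , x∈k , trans (lookup∘update′ x≢v τ true) τx , σx)
      where
      disjoint′ : ∀ x → lookup (τ [ v ]≔ true) x ≡ true → lookup σ x ≡ false
      disjoint′ x τ′x with x ≟ v
      ... | yes refl = σv
      ... | no x≢v   = disjoint (L⇒K L) x (trans (sym (lookup∘update′ x≢v τ true)) τ′x)

    cone-K : ∀ {ρ} → IsLinkFace σ ρ → lookup ρ v ≡ false → IsLinkFace σ (ρ [ u ]≔ true)
    cone-K {ρ} (linkFace disj miss) ρv = linkFace disjoint′ missing′
      where
      disjoint′ : ∀ x → lookup (ρ [ u ]≔ true) x ≡ true → lookup σ x ≡ false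
      disjoint′ x ρ′x with x ≟ u
      ... | yes refl = σu
      ... | no x≢u   = disj x (trans (sym (lookup∘update′ x≢u ρ true)) ρ′x)
      missing′ : ∀ k → ∃[ x ] block x ≡ k × lookup (ρ [ u ]≔ true) x ≡ false × lookup σ x ≡ false
      missing′ k with miss k
      ... | x , x∈k , ρx , σx with x ≟ u
      ... | no x≢u   = x , x∈k , trans (lookup∘update′ x≢u ρ true) ρx , σx
      -- If the missing vertex of the block was `u` itself, `v` takes over: it lies in the same
      -- block and outside both sets.
      ... | yes refl = v , trans (sym u~v) x∈k , trans (lookup∘update′ (u≢v ∘ sym) ρ true) ρv , σv

  -- The facets are the complements of transversals of the blocks. A face `σ` lies in the facet
  -- obtained from any choice of missing vertices `x`.
  module Facet (x : Fin r → Fin n) (block-x : ∀ k → block (x k) ≡ k) where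

    facet : Subset n
    facet = ∁ (image x)

    ∣facet∣ : ∣ facet ∣ ≡ n ℕ.∸ r
    ∣facet∣ = trans (∣∁p∣≡n∸∣p∣ (image x)) (cong (n ℕ.∸_) (∣image∣ x λ {k} {l} xk≡xl →
      trans (sym (block-x k)) (trans (cong block xk≡xl) (block-x l))))

    x∉facet : ∀ k → lookup facet (x k) ≡ false
    x∉facet k = lookup-∁ (image x) (x k) (∈image x k)

    ∉facet⇒ : ∀ v → lookup facet v ≡ false → ∃[ k ] x k ≡ v
    ∉facet⇒ v v∉ = ∈image⇒ x v (Bool.¬-not λ v∉image →
      contradiction (trans (sym v∉) (lookup-∁ (image x) v v∉image)) λ ())

    ⊆facet : ∀ {σ} → (∀ k → lookup σ (x k) ≡ false) → σ ⊆ facet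
    ⊆facet {σ} x∉σ {v} v∈σ = lookup⇒[]= v facet (Bool.¬-not λ v∉ →
      let k , xk≡v = ∉facet⇒ v v∉ in
      contradiction (trans (sym ([]=⇒lookup v∈σ)) (trans (cong (lookup σ) (sym xk≡v)) (x∉σ k))) λ ())

    -- Induction on the number `k` of vertices of the facet outside `σ`. Each step moves one of them
    -- into `σ` and desuspends once, until `σ` is the facet and the sphere has dimension -1.
    H̃-link : ∀ k σ → (∀ v → lookup σ v ≡ true → lookup facet v ≡ true) → ∣ facet ∣ ≡ k ℕ.+ ∣ σ ∣ →
      ∀ i → H̃ i (link Δ σ) ≅ H̃-sphere i (ℤ.pred (+ k))
    H̃-link k σ σ⊆F ∣F∣ i with any? (λ v → (lookup facet v Bool.≟ true) ×-dec (lookup σ v Bool.≟ false))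
    H̃-link k σ σ⊆F ∣F∣ i | no none = subst (λ e → H̃ i (link Δ σ) ≅ H̃-sphere i e)
      (cong (λ k → ℤ.pred (+ k)) (sym k≡0))
      (H̃-point (λ Kτ → lookup-ext λ v → trans (link⊆⊥ (link⇒ Kτ) v) (sym (lookup-replicate v false))) link∋⊥ i)
      where
      F⊆σ : ∀ v → lookup facet v ≡ true → lookup σ v ≡ true
      F⊆σ v v∈F = Bool.¬-not λ v∉σ → none (v , v∈F , v∉σ)
      σ≡F : σ ≡ facet
      σ≡F = ⊆-antisym (λ {v} v∈σ → lookup⇒[]= v facet (σ⊆F v ([]=⇒lookup v∈σ)))
                      (λ {v} v∈F → lookup⇒[]= v σ (F⊆σ v ([]=⇒lookup v∈F)))
      k≡0 : k ≡ 0
      k≡0 = ℕ.+-cancelʳ-≡ ∣ σ ∣ k 0 (trans (sym ∣F∣) (cong ∣_∣ (sym σ≡F)))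
      σx : ∀ k → lookup σ (x k) ≡ false
      σx k = trans (cong (λ σ → lookup σ (x k)) σ≡F) (x∉facet k)
      link⊆⊥ : ∀ {τ} → IsLinkFace σ τ → ∀ v → lookup τ v ≡ false
      -- Outside the facet there is only one vertex per block, and a face of the link has to leave
      -- it out.
      link⊆⊥ {τ} (linkFace disj miss) v = Bool.¬-not λ v∈τ →
        let l , xl≡v = ∉facet⇒ v (trans (sym (cong (λ σ → lookup σ v) σ≡F)) (disj v v∈τ))
            y , y∈l , y∉τ , y∉σ = miss l
            l′ , xl′≡y = ∉facet⇒ y (trans (sym (cong (λ σ → lookup σ y) σ≡F)) y∉σ)
            l′≡l = trans (sym (block-x l′)) (trans (cong block xl′≡y) y∈l)
            y≡v = trans (sym xl′≡y) (trans (cong x l′≡l) xl≡v)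
        in contradiction (trans (sym v∈τ) (trans (cong (lookup τ) (sym y≡v)) y∉τ)) λ ()
      link∋⊥ : link Δ σ ⊥
      link∋⊥ = ⇒link (linkFace
        (λ v v∈⊥ → contradiction (trans (sym v∈⊥) (lookup-replicate v false)) λ ())
        (λ k → x k , block-x k , lookup-replicate (x k) false , σx k))
    H̃-link zero σ σ⊆F ∣F∣ i | yes (v , v∈F , v∉σ) = contradiction
      (p⊂q⇒∣p∣<∣q∣ {p = σ} {q = facet} ((λ {w} w∈σ → lookup⇒[]= w facet (σ⊆F w ([]=⇒lookup w∈σ))) , v , lookup⇒[]= v facet v∈F ,
        λ v∈σ → contradiction (trans (sym ([]=⇒lookup v∈σ)) v∉σ) λ ()))
      (ℕ.≤⇒≯ (ℕ.≤-reflexive ∣F∣))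
    H̃-link (suc k) σ σ⊆F ∣F∣ i | yes (v , v∈F , v∉σ) =
      subst (λ j → H̃ j (link Δ σ) ≅ H̃-sphere j (+ k)) (ℤ.suc-pred i)
        (≅-trans {H̃ (ℤ.suc (ℤ.pred i)) (link Δ σ)} {H̃ (ℤ.pred i) (link Δ (σ [ v ]≔ true))} {H̃-sphere (ℤ.suc (ℤ.pred i)) (+ k)}
          (link-suspension σ u v u≢v (block-x (block v)) u∉σ v∉σ (ℤ.pred i))
          (subst (λ H → H̃ (ℤ.pred i) (link Δ (σ [ v ]≔ true)) ≅ H)
            (trans (H̃-sphere-suc (ℤ.pred i) (ℤ.pred (+ k)))
                   (cong (H̃-sphere (ℤ.suc (ℤ.pred i))) (ℤ.suc-pred (+ k))))
            (H̃-link k (σ [ v ]≔ true) σ′⊆F ∣F∣′ (ℤ.pred i))))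
      where
      -- The transversal vertex in the block of `v`: it lies outside the facet, so it is never
      -- absorbed into `σ` and can serve as apex at every step.
      u = x (block v)
      u∉F = x∉facet (block v)
      u∉σ : lookup σ u ≡ false
      u∉σ = Bool.¬-not λ u∈σ → contradiction (trans (sym (σ⊆F u u∈σ)) u∉F) λ ()
      u≢v : u ≢ v
      u≢v u≡v = contradiction (trans (sym v∈F) (trans (cong (lookup facet) (sym u≡v)) u∉F)) λ ()
      σ′⊆F : ∀ w → lookup (σ [ v ]≔ true) w ≡ true → lookup facet w ≡ true
      σ′⊆F w w∈σ′ with w ≟ v
      ... | yes refl = v∈F
      ... | no w≢v   = σ⊆F w (trans (sym (lookup∘update′ w≢v σ true)) w∈σ′)
      ∣F∣′ : ∣ facet ∣ ≡ k ℕ.+ ∣ σ [ v ]≔ true ∣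
      ∣F∣′ = trans ∣F∣ (trans (sym (ℕ.+-suc k ∣ σ ∣)) (cong (k ℕ.+_) (sym (∣[]≔true∣ σ v v∉σ))))

  -- A facet omits one vertex per block, whence the dimension. The hypothesis `two` makes every
  -- singleton a face.
  isHomologySphere : ∀ {e} → n ℕ.∸ r ≡ suc e → (x : Fin r → Fin n) → (∀ k → block (x k) ≡ k) →
    (∀ v k → ∃[ y ] block y ≡ k × y ≢ v) →
    IsHomologySphere (+ e) Δ
  isHomologySphere {e} n∸r≡1+e x block-x two = record
    { isSimplicialComplex = record
      { ∅-face      = ⇒Δ λ k → x k , block-x k , lookup-replicate (x k) false
      ; vertex-face = λ v → ⇒Δ λ k → let y , y∈k , y≢v = two v k in
          y , y∈k , Bool.¬-not λ y∈⁅v⁆ → y≢v (x∈⁅y⁆⇒x≡y v (lookup⇒[]= y ⁅ v ⁆ y∈⁅v⁆))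
      ; down-closed = λ {σ} {τ} τ⊆σ Δσ → ⇒Δ λ k → let y , y∈k , y∉σ = Δ⇒ Δσ k in
          y , y∈k , Bool.¬-not λ y∈τ → contradiction (trans (sym (⊆⇒lookup τ⊆σ y y∈τ)) y∉σ) λ ()
      }
    ; dim≤e = λ σ Δσ → let open Facet (proj₁ ∘ Δ⇒ Δσ) (proj₁ ∘ proj₂ ∘ Δ⇒ Δσ) in
        ℤ.≤-trans (ℤ.+-monoˡ-≤ (ℤ.- ℤ.1ℤ) (ℤ.+≤+ (p⊆q⇒∣p∣≤∣q∣ (⊆facet {σ} (proj₂ ∘ proj₂ ∘ Δ⇒ Δσ)))))
                  (ℤ.≤-reflexive (cong (λ k → + k ℤ.- ℤ.1ℤ) (trans ∣facet∣ n∸r≡1+e)))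
    ; dim-attained = let open Facet x block-x in
        facet , ⇒Δ (λ k → x k , block-x k , x∉facet k) ,
        cong (λ k → + k ℤ.- ℤ.1ℤ) (trans ∣facet∣ n∸r≡1+e)
    ; link-homology = link-homology
    }
    where
    open ≡-Reasoning
    link-homology : ∀ σ → Δ σ → ∀ i → H̃ i (link Δ σ) ≅ H̃-sphere i (+ e ℤ.- + ∣ σ ∣)
    link-homology σ Δσ i = subst (λ e′ → H̃ i (link Δ σ) ≅ H̃-sphere i e′) (sym dimension)
      (H̃-link (suc e ℕ.∸ ∣ σ ∣) σ (⊆⇒lookup σ⊆F) ∣F∣ i)
      where
      open Facet (proj₁ ∘ Δ⇒ Δσ) (proj₁ ∘ proj₂ ∘ Δ⇒ Δσ)
      σ⊆F : σ ⊆ facet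
      σ⊆F = ⊆facet {σ} (proj₂ ∘ proj₂ ∘ Δ⇒ Δσ)
      ∣F∣≡1+e = trans ∣facet∣ n∸r≡1+e
      ∣σ∣≤1+e : ∣ σ ∣ ℕ.≤ suc e
      ∣σ∣≤1+e = subst (∣ σ ∣ ℕ.≤_) ∣F∣≡1+e (p⊆q⇒∣p∣≤∣q∣ σ⊆F)
      ∣F∣ : ∣ facet ∣ ≡ (suc e ℕ.∸ ∣ σ ∣) ℕ.+ ∣ σ ∣
      ∣F∣ = trans ∣F∣≡1+e (sym (ℕ.m∸n+n≡m ∣σ∣≤1+e))
      dimension : + e ℤ.- + ∣ σ ∣ ≡ ℤ.pred (+ (suc e ℕ.∸ ∣ σ ∣))
      dimension = begin
        + e ℤ.- + ∣ σ ∣                      ≡⟨ cong (ℤ._- + ∣ σ ∣) (ℤ.pred-suc (+ e)) ⟨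
        ℤ.pred (+ suc e) ℤ.- + ∣ σ ∣         ≡⟨ ℤ.+-assoc ℤ.-1ℤ (+ suc e) (ℤ.- + ∣ σ ∣) ⟩
        ℤ.pred (+ suc e ℤ.- + ∣ σ ∣)         ≡⟨ cong ℤ.pred (ℤ.m-n≡m⊖n (suc e) ∣ σ ∣) ⟩
        ℤ.pred (suc e ℤ.⊖ ∣ σ ∣)             ≡⟨ cong ℤ.pred (ℤ.⊖-≥ ∣σ∣≤1+e) ⟩
        ℤ.pred (+ (suc e ℕ.∸ ∣ σ ∣))         ∎

  missingFace-block : ∀ {σ} → IsMissingFace Δ σ →
    ∃[ k ] ∀ v → lookup σ v ≡ true → block v ≡ k
  missingFace-block {σ} (¬Δσ , proper) with
    any? (λ k → ¬? (any? (λ y → (block y ≟ k) ×-dec (lookup σ y Bool.≟ false))))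
  ... | no every = contradiction (⇒Δ λ k → decidable-stable
      (any? (λ y → (block y ≟ k) ×-dec (lookup σ y Bool.≟ false))) (λ none → every (k , none))) ¬Δσ
  ... | yes (k , full) = k , in-block
    where
    -- Removing a vertex outside the full block k leaves a set that still
    -- contains this block.
    in-block : ∀ v → lookup σ v ≡ true → block v ≡ k
    in-block v v∈σ = decidable-stable (block v ≟ k) λ v∉k →
      let σ′ = σ [ v ]≔ false
          σ′v = lookup∘update v σ false
          σ′⊆σ : ∀ w → lookup σ′ w ≡ true → lookup σ w ≡ true
          σ′⊆σ w w∈σ′ = trans (sym (lookup∘update′ (λ { refl → contradiction (trans (sym w∈σ′) σ′v) λ () }) σ false)) w∈σ′
          y , y∈k , y∉σ′ = Δ⇒ (proper σ′ ((λ {w} w∈σ′ → lookup⇒[]= w σ (σ′⊆σ w ([]=⇒lookup w∈σ′))) ,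
            v , lookup⇒[]= v σ v∈σ , λ v∈σ′ → contradiction (trans (sym ([]=⇒lookup v∈σ′)) σ′v) λ ())) k
      in full (y , y∈k , trans (sym (lookup∘update′ (λ y≡v → v∉k (trans (cong block (sym y≡v)) y∈k)) σ false)) y∉σ′)

-- The polytope and its proper faces.

module DirectSumPolytope {r d} (Γ : Vec (Fin (suc r)) d) (inhabited : ∀ k → ∃[ j ] lookup Γ j ≡ k) where
  open Blocks Γ
  open DirectSum Reals.orderedRing Γ
    using (full-block-maximal; affinely-spanning) renaming (vertex to p)
  open OrderedRingProperties Reals.orderedRing using (δ)
  open ConvexCombination Reals.orderedRing using (vertex-in-hull; value-cong)

  p∈hull : ∀ v → ConvexHull p (p v)
  p∈hull v = (λ w → δ w v) , vertex-in-hull p v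

  MissesEveryBlock : Subset (suc r ℕ.+ d) → Set
  MissesEveryBlock σ = ∀ k → ∃[ x ] block x ≡ k × lookup σ x ≡ false

  avoid : ∀ v k → ∃[ x ] block x ≡ k × x ≢ v
  avoid v k with root k ≟ v
  ... | no root≢v   = root k , block-root k , root≢v
  ... | yes refl    = let j , j∈k = inhabited k in
    ι j , trans (block-ι j) j∈k , root≢ι k j ∘ sym

  -- If the face contained a block, the functional would be maximal on that block, hence at all
  -- vertices by `full-block-maximal`, and the face would be the whole polytope.
  properFace⇒ : ∀ {σ} → IsProperFace p σ → MissesEveryBlock σ
  properFace⇒ {σ} (σ≢⊤ , a , b , valid , ∈⇔) k
    with any? (λ x → (block x ≟ k) ×-dec (lookup σ x Bool.≟ false))
  ... | yes x   = x
  ... | no full = contradiction (⊆-antisym ⊆⊤ λ {v} _ → Equivalence.from (∈⇔ v)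
      (full-block-maximal a b (λ v → valid (p v) (p∈hull v)) k
        (λ v v∈k → Equivalence.to (∈⇔ v) (lookup⇒[]= v σ (Bool.¬-not λ v∉σ → full (v , v∈k , v∉σ)))) v)) σ≢⊤

  module Supported σ (miss : MissesEveryBlock σ) where
    x∉σ : ∀ k → proj₁ (miss k) ∉ σ
    x∉σ k x∈σ = contradiction (trans (sym ([]=⇒lookup x∈σ)) (proj₂ (proj₂ (miss k)))) λ ()
    open SupportedFace Reals.orderedRing Γ σ (proj₁ ∘ miss) (proj₁ ∘ proj₂ ∘ miss) x∉σ public

    isValid : IsValid (ConvexHull p) normal 1ℝ
    isValid y (t , 0≤t , Σt≈1 , t·p≈y) = value-y≤1 t 0≤t Σt≈1 y t·p≈y

    isProperFace : IsProperFace p σ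
    isProperFace = (λ { refl → x∉σ zero ∈⊤ }) , normal , 1ℝ , isValid , ∈⇔value≈1

  ⁅⁆-misses : ∀ v → MissesEveryBlock ⁅ v ⁆
  ⁅⁆-misses v k = let x , x∈k , x≢v = avoid v k in
    x , x∈k , Bool.¬-not λ x∈v → x≢v (x∈⁅y⁆⇒x≡y v (lookup⇒[]= x ⁅ v ⁆ x∈v))

  polytope : SimplicialPolytope d
  polytope = record
    { #vertices        = suc r ℕ.+ d
    ; vertex           = p
    -- The functional that supports the face with the single vertex `w` takes the value 1 at no
    -- other vertex.
    ; vertex-injective = λ v w pv≋pw → let open Supported ⁅ w ⁆ (⁅⁆-misses w) in
        x∈⁅y⁆⇒x≡y w (Equivalence.from (∈⇔value≈1 v) (same-value normal v w pv≋pw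
          (Equivalence.to (∈⇔value≈1 w) (x∈⁅x⁆ w))))
    ; isVertex         = λ v → let open Supported ⁅ v ⁆ (⁅⁆-misses v) in
        p∈hull v , normal , 1ℝ , isValid , Equivalence.to (∈⇔value≈1 v) (x∈⁅x⁆ v) ,
        λ { y (t , 0≤t , Σt≈1 , t·p≈y) → maximizer t 0≤t Σt≈1 y t·p≈y v (λ w → x∈⁅y⁆⇒x≡y v) }
    ; full-dimensional = affinely-spanning refl
    ; simplicial       = λ σ σ-face t t≈0 _ t·p≈0 →
        Supported.independent σ (properFace⇒ σ-face) t t≈0 t·p≈0
    }
    where
    same-value : ∀ a v w → p v ≋ p w → dot a (p w) ≈ 1ℝ → dot a (p v) ≈ 1ℝ
    same-value a v w pv≋pw = value-cong a (p v) (p w) 1ℝ pv≋pw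

  ⇒properFace : ∀ {σ} → MissesEveryBlock σ → ∂ polytope σ
  ⇒properFace {σ} miss = Supported.isProperFace σ miss

  open BlockComplex block {∂ polytope} properFace⇒ ⇒properFace public

-- Cardinalities and squarefree monomials.

map-segments : ∀ {A B : Set} (h : A → B) m a b c e f g →
  map h (segments m a b c e f g) ≡ segments m (h a) (h b) (h c) (h e) (h f) (h g)
map-segments h m a b c e f g = trans
  (map-++ h (replicate m a ++ replicate m b ++ replicate m c ++ replicate m e ++ []) (f ∷ g ∷ []))
  (cong (_++ (h f ∷ h g ∷ []))
    (segment a (segment b (segment c (segment e refl)))))
  where
  segment : ∀ {n} x {xs : Vec _ n} {ys} → map h xs ≡ ys → map h (replicate m x ++ xs) ≡ replicate m (h x) ++ ys
  segment x {xs} eq = trans (map-++ h (replicate m x) xs) (cong₂ _++_ (map-replicate h x m) eq)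

bit : Bool → ℕ
bit b = if b then 1 else 0

∣∷∣ : ∀ {n} b (σ : Subset n) → ∣ b ∷ σ ∣ ≡ bit b ℕ.+ ∣ σ ∣
∣∷∣ true  σ = refl
∣∷∣ false σ = refl

∣replicate++∣ : ∀ {n} m b (σ : Subset n) → ∣ replicate m b ++ σ ∣ ≡ m ℕ.* bit b ℕ.+ ∣ σ ∣
∣replicate++∣ zero    b σ = refl
∣replicate++∣ (suc m) b σ = trans (∣∷∣ b (replicate m b ++ σ))
  (trans (cong (bit b ℕ.+_) (∣replicate++∣ m b σ)) (sym (ℕ.+-assoc (bit b) (m ℕ.* bit b) ∣ σ ∣)))

∣++∣ : ∀ {m n} (σ : Subset m) (τ : Subset n) → ∣ σ ++ τ ∣ ≡ ∣ σ ∣ ℕ.+ ∣ τ ∣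
∣++∣ []          τ = refl
∣++∣ (true ∷ σ)  τ = cong suc (∣++∣ σ τ)
∣++∣ (false ∷ σ) τ = ∣++∣ σ τ

∣segments∣ : ∀ m a b c e f g → ∣ segments m a b c e f g ∣ ≡
  (m ℕ.* bit a ℕ.+ (m ℕ.* bit b ℕ.+ (m ℕ.* bit c ℕ.+ (m ℕ.* bit e ℕ.+ 0)))) ℕ.+ ∣ f ∷ g ∷ [] ∣
∣segments∣ m a b c e f g = trans
  (∣++∣ (replicate m a ++ replicate m b ++ replicate m c ++ replicate m e ++ []) (f ∷ g ∷ []))
  (cong (ℕ._+ ∣ f ∷ g ∷ [] ∣) (segment a (segment b (segment c (segment e refl)))))
  where
  segment : ∀ {n} x {σ : Subset n} {s} → ∣ σ ∣ ≡ s → ∣ replicate m x ++ σ ∣ ≡ m ℕ.* bit x ℕ.+ s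
  segment x {σ} eq = trans (∣replicate++∣ m x σ) (cong (m ℕ.* bit x ℕ.+_) eq)

∣∣≤degree : ∀ {n} (τ : Subset n) μ → τ ⊆ supp μ → ∣ τ ∣ ℕ.≤ degree μ
∣∣≤degree []          []          τ⊆μ = ℕ.z≤n
∣∣≤degree (false ∷ τ) (x ∷ μ)     τ⊆μ = ℕ.m≤n⇒m≤o+n x (∣∣≤degree τ μ (drop-∷-⊆ τ⊆μ))
∣∣≤degree (true ∷ τ)  (zero ∷ μ)  τ⊆μ with () ← τ⊆μ here
∣∣≤degree (true ∷ τ)  (suc x ∷ μ) τ⊆μ = ℕ.s≤s (ℕ.m≤n⇒m≤o+n x (∣∣≤degree τ μ (drop-∷-⊆ τ⊆μ)))

-- Every vertex of `τ` uses up one unit of degree, and nothing is left over. So whether `τ`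
-- participates in a stress of degree `∣ τ ∣` depends on a single coefficient.
squarefree-unique : ∀ {n} (τ : Subset n) μ → τ ⊆ supp μ → degree μ ≡ ∣ τ ∣ → μ ≡ map bit τ
squarefree-unique []          []          τ⊆μ eq = refl
squarefree-unique (true ∷ τ)  (zero ∷ μ)  τ⊆μ eq with () ← τ⊆μ here
squarefree-unique (true ∷ τ)  (suc x ∷ μ) τ⊆μ eq =
  cong₂ _∷_ (cong suc x≡0) (squarefree-unique τ μ (drop-∷-⊆ τ⊆μ) (trans (cong (ℕ._+ degree μ) (sym x≡0)) (ℕ.suc-injective eq)))
  where
  x≡0 : x ≡ 0
  x≡0 = ℕ.n≤0⇒n≡0 (ℕ.+-cancelʳ-≤ (degree μ) x 0
    (ℕ.≤-trans (ℕ.≤-reflexive (ℕ.suc-injective eq)) (∣∣≤degree τ μ (drop-∷-⊆ τ⊆μ))))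
squarefree-unique (false ∷ τ) (x ∷ μ)     τ⊆μ eq =
  cong₂ _∷_ x≡0 (squarefree-unique τ μ (drop-∷-⊆ τ⊆μ) (trans (cong (ℕ._+ degree μ) (sym x≡0)) eq))
  where
  x≡0 : x ≡ 0
  x≡0 = ℕ.n≤0⇒n≡0 (ℕ.+-cancelʳ-≤ (degree μ) x 0
    (ℕ.≤-trans (ℕ.≤-reflexive eq) (∣∣≤degree τ μ (drop-∷-⊆ τ⊆μ))))

-- The sphere, its missing faces and the nonparticipating face.

module Example (m : ℕ) (1≤m : 1 ℕ.≤ m) where

  Γ-last : ∀ m → lookup (Γ m) ((4 ℕ.* m) ↑ʳ 0F) ≡ 2F
  Γ-last m = lookup-++ʳ (replicate m 0F ++ replicate m 0F ++ replicate m 1F ++ replicate m 1F ++ []) (2F ∷ 2F ∷ []) 0F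

  Γ-inhabited : ∀ m → 1 ℕ.≤ m → ∀ k → ∃[ j ] lookup (Γ m) j ≡ k
  Γ-inhabited m@(suc m′) _ 0F = zero , refl
  Γ-inhabited m@(suc m′) _ 1F = (m ↑ʳ (m ↑ʳ zero)) ↑ˡ 2 , trans
    (lookup-++ˡ (replicate m 0F ++ replicate m 0F ++ replicate m 1F ++ replicate m 1F ++ []) (2F ∷ 2F ∷ []) (m ↑ʳ (m ↑ʳ zero)))
    (trans (lookup-++ʳ (replicate m 0F) (replicate m 0F ++ replicate m 1F ++ replicate m 1F ++ []) (m ↑ʳ zero))
           (lookup-++ʳ (replicate m 0F) (replicate m 1F ++ replicate m 1F ++ []) zero))
  Γ-inhabited m _ 2F = (4 ℕ.* m) ↑ʳ 0F , Γ-last m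

  open Blocks (Γ m)
  open DirectSumPolytope (Γ m) (Γ-inhabited m 1≤m)

  ∂P-isHomologySphere : IsHomologySphere (+ (4 ℕ.* m ℕ.+ 1)) (∂ polytope)
  ∂P-isHomologySphere = isHomologySphere (trans (ℕ.m+n∸m≡n 3 _) (ℕ.+-suc (4 ℕ.* m) 1)) root block-root avoid

  blockSet : Fin 3 → Subset (3 ℕ.+ (4 ℕ.* m ℕ.+ 2))
  blockSet k = map (λ l → does (l ≟ k)) (allFin 3 ++ Γ m)

  ∣blockSet∣ : ∀ k → ∣ blockSet k ∣ ℕ.≤ suc (2 ℕ.* m)
  ∣blockSet∣ 0F = ℕ.≤-reflexive (cong suc (trans (trans (cong ∣_∣ (map-segments (λ l → does (l ≟ 0F)) m 0F 0F 1F 1F 2F 2F))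
    (∣segments∣ m true true false false false false))
    (solve 1 (λ m → m :* con 1 :+ (m :* con 1 :+ (m :* con 0 :+ (m :* con 0 :+ con 0))) :+ con 0 := con 2 :* m) refl m)))
    where open +-*-Solver
  ∣blockSet∣ 1F = ℕ.≤-reflexive (cong suc (trans (trans (cong ∣_∣ (map-segments (λ l → does (l ≟ 1F)) m 0F 0F 1F 1F 2F 2F))
    (∣segments∣ m false false true true false false))
    (solve 1 (λ m → m :* con 0 :+ (m :* con 0 :+ (m :* con 1 :+ (m :* con 1 :+ con 0))) :+ con 0 := con 2 :* m) refl m)))
    where open +-*-Solver
  -- The triangle has 3 vertices, which is at most 2m+1 because m is positive.
  ∣blockSet∣ 2F = ℕ.s≤s (ℕ.≤-trans (ℕ.≤-reflexive (trans (trans (cong ∣_∣ (map-segments (λ l → does (l ≟ 2F)) m 0F 0F 1F 1F 2F 2F))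
    (∣segments∣ m false false false false true true))
    (solve 1 (λ m → m :* con 0 :+ (m :* con 0 :+ (m :* con 0 :+ (m :* con 0 :+ con 0))) :+ con 2 := con 2) refl m)))
    (ℕ.*-monoʳ-≤ 2 1≤m))
    where open +-*-Solver

  missingFace-dim : ∀ σ → IsMissingFace (∂ polytope) σ → dim σ ℤ.≤ + (2 ℕ.* m)
  missingFace-dim σ missing = let k , σ∈k = missingFace-block missing in
    ℤ.+-monoˡ-≤ (ℤ.- ℤ.1ℤ) (ℤ.+≤+ (ℕ.≤-trans (p⊆q⇒∣p∣≤∣q∣ (σ⊆blockSet k σ∈k)) (∣blockSet∣ k)))
    where
    σ⊆blockSet : ∀ k → (∀ v → lookup σ v ≡ true → block v ≡ k) → σ ⊆ blockSet k
    σ⊆blockSet k σ∈k {v} v∈σ = lookup⇒[]= v (blockSet k)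
      (trans (lookup-map v (λ l → does (l ≟ k)) (allFin 3 ++ Γ m)) (dec-true (block v ≟ k) (σ∈k v ([]=⇒lookup v∈σ))))

  τ : Subset (3 ℕ.+ (4 ℕ.* m ℕ.+ 2))
  τ = middleFace m

  ∣τ∣ : ∣ τ ∣ ≡ suc (2 ℕ.* m)
  ∣τ∣ = cong suc (trans (∣segments∣ m true false true false false false)
    (solve 1 (λ m → m :* con 1 :+ (m :* con 0 :+ (m :* con 1 :+ (m :* con 0 :+ con 0))) :+ con 0 := con 2 :* m) refl m))
    where open +-*-Solver

  map-bit-τ : map bit τ ≡ middleMonomial m
  map-bit-τ = cong (λ ν → 0 ∷ 0 ∷ 1 ∷ ν) (map-segments bit m true false true false false false)

  τ-face : ∂ polytope τ
  -- The set `τ` omits the roots of both large blocks and the two vertices of the triangle that are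
  -- not its root.
  τ-face = ⇒properFace λ
    { 0F → root 0F , block-root 0F , refl
    ; 1F → root 1F , block-root 1F , refl
    ; 2F → ι j , trans (block-ι j) (Γ-last m) ,
        lookup-++ʳ (replicate m true ++ replicate m false ++ replicate m true ++ replicate m false ++ []) (false ∷ false ∷ []) 0F
    }
    where
    j : Fin (4 ℕ.* m ℕ.+ 2)
    j = (4 ℕ.* m) ↑ʳ 0F

  τ-does-not-participate : (f : Poly (3 ℕ.+ (4 ℕ.* m ℕ.+ 2))) →
    IsAffineStress (2 ℕ.* m ℕ.+ 1) (∂ polytope) (vertex polytope) f → ¬ Participates τ f
  τ-does-not-participate f stress (μ , fμ≉0 , τ⊆μ) with degree μ ℕ.≟ 2 ℕ.* m ℕ.+ 1
  ... | no deg≢ = fμ≉0 (IsAffineStress.homogeneous stress μ deg≢)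
  ... | yes deg≡ = fμ≉0 (subst (λ μ → f μ ≈ 0ℝ) (sym μ≡) coefficient≈0)
    where
    open IsAffineStress stress
    μ≡ : μ ≡ middleMonomial m
    μ≡ = trans (squarefree-unique τ μ τ⊆μ (trans deg≡ (trans (ℕ.+-comm (2 ℕ.* m) 1) (sym ∣τ∣)))) map-bit-τ

    full≈0 : ∀ μ k → (∀ v → block v ≡ k → lookup μ v ≢ 0) → f μ ≈ 0ℝ
    -- The condition `supported` speaks only of coefficients that are not 0, so the vanishing is
    -- first obtained under a double negation.
    full≈0 μ k full = Reals.≈0-stable (f μ) λ fμ≉0 →
      let v , v∈k , v∉μ = properFace⇒ (supported μ fμ≉0) k in
      full v v∈k (side≡false (trans (sym (lookup-map v side μ)) v∉μ))
      where
      side≡false : ∀ {x} → side x ≡ false → x ≡ 0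
      side≡false {zero} _ = refl

    coefficient≈0 : f (middleMonomial m) ≈ 0ℝ
    coefficient≈0 = MiddleCoefficient.middleCoefficient≈0 Reals.orderedRing m 1≤m f
      ∂θ-zero ∂𝐜-zero full≈0

corollary6p11 : (m : ℕ) → 1 ℕ.≤ m →
    Σ[ P ∈ SimplicialPolytope (4 ℕ.* m ℕ.+ 2) ]
    (S (2 ℕ.* m) (4 ℕ.* m ℕ.+ 1) (∂ P) ×
    Σ[ τ ∈ Subset (#vertices P) ]
    (∂ P τ × dim τ ≡ + (2 ℕ.* m) ×
    ((f : Poly (#vertices P)) →
    IsAffineStress (2 ℕ.* m ℕ.+ 1) (∂ P) (vertex P) f →
    ¬ Participates τ f)))
corollary6p11 m 1≤m =
  DirectSumPolytope.polytope (Γ m) (Γ-inhabited m 1≤m) ,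
  (∂P-isHomologySphere , missingFace-dim) ,
  τ , τ-face , cong (λ k → + k ℤ.- ℤ.1ℤ) ∣τ∣ , τ-does-not-participate
  where open Example m 1≤m
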